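{- Let $k$ be a positive even integer, let $m\in\mathbb{N}$, $m\ge 1$, and put $i=\frac{m}{2}$. Let $q$ be a complex number with $0<|q|<1$, and define $$T_n(q) := q^{\frac{2i-1}{2}}\,\frac{\left(q^{\frac{k}{4}-(2i-1)},\,q^{\frac{3k}{4}+(2i-1)};\,q^{k}\right)_\infty}{\left(q^{\frac{k}{4}+(2i-1)},\,q^{\frac{3k}{4}-(2i-1)};\,q^{k}\right)_\infty}=q^{\frac{2i-1}{2}}\,\frac{f\left(-q^{\frac{k}{4}-(2i-1)},-q^{\frac{3k}{4}+(2i-1)}\right)}{f\left(-q^{\frac{k}{4}+(2i-1)},-q^{\frac{3k}{4}-(2i-1)}\right)},$$ where it is assumed that the numerator and the denominator of this quotient are nonzero. Then $$\frac{1}{T_n(q)}-T_n(q)=\frac{\phi\left(q^{\frac{k}{4}}\right) f\left(-q^{2i-1},-q^{\frac{k}{2}-(2i-1)}\right)}{q^{\frac{2i-1}{2}}\,\psi\left(q^{\frac{k}{2}}\right) f\left(-q^{\frac{k}{4}-(2i-1)},-q^{\frac{k}{4}+(2i-1)}\right)}$$ and $$\frac{1}{T_n(q)}+T_n(q)=\frac{\phi\left(-q^{\frac{k}{4}}\right) f\left(q^{2i-1},q^{\frac{k}{2}-(2i-1)}\right)}{q^{\frac{2i-1}{2}}\,\psi\left(q^{\frac{k}{2}}\right) f\left(-q^{\frac{k}{4}-(2i-1)},-q^{\frac{k}{4}+(2i-1)}\right)}.$$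
   Context: For complex $\lambda$ and $|q|<1$, $(\lambda;q)_\infty=\prod_{n\ge 0}(1-\lambda q^n)$ and $(\lambda_1,\dots,\lambda_r;q)_\infty=\prod_{j=1}^r(\lambda_j;q)_\infty$. Ramanujan's general theta function is $f(a,b)=\sum_{n=-\infty}^{\infty}a^{n(n+1)/2}b^{n(n-1)/2}$ for $|ab|<1$; by Jacobi's triple product identity $f(a,b)=(-a;ab)_\infty(-b;ab)_\infty(ab;ab)_\infty$. Special cases: $\phi(q)=f(q,q)=\sum_{n=-\infty}^\infty q^{n^2}$ and $\psi(q)=f(q,q^3)=\sum_{n=0}^\infty q^{n(n+1)/2}$. A fourth root $q^{1/4}$ of $q$ is fixed once and for all, and every power $q^{r/4}$ with $r\in\mathbb{Z}$ means $(q^{1/4})^r$. The subscript $n$ in $T_n$ is only a label; the function depends on $k$ and $i$. -}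

module Defs where

open import Level using (Level; _⊔_) renaming (suc to lsuc)
open import Data.Nat.Base as ℕ using (ℕ; zero; suc)
import Data.Nat.Properties as ℕₚ
import Data.Nat.DivMod as ℕ/
import Data.Nat.Divisibility as ℕ∣
import Data.Nat.Solver as ℕSolver
open import Data.Integer.Base as ℤ using (ℤ; +_; -[1+_]; ∣_∣)
import Data.Integer.Properties as ℤₚ
import Data.Integer.Solver as ℤSolver
open import Data.Maybe.Base using (Maybe; just; nothing)
open import Data.Product.Base using (Σ; Σ-syntax; ∃-syntax; _×_; _,_; proj₁; proj₂)
open import Data.Sum.Base using (_⊎_; inj₁; inj₂)
open import Data.Empty using (⊥-elim)
open import Function.Base using (_∘_)
open import Function.Bundles using (_⇔_; Equivalence)
open import Relation.Nullary using (¬_; yes; no)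
open import Relation.Binary.Core using (Rel)
open import Relation.Binary.Structures using (IsStrictPartialOrder)
open import Relation.Binary.PropositionalEquality as ≡ using (_≡_)
open import Algebra.Bundles using (CommutativeRing; RawRing; Semiring)
open import Algebra.Apartness.Bundles using (HeytingField; HeytingCommutativeRing)
import Algebra.Apartness.Properties.HeytingCommutativeRing as HCRₚ
import Algebra.Definitions.RawSemiring as RawSemiringDefs
import Algebra.Properties.Ring as Ringₚ
import Algebra.Properties.Semiring.Exp as Expₚ
import Algebra.Properties.CommutativeSemiring.Exp as CExpₚ
import Algebra.Properties.Semiring.Mult.TCOptimised as Multₚ
import Algebra.Solver.Ring as RingSolver
open import Algebra.Solver.Ring.AlmostCommutativeRing
  using (fromCommutativeRing; _-Raw-AlmostCommutative⟶_)
import Relation.Binary.Reasoning.Setoid as SetoidReasoning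

module Solve {c ℓ : Level} (R : CommutativeRing c ℓ) where
  open CommutativeRing R
  open Multₚ semiring using (1+×; ×-homo-+; ×1-homo-*) renaming (_×_ to _·_)
  open Ringₚ ring
  open SetoidReasoning setoid

  ⟦_⟧ℤ : ℤ → Carrier
  ⟦ + n ⟧ℤ      = n · 1#
  ⟦ -[1+ n ] ⟧ℤ = - (suc n · 1#)

  private
    cancel : ∀ u v w → (u + v) - (u + w) ≈ v - w
    cancel u v w = begin
      (u + v) - (u + w)        ≈⟨ +-congˡ (-‿+-comm u w) ⟨
      (u + v) + (- u + - w)    ≈⟨ +-congʳ (+-comm u v) ⟩
      (v + u) + (- u + - w)    ≈⟨ +-assoc v u _ ⟩
      v + (u + (- u + - w))    ≈⟨ +-congˡ (+-assoc u (- u) (- w)) ⟨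
      v + ((u + - u) + - w)    ≈⟨ +-congˡ (+-congʳ (-‿inverseʳ u)) ⟩
      v + (0# + - w)           ≈⟨ +-congˡ (+-identityˡ _) ⟩
      v - w                    ∎

    ⊖-homo : ∀ m n → ⟦ m ℤ.⊖ n ⟧ℤ ≈ m · 1# - n · 1#
    ⊖-homo zero zero = begin
      0#          ≈⟨ -‿inverseʳ 0# ⟨
      0# - 0#     ∎
    ⊖-homo zero (suc n) = sym (+-identityˡ _)
    ⊖-homo (suc m) zero = begin
      suc m · 1#        ≈⟨ +-identityʳ _ ⟨
      suc m · 1# + 0#   ≈⟨ +-congˡ -0#≈0# ⟨
      suc m · 1# - 0#   ∎
    ⊖-homo (suc m) (suc n) = begin
      ⟦ suc m ℤ.⊖ suc n ⟧ℤ            ≡⟨ ≡.cong ⟦_⟧ℤ (ℤₚ.[1+m]⊖[1+n]≡m⊖n m n) ⟩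
      ⟦ m ℤ.⊖ n ⟧ℤ                    ≈⟨ ⊖-homo m n ⟩
      m · 1# - n · 1#                 ≈⟨ cancel 1# _ _ ⟨
      (1# + m · 1#) - (1# + n · 1#)   ≈⟨ +-cong (1+× m 1#) (-‿cong (1+× n 1#)) ⟨
      suc m · 1# - suc n · 1#         ∎

    neg-homo : ∀ x → ⟦ ℤ.- x ⟧ℤ ≈ - ⟦ x ⟧ℤ
    neg-homo (+ zero)  = sym -0#≈0#
    neg-homo (+ suc n) = refl
    neg-homo -[1+ n ]  = sym (-‿involutive _)

    +-homo : ∀ x y → ⟦ x ℤ.+ y ⟧ℤ ≈ ⟦ x ⟧ℤ + ⟦ y ⟧ℤ
    +-homo (+ m)    (+ n)    = ×-homo-+ 1# m n
    +-homo (+ m)    -[1+ n ] = ⊖-homo m (suc n)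
    +-homo -[1+ m ] (+ n)    = trans (⊖-homo n (suc m)) (+-comm _ _)
    +-homo -[1+ m ] -[1+ n ] = begin
      - (suc (suc (m ℕ.+ n)) · 1#)      ≡⟨ ≡.cong (λ j → - (suc j · 1#)) (ℕₚ.+-suc m n) ⟨
      - ((suc m ℕ.+ suc n) · 1#)        ≈⟨ -‿cong (×-homo-+ 1# (suc m) (suc n)) ⟩
      - (suc m · 1# + suc n · 1#)       ≈⟨ -‿+-comm _ _ ⟨
      - (suc m · 1#) + - (suc n · 1#)   ∎

    *-homo⁺ : ∀ m y → ⟦ + m ℤ.* y ⟧ℤ ≈ m · 1# * ⟦ y ⟧ℤ
    *-homo⁺ m (+ n) = begin
      ⟦ + m ℤ.* + n ⟧ℤ   ≡⟨ ≡.cong ⟦_⟧ℤ (ℤₚ.pos-* m n) ⟨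
      (m ℕ.* n) · 1#     ≈⟨ ×1-homo-* m n ⟩
      m · 1# * n · 1#    ∎
    *-homo⁺ m -[1+ n ] = begin
      ⟦ + m ℤ.* (ℤ.- (+ suc n)) ⟧ℤ  ≡⟨ ≡.cong ⟦_⟧ℤ (ℤₚ.neg-distribʳ-* (+ m) (+ suc n)) ⟨
      ⟦ ℤ.- (+ m ℤ.* + suc n) ⟧ℤ    ≈⟨ neg-homo (+ m ℤ.* + suc n) ⟩
      - ⟦ + m ℤ.* + suc n ⟧ℤ        ≈⟨ -‿cong (*-homo⁺ m (+ suc n)) ⟩
      - (m · 1# * suc n · 1#)       ≈⟨ -‿distribʳ-* _ _ ⟩
      m · 1# * - (suc n · 1#)       ∎

    *-homo : ∀ x y → ⟦ x ℤ.* y ⟧ℤ ≈ ⟦ x ⟧ℤ * ⟦ y ⟧ℤ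
    *-homo (+ m)    y = *-homo⁺ m y
    *-homo -[1+ m ] y = begin
      ⟦ (ℤ.- (+ suc m)) ℤ.* y ⟧ℤ    ≡⟨ ≡.cong ⟦_⟧ℤ (ℤₚ.neg-distribˡ-* (+ suc m) y) ⟨
      ⟦ ℤ.- (+ suc m ℤ.* y) ⟧ℤ      ≈⟨ neg-homo (+ suc m ℤ.* y) ⟩
      - ⟦ + suc m ℤ.* y ⟧ℤ          ≈⟨ -‿cong (*-homo⁺ (suc m) y) ⟩
      - (suc m · 1# * ⟦ y ⟧ℤ)       ≈⟨ -‿distribˡ-* _ _ ⟩
      - (suc m · 1#) * ⟦ y ⟧ℤ       ∎

    ℤ-rawRing : RawRing _ _
    ℤ-rawRing = CommutativeRing.rawRing ℤₚ.+-*-commutativeRing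

    morphism : ℤ-rawRing -Raw-AlmostCommutative⟶ fromCommutativeRing R
    morphism = record
      { ⟦_⟧ = ⟦_⟧ℤ ; +-homo = +-homo ; *-homo = *-homo ; -‿homo = neg-homo
      ; 0-homo = refl ; 1-homo = refl }

    coeff≟ : ∀ x y → Maybe (⟦ x ⟧ℤ ≈ ⟦ y ⟧ℤ)
    coeff≟ x y with x ℤₚ.≟ y
    ... | yes x≡y = just (reflexive (≡.cong ⟦_⟧ℤ x≡y))
    ... | no _    = nothing

  open RingSolver ℤ-rawRing (fromCommutativeRing R) morphism coeff≟ public
    using (Polynomial; solve; _:=_; con; _:+_; _:*_; :-_; _:-_)

  :0 :1 : ∀ {n} → Polynomial n
  :0 = con (+ 0)
  :1 = con (+ 1)

-- Proved over an abstract ring, as the solver is slow on the concrete ring ℂ.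
module RingIdentities {c ℓ : Level} (R : CommutativeRing c ℓ) where
  open CommutativeRing R
  open Solve R

  0≈x-x : ∀ x → 0# ≈ x - x
  0≈x-x = solve 1 (λ x → :0 := x :- x) refl

  [x-y]+[y-z] : ∀ x y z → (x - y) + (y - z) ≈ x - z
  [x-y]+[y-z] = solve 3 (λ x y z → (x :- y) :+ (y :- z) := x :- z) refl

  -[x-y] : ∀ x y → - (x - y) ≈ y - x
  -[x-y] = solve 2 (λ x y → :- (x :- y) := y :- x) refl

  series-step : ∀ S u v r → v ≈ u * r → ((S + u) + v) - (S + u) ≈ ((S + u) - S) * r
  series-step S u v r v≈ur = trans (last (S + u) v) (trans v≈ur (*-congʳ (sym (last S u))))
    where
    last : ∀ z w → (z + w) - z ≈ w
    last = solve 2 (λ z w → (z :+ w) :- z := w) refl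

  product-step : ∀ p a q x →
    (p * (1# - a * x)) * (1# - a * (q * x)) - p * (1# - a * x)
    ≈ (p * (1# - a * x) - p) * ((1# - a * x) * q)
  product-step = solve 4 (λ p a q x →
    (p :* (:1 :- a :* x)) :* (:1 :- a :* (q :* x)) :- p :* (:1 :- a :* x)
    := (p :* (:1 :- a :* x) :- p) :* ((:1 :- a :* x) :* q)) refl

  open Expₚ (CommutativeRing.semiring R) using (^-homo-*)
  open CExpₚ (CommutativeRing.commutativeSemiring R) using (^-distrib-*)
  open RawSemiringDefs (Semiring.rawSemiring (CommutativeRing.semiring R)) using (_^_)
  open SetoidReasoning setoid

  theta-step : ∀ a b m n A B →
    a ^ (m ℕ.+ A) * b ^ (n ℕ.+ B) ≈ (a ^ A * b ^ B) * (a ^ m * b ^ n)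
  theta-step a b m n A B = begin
    a ^ (m ℕ.+ A) * b ^ (n ℕ.+ B)       ≈⟨ *-cong (^-homo-* a m A) (^-homo-* b n B) ⟩
    (a ^ m * a ^ A) * (b ^ n * b ^ B)   ≈⟨ solve 4 (λ x y z w → (x :* y) :* (z :* w)
                                             := (y :* w) :* (x :* z)) refl _ _ _ _ ⟩
    (a ^ A * b ^ B) * (a ^ m * b ^ n)   ∎

  ratio⁺ : ∀ a b n → a ^ suc n * b ^ n ≈ a * (a * b) ^ n
  ratio⁺ a b n = trans (*-assoc _ _ _) (*-congˡ (sym (^-distrib-* a b n)))

  ratio⁻ : ∀ a b n → a ^ suc n * b ^ (2 ℕ.+ n) ≈ (b * (a * b)) * (a * b) ^ n
  ratio⁻ a b n = trans
    (solve 4 (λ a b x y → (a :* x) :* (b :* (b :* y)) := (b :* (a :* b)) :* (x :* y))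
      refl a b (a ^ n) (b ^ n))
    (*-congˡ (sym (^-distrib-* a b n)))

  theta-step⁺ : ∀ a b n {A B A′ B′} → A′ ≡ suc n ℕ.+ A → B′ ≡ n ℕ.+ B →
    a ^ A′ * b ^ B′ ≈ (a ^ A * b ^ B) * (a * (a * b) ^ n)
  theta-step⁺ a b n {A} {B} ≡.refl ≡.refl =
    trans (theta-step a b (suc n) n A B) (*-congˡ (ratio⁺ a b n))

  theta-step⁻ : ∀ a b n {A B A′ B′} → A′ ≡ suc n ℕ.+ A → B′ ≡ 2 ℕ.+ n ℕ.+ B →
    a ^ A′ * b ^ B′ ≈ (a ^ A * b ^ B) * ((b * (a * b)) * (a * b) ^ n)
  theta-step⁻ a b n {A} {B} ≡.refl ≡.refl =
    trans (theta-step a b (suc n) (2 ℕ.+ n) A B) (*-congˡ (ratio⁻ a b n))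

  module IntegerPower {r s : Carrier} (rs≈1 : r * s ≈ 1#) where
    pow : ℤ → Carrier
    pow (+ n)    = r ^ n
    pow -[1+ n ] = s ^ suc n

    pow-⊖ : ∀ m n → pow (m ℤ.⊖ n) ≈ r ^ m * s ^ n
    pow-⊖ zero    zero    = sym (*-identityˡ 1#)
    pow-⊖ zero    (suc n) = sym (*-identityˡ _)
    pow-⊖ (suc m) zero    = sym (*-identityʳ _)
    pow-⊖ (suc m) (suc n) = begin
      pow (suc m ℤ.⊖ suc n)       ≡⟨ ≡.cong pow (ℤₚ.[1+m]⊖[1+n]≡m⊖n m n) ⟩
      pow (m ℤ.⊖ n)               ≈⟨ pow-⊖ m n ⟩
      r ^ m * s ^ n               ≈⟨ *-identityˡ _ ⟨
      1# * (r ^ m * s ^ n)        ≈⟨ *-congʳ rs≈1 ⟨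
      (r * s) * (r ^ m * s ^ n)   ≈⟨ solve 4 (λ r s x y → (r :* s) :* (x :* y)
                                       := (r :* x) :* (s :* y)) refl r s (r ^ m) (s ^ n) ⟩
      r ^ suc m * s ^ suc n       ∎

    pow-homo : ∀ x y → pow (x ℤ.+ y) ≈ pow x * pow y
    pow-homo (+ m)    (+ n)    = ^-homo-* r m n
    pow-homo (+ m)    -[1+ n ] = pow-⊖ m (suc n)
    pow-homo -[1+ m ] (+ n)    = trans (pow-⊖ n (suc m)) (*-comm _ _)
    pow-homo -[1+ m ] -[1+ n ] = trans
      (reflexive (≡.cong (λ j → s ^ suc j) (≡.sym (ℕₚ.+-suc m n))))
      (^-homo-* s (suc m) (suc n))

  -x*-y : ∀ x y → (- x) * (- y) ≈ x * y
  -x*-y = solve 2 (λ x y → (:- x) :* (:- y) := x :* y) refl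

-- A Cauchy complete Archimedean ordered field; classically, ℝ is the only
-- one up to isomorphism.  The axioms are the constructive ones
-- (the order is not assumed decidable), so that the setoid of Cauchy sequences
-- of rationals with a modulus is an instance.
record RealField (c ℓ₁ ℓ₂ : Level) : Set (lsuc (c ⊔ ℓ₁ ⊔ ℓ₂)) where
  infix 4 _<_ _⟶_
  field
    heytingField : HeytingField c ℓ₁ ℓ₂
  open HeytingField heytingField public
  open HeytingCommutativeRing heytingCommutativeRing public using (commutativeRing)
  open RawSemiringDefs (Semiring.rawSemiring (CommutativeRing.semiring commutativeRing)) public
    using (_^_) renaming (_×_ to _·_)
  field
    _<_                  : Rel Carrier ℓ₂
    isStrictPartialOrder : IsStrictPartialOrder _≈_ _<_
    #⇔<⊎>                : ∀ {x y} → x # y ⇔ (x < y ⊎ y < x)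
    +-monoˡ-<            : ∀ {x y} z → x < y → x + z < y + z
    *-pos                : ∀ {x y} → 0# < x → 0# < y → 0# < x * y
    archimedean          : ∀ x → ∃[ n ] x < n · 1#

  -- As m and n are interchangeable, the bound is one on the absolute value.
  Cauchy : (ℕ → Carrier) → Set (c ⊔ ℓ₂)
  Cauchy s = ∀ ε → 0# < ε →
    ∃[ N ] (∀ m n → N ℕ.≤ m → N ℕ.≤ n → s m - s n < ε)

  _⟶_ : (ℕ → Carrier) → Carrier → Set (c ⊔ ℓ₂)
  s ⟶ x = ∀ ε → 0# < ε →
    ∃[ N ] (∀ n → N ℕ.≤ n → s n - x < ε × x - s n < ε)

  field
    complete : ∀ s → Cauchy s → ∃[ x ] s ⟶ x

module Order {c ℓ₁ ℓ₂ : Level} (ℝ : RealField c ℓ₁ ℓ₂) where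
  open RealField ℝ
  open IsStrictPartialOrder isStrictPartialOrder public
    using (<-respˡ-≈; <-respʳ-≈)
    renaming (irrefl to <-irrefl; trans to <-trans; asym to <-asym)
  open HCRₚ heytingCommutativeRing using (1#0; #-congʳ; invertibleʳ⇒#)
  open Solve commutativeRing

  infix 4 _≤_

  _≤_ : Rel Carrier ℓ₂
  x ≤ y = ¬ (y < x)

  <-resp : ∀ {x x′ y y′} → x ≈ x′ → y ≈ y′ → x < y → x′ < y′
  <-resp p r h = <-respˡ-≈ p (<-respʳ-≈ r h)

  ≤-resp : ∀ {x x′ y y′} → x ≈ x′ → y ≈ y′ → x ≤ y → x′ ≤ y′
  ≤-resp p r h h′ = h (<-resp (sym r) (sym p) h′)

  ≤-refl : ∀ {x} → x ≤ x
  ≤-refl = <-irrefl refl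

  ≤-reflexive : ∀ {x y} → x ≈ y → x ≤ y
  ≤-reflexive p = ≤-resp refl p ≤-refl

  <⇒≤ : ∀ {x y} → x < y → x ≤ y
  <⇒≤ = <-asym

  <-cotrans : ∀ {x y} → x < y → ∀ z → x < z ⊎ z < y
  <-cotrans {x} {y} x<y z with #-cotrans (Equivalence.from #⇔<⊎> (inj₁ x<y)) z
  ... | inj₁ x#z with Equivalence.to #⇔<⊎> x#z
  ...   | inj₁ x<z = inj₁ x<z
  ...   | inj₂ z<x = inj₂ (<-trans z<x x<y)
  <-cotrans {x} {y} x<y z | inj₂ z#y with Equivalence.to #⇔<⊎> z#y
  ...   | inj₁ z<y = inj₂ z<y
  ...   | inj₂ y<z = inj₁ (<-trans x<y y<z)

  ≤-<-trans : ∀ {x y z} → x ≤ y → y < z → x < z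
  ≤-<-trans {x} x≤y y<z with <-cotrans y<z x
  ... | inj₁ y<x = ⊥-elim (x≤y y<x)
  ... | inj₂ x<z = x<z

  <-≤-trans : ∀ {x y z} → x < y → y ≤ z → x < z
  <-≤-trans {z = z} x<y y≤z with <-cotrans x<y z
  ... | inj₁ x<z = x<z
  ... | inj₂ z<y = ⊥-elim (y≤z z<y)

  ≤-trans : ∀ {x y z} → x ≤ y → y ≤ z → x ≤ z
  ≤-trans x≤y y≤z z<x = y≤z (<-≤-trans z<x x≤y)

  x<y⇒0<y-x : ∀ {x y} → x < y → 0# < y - x
  x<y⇒0<y-x {x} x<y = <-resp (-‿inverseʳ x) refl (+-monoˡ-< (- x) x<y)

  0<y-x⇒x<y : ∀ {x y} → 0# < y - x → x < y
  0<y-x⇒x<y {x} {y} h = <-resp (+-identityˡ x)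
    (solve 2 (λ x y → (y :- x) :+ x := y) refl x y) (+-monoˡ-< x h)

  +-monoˡ-≤ : ∀ {x y} z → x ≤ y → x + z ≤ y + z
  +-monoˡ-≤ {x} {y} z x≤y h = x≤y (<-resp (e y) (e x) (+-monoˡ-< (- z) h))
    where e = λ w → solve 2 (λ w z → (w :+ z) :- z := w) refl w z

  +-mono-≤ : ∀ {x y u v} → x ≤ y → u ≤ v → x + u ≤ y + v
  +-mono-≤ {x} {y} {u} {v} x≤y u≤v = ≤-trans (+-monoˡ-≤ u x≤y)
    (≤-resp (+-comm u y) (+-comm v y) (+-monoˡ-≤ y u≤v))

  x≤y⇒0≤y-x : ∀ {x y} → x ≤ y → 0# ≤ y - x
  x≤y⇒0≤y-x {x} x≤y = ≤-resp (-‿inverseʳ x) refl (+-monoˡ-≤ (- x) x≤y)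

  0≤y-x⇒x≤y : ∀ {x y} → 0# ≤ y - x → x ≤ y
  0≤y-x⇒x≤y {x} {y} h = ≤-resp (+-identityˡ x)
    (solve 2 (λ x y → (y :- x) :+ x := y) refl x y) (+-monoˡ-≤ x h)

  x≤x+y : ∀ {x y} → 0# ≤ y → x ≤ x + y
  x≤x+y {x} 0≤y = ≤-resp (+-identityʳ x) refl (+-mono-≤ ≤-refl 0≤y)

  x<0⇒0<-x : ∀ {x} → x < 0# → 0# < - x
  x<0⇒0<-x x<0 = <-resp refl (+-identityˡ _) (x<y⇒0<y-x x<0)

  0<x⇒-x<0 : ∀ {x} → 0# < x → - x < 0#
  0<x⇒-x<0 {x} 0<x = <-resp (+-identityˡ _) (-‿inverseʳ x) (+-monoˡ-< (- x) 0<x)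

  *-#0⇒#0 : ∀ {x y} → x * y # 0# → x # 0#
  *-#0⇒#0 {x} {y} xy#0 with #⇒invertible xy#0
  ... | i , i*xy≈1 , _ = invertibleʳ⇒# {x} {0#} (y * i , trans
    (solve 3 (λ x y i → (x :- :0) :* (y :* i) := i :* (x :* y :- :0)) refl x y i)
    i*xy≈1)

  0≤∧#⇒0< : ∀ {x} → 0# ≤ x → x # 0# → 0# < x
  0≤∧#⇒0< 0≤x x#0 with Equivalence.to #⇔<⊎> x#0
  ... | inj₁ x<0 = ⊥-elim (0≤x x<0)
  ... | inj₂ 0<x = 0<x

  0<⇒#0 : ∀ {x} → 0# < x → x # 0#
  0<⇒#0 0<x = Equivalence.from #⇔<⊎> (inj₂ 0<x)

  *-nonneg : ∀ {x y} → 0# ≤ x → 0# ≤ y → 0# ≤ x * y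
  *-nonneg {x} {y} 0≤x 0≤y xy<0 = <-asym xy<0 (*-pos
    (0≤∧#⇒0< 0≤x (*-#0⇒#0 xy#0))
    (0≤∧#⇒0< 0≤y (*-#0⇒#0 (#-congʳ (*-comm x y) xy#0))))
    where xy#0 = Equivalence.from #⇔<⊎> (inj₁ xy<0)

  sq-nonneg : ∀ x → 0# ≤ x * x
  sq-nonneg x x²<0 = impossible
    (Equivalence.to #⇔<⊎> (*-#0⇒#0 (Equivalence.from #⇔<⊎> (inj₁ x²<0))))
    where
    impossible : ¬ (x < 0# ⊎ 0# < x)
    impossible (inj₂ 0<x) = <-asym x²<0 (*-pos 0<x 0<x)
    impossible (inj₁ x<0) = <-asym x²<0 (<-resp refl
      (solve 1 (λ x → (:- x) :* (:- x) := x :* x) refl x)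
      (*-pos (x<0⇒0<-x x<0) (x<0⇒0<-x x<0)))

  0<1 : 0# < 1#
  0<1 = 0≤∧#⇒0< (≤-resp refl (*-identityˡ 1#) (sq-nonneg 1#)) 1#0

  *-monoʳ-≤ : ∀ {x y z} → 0# ≤ z → x ≤ y → z * x ≤ z * y
  *-monoʳ-≤ {x} {y} {z} 0≤z x≤y = 0≤y-x⇒x≤y (≤-resp refl
    (solve 3 (λ x y z → z :* (y :- x) := z :* y :- z :* x) refl x y z)
    (*-nonneg 0≤z (x≤y⇒0≤y-x x≤y)))

  *-mono-≤ : ∀ {x y u v} → 0# ≤ x → 0# ≤ v → x ≤ y → u ≤ v → x * u ≤ y * v
  *-mono-≤ {x} {y} {u} {v} 0≤x 0≤v x≤y u≤v = ≤-trans (*-monoʳ-≤ 0≤x u≤v)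
    (≤-resp (*-comm v x) (*-comm v y) (*-monoʳ-≤ 0≤v x≤y))

  *-cancelˡ-< : ∀ {x y z} → 0# ≤ z → z * x < z * y → x < y
  *-cancelˡ-< {x} {y} {z} 0≤z zx<zy = 0<y-x⇒x<y (0≤∧#⇒0< 0≤y-x
    (*-#0⇒#0 (#-congʳ (*-comm z (y - x)) (0<⇒#0 0<z[y-x]))))
    where
    0<z[y-x] : 0# < z * (y - x)
    0<z[y-x] = <-resp refl
      (solve 3 (λ x y z → z :* y :- z :* x := z :* (y :- x)) refl x y z) (x<y⇒0<y-x zx<zy)
    0≤y-x : 0# ≤ y - x
    0≤y-x h = *-nonneg 0≤z (<⇒≤ (x<0⇒0<-x h)) (<-resp
      (solve 2 (λ z w → :- (z :* w) := z :* (:- w)) refl z (y - x)) refl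
      (0<x⇒-x<0 0<z[y-x]))

  abstract
    inverse : ∀ {x} → 0# < x → ∃[ y ] (0# < y × x * y ≈ 1#)
    inverse {x} 0<x with #⇒invertible (0<⇒#0 0<x)
    ... | y , yx≈1 , _ = y , *-cancelˡ-< (<⇒≤ 0<x) x0<xy , xy≈1
      where
      xy≈1 : x * y ≈ 1#
      xy≈1 = trans (solve 2 (λ x y → x :* y := y :* (x :- :0)) refl x y) yx≈1
      x0<xy : x * 0# < x * y
      x0<xy = <-resp (sym (zeroʳ x)) (sym xy≈1) 0<1

  sq-cancel-≤ : ∀ {x t} → 0# ≤ t → x * x ≤ t * t → x ≤ t
  sq-cancel-≤ {x} {t} 0≤t x²≤t² t<x = x²≤t² (0<y-x⇒x<y (<-resp refl
    (solve 2 (λ x t → (x :- t) :* (x :+ t) := x :* x :- t :* t) refl x t)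
    (*-pos (x<y⇒0<y-x t<x) (<-≤-trans (≤-<-trans 0≤t t<x) (x≤x+y 0≤t)))))

  abstract
    ½ : Carrier
    ½ = proj₁ (inverse (<-≤-trans 0<1 (x≤x+y (<⇒≤ 0<1))))

    0<½ : 0# < ½
    0<½ = proj₁ (proj₂ (inverse (<-≤-trans 0<1 (x≤x+y (<⇒≤ 0<1)))))

    ½+½≈1 : ½ + ½ ≈ 1#
    ½+½≈1 = trans (solve 1 (λ h → h :+ h := (:1 :+ :1) :* h) refl ½)
      (proj₂ (proj₂ (inverse (<-≤-trans 0<1 (x≤x+y (<⇒≤ 0<1))))))

  ^-nonneg : ∀ {τ} → 0# ≤ τ → ∀ n → 0# ≤ τ ^ n
  ^-nonneg 0≤τ zero    = <⇒≤ 0<1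
  ^-nonneg 0≤τ (suc n) = *-nonneg 0≤τ (^-nonneg 0≤τ n)

  ^-suc-≤ : ∀ {τ} → 0# ≤ τ → τ ≤ 1# → ∀ n → τ ^ suc n ≤ τ ^ n
  ^-suc-≤ 0≤τ τ≤1 n = ≤-resp refl (*-identityˡ _)
    (*-mono-≤ 0≤τ (^-nonneg 0≤τ n) τ≤1 ≤-refl)

  ^-anti-≤ : ∀ {τ} → 0# ≤ τ → τ ≤ 1# → ∀ k n → τ ^ (k ℕ.+ n) ≤ τ ^ n
  ^-anti-≤ 0≤τ τ≤1 zero    n = ≤-refl
  ^-anti-≤ 0≤τ τ≤1 (suc k) n = ≤-trans (^-suc-≤ 0≤τ τ≤1 (k ℕ.+ n)) (^-anti-≤ 0≤τ τ≤1 k n)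

  ^-≤1 : ∀ {τ} → 0# ≤ τ → τ ≤ 1# → ∀ n → τ ^ n ≤ 1#
  ^-≤1 0≤τ τ≤1 zero    = ≤-refl
  ^-≤1 0≤τ τ≤1 (suc n) = ≤-trans (^-suc-≤ 0≤τ τ≤1 n) (^-≤1 0≤τ τ≤1 n)

  fromℕ-nonneg : ∀ n → 0# ≤ n · 1#
  fromℕ-nonneg zero    = ≤-refl
  fromℕ-nonneg (suc n) = ≤-trans (<⇒≤ 0<1) (x≤x+y (fromℕ-nonneg n))

  -- n τⁿ (1 - τ) ≤ (1 - τ) (1 + τ + ⋯ + τⁿ⁻¹) = 1 - τⁿ
  n*τ^n-≤ : ∀ {τ} → 0# ≤ τ → τ ≤ 1# → ∀ n →
            (n · 1#) * (τ ^ n * (1# - τ)) ≤ 1# - τ ^ n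
  n*τ^n-≤ {τ} 0≤τ τ≤1 zero = ≤-reflexive
    (solve 1 (λ t → :0 :* (:1 :* (:1 :- t)) := :1 :- :1) refl τ)
  n*τ^n-≤ {τ} 0≤τ τ≤1 (suc n) = ≤-resp
    (solve 3 (λ t p k →
        t :* (k :* (p :* (:1 :- t))) :+ (t :* p) :* (:1 :- t)
        := (:1 :+ k) :* ((t :* p) :* (:1 :- t))) refl τ (τ ^ n) (n · 1#))
    (solve 2 (λ t p → t :* (:1 :- p) :+ :1 :* (:1 :- t) := :1 :- t :* p) refl τ (τ ^ n))
    (+-mono-≤ (*-monoʳ-≤ 0≤τ (n*τ^n-≤ 0≤τ τ≤1 n))
              (*-mono-≤ (^-nonneg 0≤τ (suc n)) (x≤y⇒0≤y-x τ≤1) (^-≤1 0≤τ τ≤1 (suc n)) ≤-refl))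

  geometric-small : ∀ {τ} → 0# ≤ τ → τ < 1# → ∀ {C ε} → 0# ≤ C → 0# < ε →
                    ∃[ n ] C * τ ^ n < ε
  geometric-small {τ} 0≤τ τ<1 {C} {ε} 0≤C 0<ε = n , *-cancelˡ-< (*-nonneg (fromℕ-nonneg n) (<⇒≤ 0<δ))
    (≤-<-trans lower upper)
    where
    δ = 1# - τ
    0<δ = x<y⇒0<y-x τ<1
    inv = inverse (*-pos 0<δ 0<ε)
    y = proj₁ inv
    arch = archimedean (C * y)
    n = proj₁ arch
    lower : (n · 1#) * δ * (C * τ ^ n) ≤ C
    lower = ≤-resp
      (solve 4 (λ k t p c → c :* (k :* (p :* (:1 :- t))) := k :* (:1 :- t) :* (c :* p))
        refl (n · 1#) τ (τ ^ n) C)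
      (*-identityʳ C)
      (*-monoʳ-≤ 0≤C (≤-trans (n*τ^n-≤ 0≤τ (<⇒≤ τ<1) n)
        (≤-resp refl (solve 2 (λ o p → (o :- p) :+ p := o) refl 1# (τ ^ n))
          (x≤x+y (^-nonneg 0≤τ n)))))
    upper : C < (n · 1#) * δ * ε
    upper = *-cancelˡ-< (<⇒≤ (proj₁ (proj₂ inv))) (<-resp (*-comm C y)
      (trans (sym (trans (*-congˡ (proj₂ (proj₂ inv))) (*-identityʳ _)))
        (solve 4 (λ k d e y → k :* ((d :* e) :* y) := y :* (k :* d :* e)) refl (n · 1#) δ ε y))
      (proj₂ arch))

module Complex {c ℓ₁ ℓ₂ : Level} (ℝ : RealField c ℓ₁ ℓ₂) where
  private
    module R = RealField ℝ
    module S = Solve R.commutativeRing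
  open Order ℝ
  open S using (_:=_; _:+_; _:*_; :-_; _:-_; :0; :1)
  open R using () renaming (Carrier to ∣ℝ∣; _<_ to _<ℝ_; 0# to 0ℝ; 1# to 1ℝ)

  record ℂ : Set c where
    constructor _+i_
    field
      re : ∣ℝ∣
      im : ∣ℝ∣
  open ℂ public

  infix  4 _≈ℂ_
  infixl 6 _+ℂ_
  infixl 7 _*ℂ_

  record _≈ℂ_ (z w : ℂ) : Set ℓ₁ where
    constructor _,_
    field
      re-≈ : re z R.≈ re w
      im-≈ : im z R.≈ im w

  _+ℂ_ _*ℂ_ : ℂ → ℂ → ℂ
  (x +i y) +ℂ (u +i v) = (x R.+ u) +i (y R.+ v)
  (x +i y) *ℂ (u +i v) = (x R.* u R.- y R.* v) +i (x R.* v R.+ y R.* u)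

  -ℂ_ : ℂ → ℂ
  -ℂ (x +i y) = (R.- x) +i (R.- y)

  ℂ-commutativeRing : CommutativeRing c ℓ₁
  ℂ-commutativeRing = record
    { Carrier = ℂ ; _≈_ = _≈ℂ_ ; _+_ = _+ℂ_ ; _*_ = _*ℂ_ ; -_ = -ℂ_
    ; 0# = 0ℝ +i 0ℝ ; 1# = 1ℝ +i 0ℝ
    ; isCommutativeRing = record
      { isRing = record
        { +-isAbelianGroup = record
          { isGroup = record
            { isMonoid = record
              { isSemigroup = record
                { isMagma = record
                  { isEquivalence = record
                    { refl  = R.refl , R.refl
                    ; sym   = λ (p , r) → R.sym p , R.sym r
                    ; trans = λ (p , r) (p′ , r′) → R.trans p p′ , R.trans r r′ }
                  ; ∙-cong = λ (p , r) (p′ , r′) → R.+-cong p p′ , R.+-cong r r′ }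
                ; assoc = λ _ _ _ → R.+-assoc _ _ _ , R.+-assoc _ _ _ }
              ; identity = (λ _ → R.+-identityˡ _ , R.+-identityˡ _)
                         , (λ _ → R.+-identityʳ _ , R.+-identityʳ _) }
            ; inverse = (λ _ → R.-‿inverseˡ _ , R.-‿inverseˡ _)
                      , (λ _ → R.-‿inverseʳ _ , R.-‿inverseʳ _)
            ; ⁻¹-cong = λ (p , r) → R.-‿cong p , R.-‿cong r }
          ; comm = λ _ _ → R.+-comm _ _ , R.+-comm _ _ }
        ; *-cong = λ (p , r) (p′ , r′) →
              R.+-cong (R.*-cong p p′) (R.-‿cong (R.*-cong r r′))
            , R.+-cong (R.*-cong p r′) (R.*-cong r p′)
        ; *-assoc = λ (x +i y) (u +i v) (a +i b) →
              S.solve 6 (λ x y u v a b →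
                (x :* u :- y :* v) :* a :- (x :* v :+ y :* u) :* b
                := x :* (u :* a :- v :* b) :- y :* (u :* b :+ v :* a)) R.refl x y u v a b
            , S.solve 6 (λ x y u v a b →
                (x :* u :- y :* v) :* b :+ (x :* v :+ y :* u) :* a
                := x :* (u :* b :+ v :* a) :+ y :* (u :* a :- v :* b)) R.refl x y u v a b
        ; *-identity =
              (λ (x +i y) →
                  S.solve 2 (λ x y → :1 :* x :- :0 :* y := x) R.refl x y
                , S.solve 2 (λ x y → :1 :* y :+ :0 :* x := y) R.refl x y)
            , (λ (x +i y) →
                  S.solve 2 (λ x y → x :* :1 :- y :* :0 := x) R.refl x y
                , S.solve 2 (λ x y → x :* :0 :+ y :* :1 := y) R.refl x y)
        ; distrib =
              (λ (x +i y) (u +i v) (a +i b) →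
                  S.solve 6 (λ x y u v a b → x :* (u :+ a) :- y :* (v :+ b)
                    := (x :* u :- y :* v) :+ (x :* a :- y :* b)) R.refl x y u v a b
                , S.solve 6 (λ x y u v a b → x :* (v :+ b) :+ y :* (u :+ a)
                    := (x :* v :+ y :* u) :+ (x :* b :+ y :* a)) R.refl x y u v a b)
            , (λ (x +i y) (u +i v) (a +i b) →
                  S.solve 6 (λ x y u v a b → (u :+ a) :* x :- (v :+ b) :* y
                    := (u :* x :- v :* y) :+ (a :* x :- b :* y)) R.refl x y u v a b
                , S.solve 6 (λ x y u v a b → (u :+ a) :* y :+ (v :+ b) :* x
                    := (u :* y :+ v :* x) :+ (a :* y :+ b :* x)) R.refl x y u v a b)
        }
      ; *-comm = λ (x +i y) (u +i v) →
            S.solve 4 (λ x y u v → x :* u :- y :* v := u :* x :- v :* y) R.refl x y u v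
          , S.solve 4 (λ x y u v → x :* v :+ y :* u := u :* y :+ v :* x) R.refl x y u v
      }
    }

  open CommutativeRing ℂ-commutativeRing public
    using (_+_; _*_; -_; _-_; 0#; 1#; _≈_)
  open RawSemiringDefs (Semiring.rawSemiring (CommutativeRing.semiring ℂ-commutativeRing))
    public using (_^_)

  -- The squared modulus.  Square roots being unavailable, conditions on |z|
  -- are stated through it.
  ∣_∣² : ℂ → ∣ℝ∣
  ∣ x +i y ∣² = x R.* x R.+ y R.* y

  -- Apartness from 0, i.e. 0 < |z|
  _≉0 : ℂ → Set ℓ₂
  z ≉0 = 0ℝ <ℝ ∣ z ∣²

  ∣_∣<1 : ℂ → Set ℓ₂
  ∣ z ∣<1 = ∣ z ∣² <ℝ 1ℝ

  ∣∣²-cong : ∀ {z w} → z ≈ w → ∣ z ∣² R.≈ ∣ w ∣²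
  ∣∣²-cong (p , r) = R.+-cong (R.*-cong p p) (R.*-cong r r)

  ∣∣²-* : ∀ z w → ∣ z * w ∣² R.≈ ∣ z ∣² R.* ∣ w ∣²
  ∣∣²-* (x +i y) (u +i v) = S.solve 4 (λ x y u v →
    (x :* u :- y :* v) :* (x :* u :- y :* v) :+ (x :* v :+ y :* u) :* (x :* v :+ y :* u)
    := (x :* x :+ y :* y) :* (u :* u :+ v :* v)) R.refl x y u v

  ∣∣²-neg : ∀ z → ∣ - z ∣² R.≈ ∣ z ∣²
  ∣∣²-neg (x +i y) = S.solve 2 (λ x y →
    (:- x) :* (:- x) :+ (:- y) :* (:- y) := x :* x :+ y :* y) R.refl x y

  ∣1∣² : ∣ 1# ∣² R.≈ 1ℝ
  ∣1∣² = S.solve 0 (:1 :* :1 :+ :0 :* :0 := :1) R.refl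

  ∣∣²-nonneg : ∀ z → 0ℝ ≤ ∣ z ∣²
  ∣∣²-nonneg (x +i y) = ≤-trans (sq-nonneg x) (x≤x+y (sq-nonneg y))

  *-≉0 : ∀ {z w} → z ≉0 → w ≉0 → (z * w) ≉0
  *-≉0 {z} {w} z≉0 w≉0 = <-resp R.refl (R.sym (∣∣²-* z w)) (R.*-pos z≉0 w≉0)

  *-≉0ˡ : ∀ {z w} → (z * w) ≉0 → z ≉0
  *-≉0ˡ {z} {w} zw≉0 = 0≤∧#⇒0< (∣∣²-nonneg z)
    (*-#0⇒#0 (0<⇒#0 (<-resp R.refl (∣∣²-* z w) zw≉0)))

  ^-≉0 : ∀ {z} → z ≉0 → ∀ n → (z ^ n) ≉0
  ^-≉0 z≉0 zero        = <-resp R.refl (R.sym ∣1∣²) 0<1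
  ^-≉0 {z} z≉0 (suc n) = *-≉0 {z} {z ^ n} z≉0 (^-≉0 {z} z≉0 n)

  ≉0-cong : ∀ {z w} → z ≈ w → z ≉0 → w ≉0
  ≉0-cong z≈w = <-resp R.refl (∣∣²-cong z≈w)

  -- z⁻¹ = z̄ / |z|²
  inv : (z : ℂ) → z ≉0 → ℂ
  inv (x +i y) z≉0 = (x R.* r) +i (R.- (y R.* r))
    where r = proj₁ (inverse z≉0)

  inv-inverseʳ : ∀ z (z≉0 : z ≉0) → z * inv z z≉0 ≈ 1#
  inv-inverseʳ (x +i y) z≉0 =
      R.trans (S.solve 3 (λ x y r → x :* (x :* r) :- y :* (:- (y :* r))
        := (x :* x :+ y :* y) :* r) R.refl x y (proj₁ (inverse z≉0)))
        (proj₂ (proj₂ (inverse z≉0)))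
    , S.solve 3 (λ x y r → x :* (:- (y :* r)) :+ y :* (x :* r) := :0)
        R.refl x y (proj₁ (inverse z≉0))

  inv-≉0 : ∀ z (z≉0 : z ≉0) → inv z z≉0 ≉0
  inv-≉0 z z≉0 = *-≉0ˡ {inv z z≉0} {z} (≉0-cong
    (CommutativeRing.sym ℂ-commutativeRing (CommutativeRing.trans ℂ-commutativeRing
      (CommutativeRing.*-comm ℂ-commutativeRing (inv z z≉0) z) (inv-inverseʳ z z≉0)))
    (<-resp R.refl (R.sym ∣1∣²) 0<1))

  infixl 7 _÷_[_]

  _÷_[_] : (z w : ℂ) → w ≉0 → ℂ
  z ÷ w [ w≉0 ] = z * inv w w≉0

  ÷-≉0 : ∀ {z w} → z ≉0 → (w≉0 : w ≉0) → (z ÷ w [ w≉0 ]) ≉0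
  ÷-≉0 {z} {w} z≉0 w≉0 = *-≉0 {z} z≉0 (inv-≉0 w w≉0)

module Analysis {c ℓ₁ ℓ₂ : Level} (ℝ : RealField c ℓ₁ ℓ₂) where
  open Complex ℝ public
  open Order ℝ
  private
    module R = RealField ℝ
    module S = Solve R.commutativeRing
    module RZ = RingIdentities R.commutativeRing
    module Z = RingIdentities ℂ-commutativeRing
    module NS = ℕSolver.+-*-Solver
  open CommutativeRing ℂ-commutativeRing
    using (refl; sym; trans; reflexive; *-congˡ)
  open R using () renaming (Carrier to ∣ℝ∣; _<_ to _<ℝ_; 0# to 0ℝ; 1# to 1ℝ)
  open S using (_:=_; _:+_; _:*_; :-_; _:-_; :0; :1)

  -- Limits in ℂ = ℝ² are componentwise.
  Cauchyℂ : (ℕ → ℂ) → Set (c ⊔ ℓ₂)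
  Cauchyℂ s = R.Cauchy (re ∘ s) × R.Cauchy (im ∘ s)

  lim : (s : ℕ → ℂ) → Cauchyℂ s → ℂ
  lim s (cre , cim) = proj₁ (R.complete (re ∘ s) cre) +i proj₁ (R.complete (im ∘ s) cim)

  partialSum partialProduct : (ℕ → ℂ) → ℕ → ℂ
  partialSum u zero    = 0#
  partialSum u (suc n) = partialSum u n + u n
  partialProduct u zero    = 1#
  partialProduct u (suc n) = partialProduct u n * u n

  -- z ≼ t means |z| ≤ t.
  infix 4 _≼_

  record _≼_ (z : ℂ) (t : ∣ℝ∣) : Set ℓ₂ where
    constructor _,_
    field
      0≤t  : 0ℝ ≤ t
      ≤t*t : ∣ z ∣² ≤ t R.* t
  open _≼_ using (0≤t)

  ≼-cong : ∀ {z w s t} → z ≈ w → s R.≈ t → z ≼ s → w ≼ t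
  ≼-cong p r (h , k) = ≤-resp R.refl r h , ≤-resp (∣∣²-cong p) (R.*-cong r r) k

  ≼-weaken : ∀ {z s t} → s ≤ t → z ≼ s → z ≼ t
  ≼-weaken s≤t (0≤s , k) = 0≤u , ≤-trans k (*-mono-≤ 0≤s 0≤u s≤t s≤t)
    where 0≤u = ≤-trans 0≤s s≤t

  ≼-* : ∀ {z w s t} → z ≼ s → w ≼ t → z * w ≼ s R.* t
  ≼-* {z} {w} {s} {t} (0≤s , h) (0≤t , k) = *-nonneg 0≤s 0≤t , ≤-resp
    (R.sym (∣∣²-* z w))
    (S.solve 2 (λ s t → (s :* s) :* (t :* t) := (s :* t) :* (s :* t)) R.refl s t)
    (*-mono-≤ (∣∣²-nonneg z) (sq-nonneg t) h k)

  ≼-neg : ∀ {z t} → z ≼ t → - z ≼ t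
  ≼-neg {z} (0≤t , h) = 0≤t , ≤-resp (R.sym (∣∣²-neg z)) R.refl h

  ≼-+ : ∀ {z w s t} → z ≼ s → w ≼ t → z + w ≼ s R.+ t
  ≼-+ {x +i y} {u +i v} {s} {t} (0≤s , h) (0≤t , k) =
    ≤-trans 0≤s (x≤x+y 0≤t) , ≤-resp
      (S.solve 4 (λ x y u v →
        (x :* x :+ y :* y) :+ (u :* u :+ v :* v)
          :+ ((x :* u :+ y :* v) :+ (x :* u :+ y :* v))
        := (x :+ u) :* (x :+ u) :+ (y :+ v) :* (y :+ v)) R.refl x y u v)
      (S.solve 2 (λ s t → s :* s :+ t :* t :+ (s :* t :+ s :* t) := (s :+ t) :* (s :+ t))
        R.refl s t)
      (+-mono-≤ (+-mono-≤ h k) (+-mono-≤ inner inner))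
    where
    -- Cauchy–Schwarz
    inner : x R.* u R.+ y R.* v ≤ s R.* t
    inner = sq-cancel-≤ (*-nonneg 0≤s 0≤t) (≤-trans
      (x≤x+y (sq-nonneg (x R.* v R.- y R.* u)))
      (≤-resp
        (S.solve 4 (λ x y u v → (x :* x :+ y :* y) :* (u :* u :+ v :* v)
          := (x :* u :+ y :* v) :* (x :* u :+ y :* v)
             :+ (x :* v :- y :* u) :* (x :* v :- y :* u)) R.refl x y u v)
        (S.solve 2 (λ s t → (s :* s) :* (t :* t) := (s :* t) :* (s :* t)) R.refl s t)
        (*-mono-≤ (∣∣²-nonneg (x +i y)) (sq-nonneg t) h k)))

  ≼⇒re≤ : ∀ {z t} → z ≼ t → re z ≤ t
  ≼⇒re≤ {x +i y} (0≤t , h) = sq-cancel-≤ 0≤t (≤-trans (x≤x+y (sq-nonneg y)) h)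

  ≼⇒im≤ : ∀ {z t} → z ≼ t → im z ≤ t
  ≼⇒im≤ {x +i y} (0≤t , h) = sq-cancel-≤ 0≤t (≤-trans (x≤x+y (sq-nonneg x))
    (≤-resp (R.+-comm _ _) R.refl h))

  ≼-zero : 0# ≼ 0ℝ
  ≼-zero = ≤-refl , ≤-reflexive (S.solve 0 (:0 :* :0 :+ :0 :* :0 := :0 :* :0) R.refl)

  ≼-one : 1# ≼ 1ℝ
  ≼-one = <⇒≤ 0<1 , ≤-reflexive (R.trans ∣1∣² (R.sym (R.*-identityˡ 1ℝ)))

  ≼-^ : ∀ {z t} → z ≼ t → ∀ n → z ^ n ≼ t R.^ n
  ≼-^ h zero    = ≼-one
  ≼-^ h (suc n) = ≼-* h (≼-^ h n)

  bound : ℂ → ∣ℝ∣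
  bound z = 1ℝ R.+ ∣ z ∣²

  ≼-bound : ∀ z → z ≼ bound z
  ≼-bound z = ≤-trans (<⇒≤ 0<1) (x≤x+y 0≤w) ,
    ≤-resp (R.+-identityʳ w)
      (S.solve 1 (λ w → w :+ (:1 :+ w :+ w :* w) := (:1 :+ w) :* (:1 :+ w)) R.refl w)
      (+-mono-≤ ≤-refl (≤-trans (≤-trans (<⇒≤ 0<1) (x≤x+y 0≤w)) (x≤x+y (sq-nonneg w))))
    where
    w = ∣ z ∣²
    0≤w = ∣∣²-nonneg z

  -- |z| < 1 gives |z| ≤ (1 + |z|²) / 2 < 1.
  σ : ℂ → ∣ℝ∣
  σ z = ½ R.* (1ℝ R.+ ∣ z ∣²)

  double-½ : ∀ x → ½ R.* x R.+ ½ R.* x R.≈ x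
  double-½ x = R.trans (S.solve 2 (λ h x → h :* x :+ h :* x := (h :+ h) :* x) R.refl ½ x)
    (R.trans (R.*-congʳ ½+½≈1) (R.*-identityˡ x))

  ≼-σ : ∀ z → z ≼ σ z
  ≼-σ z = *-nonneg (<⇒≤ 0<½) (≤-trans (<⇒≤ 0<1) (x≤x+y (∣∣²-nonneg z))) ,
    0≤y-x⇒x≤y (≤-resp R.refl square (sq-nonneg (½ R.* (1ℝ R.- w))))
    where
    w = ∣ z ∣²
    square : ½ R.* (1ℝ R.- w) R.* (½ R.* (1ℝ R.- w)) R.≈ σ z R.* σ z R.- w
    square = R.trans
      (S.solve 2 (λ h w → h :* (:1 :- w) :* (h :* (:1 :- w))
        := h :* (:1 :+ w) :* (h :* (:1 :+ w)) :- (h :+ h) :* (h :+ h) :* w) R.refl ½ w)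
      (R.+-congˡ (R.-‿cong (R.trans (R.*-congʳ (R.trans (R.*-cong ½+½≈1 ½+½≈1)
        (R.*-identityˡ 1ℝ))) (R.*-identityˡ w))))

  ½*-< : ∀ {x y} → x <ℝ y → ½ R.* x <ℝ ½ R.* y
  ½*-< {x} {y} x<y = 0<y-x⇒x<y (<-resp R.refl
    (S.solve 3 (λ h x y → h :* (y :- x) := h :* y :- h :* x) R.refl ½ x y)
    (R.*-pos 0<½ (x<y⇒0<y-x x<y)))

  σ<1 : ∀ {z} → ∣ z ∣<1 → σ z <ℝ 1ℝ
  σ<1 {z} h = <-resp R.refl (R.trans (R.distribˡ ½ 1ℝ 1ℝ) (double-½ 1ℝ))
    (½*-< (<-resp (R.+-comm _ _) R.refl (R.+-monoˡ-< 1ℝ h)))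

  -- If |s (n + 1) - s n| ≤ b n - b (n + 1), where b ≥ 0 gets arbitrarily small,
  -- then s is Cauchy.
  telescope-Cauchy : (s : ℕ → ℂ) (b : ℕ → ∣ℝ∣) →
    (∀ n → s (suc n) - s n ≼ b n R.- b (suc n)) → (∀ n → 0ℝ ≤ b n) →
    (∀ ε → 0ℝ <ℝ ε → ∃[ n ] b n <ℝ ε) → Cauchyℂ s
  telescope-Cauchy s b step 0≤b small = part re ≼⇒re≤ (λ _ _ → R.refl) , part im ≼⇒im≤ (λ _ _ → R.refl)
    where
    far : ∀ k n → s (k ℕ.+ n) - s n ≼ b n R.- b (k ℕ.+ n)
    far zero n = ≼-cong (Z.0≈x-x (s n))
      (R.sym (R.-‿inverseʳ (b n))) ≼-zero
    far (suc k) n = ≼-cong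
      (Z.[x-y]+[y-z] (s (suc k ℕ.+ n)) (s (k ℕ.+ n)) (s n))
      (S.solve 3 (λ x y z → (y :- x) :+ (z :- y) := z :- x)
        R.refl (b (suc k ℕ.+ n)) (b (k ℕ.+ n)) (b n))
      (≼-+ (step (k ℕ.+ n)) (far k n))

    near : ∀ N m → N ℕ.≤ m → s m - s N ≼ b N
    near N m N≤m = ≡.subst (λ k → s k - s N ≼ b N) (ℕₚ.m∸n+n≡m N≤m)
      (≼-weaken (≤-resp R.refl (S.solve 2 (λ x y → (x :- y) :+ y := x) R.refl (b N) (b k))
        (x≤x+y (0≤b k))) (far (m ℕ.∸ N) N))
      where k = m ℕ.∸ N ℕ.+ N

    part : (p : ℂ → ∣ℝ∣) → (∀ {z t} → z ≼ t → p z ≤ t) →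
           (∀ z w → p (z - w) R.≈ p z R.- p w) → R.Cauchy (p ∘ s)
    part p p≤ p-sub ε 0<ε with small (½ R.* ε) (R.*-pos 0<½ 0<ε)
    ... | N , bN<½ε = N , λ m n N≤m N≤n → ≤-<-trans (apart m n N≤m N≤n) 2bN<ε
      where
      left : ∀ m → N ℕ.≤ m → p (s m) R.- p (s N) ≤ b N
      left m N≤m = ≤-resp (p-sub (s m) (s N)) R.refl (p≤ (near N m N≤m))
      right : ∀ n → N ℕ.≤ n → p (s N) R.- p (s n) ≤ b N
      right n N≤n = ≤-resp (p-sub (s N) (s n)) R.refl
        (p≤ (≼-cong (Z.-[x-y] (s n) (s N)) R.refl (≼-neg (near N n N≤n))))
      apart : ∀ m n → N ℕ.≤ m → N ℕ.≤ n → p (s m) R.- p (s n) ≤ b N R.+ b N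
      apart m n N≤m N≤n = ≤-resp (RZ.[x-y]+[y-z] (p (s m)) (p (s N)) (p (s n))) R.refl
        (+-mono-≤ (left m N≤m) (right n N≤n))
      2bN<ε : b N R.+ b N <ℝ ε
      2bN<ε = <-resp R.refl (double-½ ε)
        (<-≤-trans (R.+-monoˡ-< (b N) bN<½ε) (+-mono-≤ ≤-refl (<⇒≤ bN<½ε)))

  shift-Cauchy : ∀ s N → Cauchyℂ (λ n → s (n ℕ.+ N)) → Cauchyℂ s
  shift-Cauchy s N (cre , cim) = part re cre , part im cim
    where
    part : (p : ℂ → ∣ℝ∣) → R.Cauchy (λ n → p (s (n ℕ.+ N))) → R.Cauchy (p ∘ s)
    part p h ε 0<ε with h ε 0<ε
    ... | M , k = M ℕ.+ N , λ m n M+N≤m M+N≤n →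
      ≡.subst₂ (λ i j → p (s i) R.- p (s j) <ℝ ε) (back m M+N≤m) (back n M+N≤n)
        (k (m ℕ.∸ N) (n ℕ.∸ N) (enough m M+N≤m) (enough n M+N≤n))
      where
      back : ∀ m → M ℕ.+ N ℕ.≤ m → m ℕ.∸ N ℕ.+ N ≡ m
      back m q = ℕₚ.m∸n+n≡m (ℕₚ.≤-trans (ℕₚ.m≤n+m N M) q)
      enough : ∀ m → M ℕ.+ N ℕ.≤ m → M ℕ.≤ m ℕ.∸ N
      enough m q = ≡.subst (ℕ._≤ m ℕ.∸ N) (ℕₚ.m+n∸n≡m M N) (ℕₚ.∸-monoˡ-≤ N q)

  ratio-Cauchy : (s r : ℕ → ℂ) (τ : ∣ℝ∣) → 0ℝ ≤ τ → τ <ℝ 1ℝ →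
    (∀ n → s (2 ℕ.+ n) - s (1 ℕ.+ n) ≈ (s (1 ℕ.+ n) - s n) * r n) →
    ∃[ N ] (∀ n → r (n ℕ.+ N) ≼ τ) → Cauchyℂ s
  ratio-Cauchy s r τ 0≤τ τ<1 rec (N , r≼τ) = shift-Cauchy s N
    (telescope-Cauchy s′ (λ n → B R.* τ R.^ n)
      (λ n → ≼-cong refl (step n) (steps≼ n))
      (λ n → *-nonneg 0≤B (^-nonneg 0≤τ n))
      (λ ε 0<ε → geometric-small 0≤τ τ<1 0≤B 0<ε))
    where
    s′ : ℕ → ℂ
    s′ n = s (n ℕ.+ N)
    D = bound (s′ 1 - s′ 0)
    0≤D : 0ℝ ≤ D
    0≤D = 0≤t (≼-bound (s′ 1 - s′ 0))
    i = inverse (x<y⇒0<y-x τ<1)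
    B = D R.* proj₁ i
    0≤B : 0ℝ ≤ B
    0≤B = *-nonneg 0≤D (<⇒≤ (proj₁ (proj₂ i)))
    steps≼ : ∀ n → s′ (suc n) - s′ n ≼ D R.* τ R.^ n
    steps≼ zero    = ≼-cong refl (R.sym (R.*-identityʳ D)) (≼-bound (s′ 1 - s′ 0))
    steps≼ (suc n) = ≼-cong (sym (rec (n ℕ.+ N)))
      (S.solve 3 (λ d t p → (d :* p) :* t := d :* (t :* p)) R.refl D τ (τ R.^ n))
      (≼-* (steps≼ n) (r≼τ n))
    step : ∀ n → D R.* τ R.^ n R.≈ B R.* τ R.^ n R.- B R.* τ R.^ suc n
    step n = R.trans
      (R.*-congʳ (R.sym (R.trans (R.*-congˡ (proj₂ (proj₂ i))) (R.*-identityʳ D))))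
      (S.solve 4 (λ d t p y → d :* ((:1 :- t) :* y) :* p
        := d :* y :* p :- d :* y :* (t :* p)) R.refl D τ (τ R.^ n) (proj₁ i))

  power≼small : ∀ x {p} → ∣ p ∣<1 → ∀ ε → 0ℝ <ℝ ε → ∃[ N ] (∀ n → x * p ^ (n ℕ.+ N) ≼ ε)
  power≼small x {p} p<1 ε 0<ε = N , λ n → ≼-weaken {s = bound x R.* σ p R.^ (n ℕ.+ N)}
    (≤-trans (*-monoʳ-≤ (0≤t (≼-bound x)) (^-anti-≤ (0≤t (≼-σ p)) (<⇒≤ (σ<1 p<1)) n N))
      (<⇒≤ (proj₂ small)))
    (≼-* (≼-bound x) (≼-^ (≼-σ p) (n ℕ.+ N)))
    where
    small : ∃[ N ] bound x R.* σ p R.^ N <ℝ ε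
    small = geometric-small (0≤t (≼-σ p)) (σ<1 p<1) (0≤t (≼-bound x)) 0<ε
    N = proj₁ small

  series-Cauchy : (u : ℕ → ℂ) (x p : ℂ) → ∣ p ∣<1 →
    (∀ n → u (suc n) ≈ u n * (x * p ^ n)) → Cauchyℂ (partialSum u)
  series-Cauchy u x p p<1 rec = ratio-Cauchy (partialSum u) (λ n → x * p ^ n) ½ (<⇒≤ 0<½) ½<1
    (λ n → Z.series-step (partialSum u n) (u n) (u (suc n)) (x * p ^ n) (rec n))
    (power≼small x p<1 ½ 0<½)
    where
    ½<1 : ½ <ℝ 1ℝ
    ½<1 = <-resp (R.+-identityˡ ½) ½+½≈1 (R.+-monoˡ-< ½ 0<½)

  -- (a ; q)_∞ = ∏_{n ≥ 0} (1 - a qⁿ)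

  pochhammer-factor : ℂ → ℂ → ℕ → ℂ
  pochhammer-factor a q n = 1# - a * q ^ n

  private
    pochhammer-Cauchy₀ : ∀ a q → ∣ q ∣<1 → Cauchyℂ (partialProduct (pochhammer-factor a q))
    pochhammer-Cauchy₀ a q q<1 = ratio-Cauchy P (λ n → (1# - a * q ^ n) * q) (σ q R.+ δ)
      (≤-trans (0≤t (≼-σ q)) (x≤x+y (<⇒≤ 0<δ))) τ<1
      (λ n → Z.product-step (P n) a q (q ^ n))
      (proj₁ small , λ n → ≼-weaken factor≤
        (≼-* (≼-+ ≼-one (≼-neg (proj₂ small n))) (≼-σ q)))
      where
      P = partialProduct (pochhammer-factor a q)
      0<1-σ = x<y⇒0<y-x (σ<1 q<1)
      δ = ½ R.* (1ℝ R.- σ q)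
      0<δ = R.*-pos 0<½ 0<1-σ
      small = power≼small a q<1 δ 0<δ
      τ<1 : σ q R.+ δ <ℝ 1ℝ
      τ<1 = <-resp (R.+-comm _ _)
        (R.trans (S.solve 2 (λ d s → (d :+ d) :+ s := s :+ (d :+ d)) R.refl δ (σ q))
          (R.trans (R.+-congˡ (double-½ (1ℝ R.- σ q)))
            (S.solve 1 (λ s → s :+ (:1 :- s) := :1) R.refl (σ q))))
        ((R.+-monoˡ-< (σ q)
          (<-resp (R.+-identityˡ δ) R.refl (R.+-monoˡ-< δ 0<δ))))
      factor≤ : (1ℝ R.+ δ) R.* σ q ≤ σ q R.+ δ
      factor≤ = ≤-resp (S.solve 2 (λ d s → s :+ d :* s := (:1 :+ d) :* s) R.refl δ (σ q))
        (R.+-congˡ (R.*-identityʳ δ))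
        (+-mono-≤ ≤-refl (*-monoʳ-≤ (<⇒≤ 0<δ) (<⇒≤ (σ<1 q<1))))

  abstract
    pochhammer-Cauchy : ∀ a q → ∣ q ∣<1 → Cauchyℂ (partialProduct (pochhammer-factor a q))
    pochhammer-Cauchy = pochhammer-Cauchy₀

  ⟨_⨾_⟩∞[_] : ∀ a q → ∣ q ∣<1 → ℂ
  ⟨ a ⨾ q ⟩∞[ q<1 ] = lim (partialProduct (pochhammer-factor a q)) (pochhammer-Cauchy a q q<1)

  -- f(a,b) = ∑_{n ∈ ℤ} a^{n(n+1)/2} b^{n(n-1)/2}

  -- n(n+1)/2 and n(n-1)/2 are natural numbers for every integer n.
  tri : ℤ → ℕ
  tri n = ∣ n ℤ.* (n ℤ.+ ℤ.1ℤ) ∣ ℕ./ 2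

  tri′ : ℤ → ℕ
  tri′ n = ∣ n ℤ.* (n ℤ.- ℤ.1ℤ) ∣ ℕ./ 2

  θ-term : ℂ → ℂ → ℤ → ℂ
  θ-term a b n = a ^ tri n * b ^ tri′ n

  half-step : ∀ n → suc n ℕ.* suc (suc n) ℕ./ 2 ≡ suc n ℕ.+ n ℕ.* suc n ℕ./ 2
  half-step n = begin
    suc n ℕ.* suc (suc n) ℕ./ 2             ≡⟨ ≡.cong (ℕ._/ 2) (NS.solve 1 (λ n →
        (NS.con 1 NS.:+ n) NS.:* (NS.con 2 NS.:+ n)
        NS.:= (NS.con 1 NS.:+ n) NS.:* NS.con 2 NS.:+ n NS.:* (NS.con 1 NS.:+ n)) ≡.refl n) ⟩
    (suc n ℕ.* 2 ℕ.+ n ℕ.* suc n) ℕ./ 2     ≡⟨ ℕ/.+-distrib-/-∣ˡ (n ℕ.* suc n) (ℕ∣.n∣m*n (suc n)) ⟩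
    suc n ℕ.* 2 ℕ./ 2 ℕ.+ n ℕ.* suc n ℕ./ 2
      ≡⟨ ≡.cong (ℕ._+ n ℕ.* suc n ℕ./ 2) (ℕ/.m*n/n≡m (suc n) 2) ⟩
    suc n ℕ.+ n ℕ.* suc n ℕ./ 2             ∎
    where open ≡.≡-Reasoning

  triangle : ℕ → ℕ
  triangle n = n ℕ.* suc n ℕ./ 2

  tri-+ : ∀ n → tri (+ n) ≡ triangle n
  tri-+ n = ≡.cong (ℕ._/ 2) (≡.trans (ℤₚ.abs-* (+ n) (+ n ℤ.+ ℤ.1ℤ))
    (≡.cong (n ℕ.*_) (ℕₚ.+-comm n 1)))

  tri′-suc : ∀ n → tri′ (+ suc n) ≡ triangle n
  tri′-suc n = ≡.cong (ℕ._/ 2) (≡.trans (ℤₚ.abs-* (+ suc n) (+ suc n ℤ.- ℤ.1ℤ)) (ℕₚ.*-comm (suc n) n))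

  tri-neg : ∀ n → tri -[1+ n ] ≡ triangle n
  tri-neg n = ≡.cong (ℕ._/ 2) (≡.trans (ℤₚ.abs-* -[1+ n ] (-[1+ n ] ℤ.+ ℤ.1ℤ))
    (≡.trans (≡.cong (λ z → suc n ℕ.* ∣ z ∣) (ℤₚ.[1+m]⊖[1+n]≡m⊖n 0 n))
      (≡.trans (≡.cong (suc n ℕ.*_) (ℤₚ.∣⊖∣-≤ (ℕ.z≤n {n}))) (ℕₚ.*-comm (suc n) n))))

  tri′-neg : ∀ n → tri′ -[1+ n ] ≡ triangle (suc n)
  tri′-neg n = ≡.cong (ℕ._/ 2) (≡.trans (ℤₚ.abs-* -[1+ n ] (-[1+ n ] ℤ.- ℤ.1ℤ))
    (≡.cong (λ j → suc n ℕ.* suc (suc j)) (ℕₚ.+-identityʳ n)))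

  tri′-step : ∀ n → tri′ (+ suc n) ≡ n ℕ.+ tri′ (+ n)
  tri′-step zero    = ≡.refl
  tri′-step (suc n) = ≡.trans (tri′-suc (suc n))
    (≡.trans (half-step n) (≡.cong (suc n ℕ.+_) (≡.sym (tri′-suc n))))

  tri-step : ∀ n → tri (+ suc n) ≡ suc n ℕ.+ tri (+ n)
  tri-step n = ≡.trans (tri-+ (suc n))
    (≡.trans (half-step n) (≡.cong (suc n ℕ.+_) (≡.sym (tri-+ n))))

  tri-neg-step : ∀ n → tri -[1+ suc n ] ≡ suc n ℕ.+ tri -[1+ n ]
  tri-neg-step n = ≡.trans (tri-neg (suc n))
    (≡.trans (half-step n) (≡.cong (suc n ℕ.+_) (≡.sym (tri-neg n))))

  tri′-neg-step : ∀ n → tri′ -[1+ suc n ] ≡ 2 ℕ.+ n ℕ.+ tri′ -[1+ n ]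
  tri′-neg-step n = ≡.trans (tri′-neg (suc n))
    (≡.trans (half-step (suc n)) (≡.cong (2 ℕ.+ n ℕ.+_) (≡.sym (tri′-neg n))))

  θ⁺-rec : ∀ a b n → θ-term a b (+ suc n) ≈ θ-term a b (+ n) * (a * (a * b) ^ n)
  θ⁺-rec a b n = Z.theta-step⁺ a b n {tri (+ n)} {tri′ (+ n)} {tri (+ suc n)} {tri′ (+ suc n)}
    (tri-step n) (tri′-step n)

  θ⁻-rec : ∀ a b n → θ-term a b -[1+ suc n ] ≈ θ-term a b -[1+ n ] * ((b * (a * b)) * (a * b) ^ n)
  θ⁻-rec a b n = Z.theta-step⁻ a b n
    {tri -[1+ n ]} {tri′ -[1+ n ]} {tri -[1+ suc n ]} {tri′ -[1+ suc n ]}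
    (tri-neg-step n) (tri′-neg-step n)

  abstract
    θ⁺-Cauchy : ∀ a b → ∣ a * b ∣<1 → Cauchyℂ (partialSum (λ n → θ-term a b (+ n)))
    θ⁺-Cauchy a b ab<1 = series-Cauchy (λ n → θ-term a b (+ n)) a (a * b) ab<1 (θ⁺-rec a b)

    θ⁻-Cauchy : ∀ a b → ∣ a * b ∣<1 → Cauchyℂ (partialSum (λ n → θ-term a b -[1+ n ]))
    θ⁻-Cauchy a b ab<1 =
      series-Cauchy (λ n → θ-term a b -[1+ n ]) (b * (a * b)) (a * b) ab<1 (θ⁻-rec a b)

  -- The sums over n ≥ 0 and over n < 0 converge separately.
  f : ∀ a b → ∣ a * b ∣<1 → ℂ
  f a b ab<1 = lim (partialSum (λ n → θ-term a b (+ n))) (θ⁺-Cauchy a b ab<1)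
             + lim (partialSum (λ n → θ-term a b -[1+ n ])) (θ⁻-Cauchy a b ab<1)

  <1-*ˡ : ∀ {z w} → ∣ z ∣<1 → ∣ w ∣² ≤ 1ℝ → ∣ z * w ∣<1
  <1-*ˡ {z} {w} z<1 w≤1 = ≤-<-trans
    (≤-resp (R.sym (∣∣²-* z w)) (R.*-identityʳ ∣ z ∣²) (*-monoʳ-≤ (∣∣²-nonneg z) w≤1)) z<1

  ^-∣∣²≤1 : ∀ {z} → ∣ z ∣<1 → ∀ n → ∣ z ^ n ∣² ≤ 1ℝ
  ^-∣∣²≤1     z<1 zero    = ≤-reflexive ∣1∣²
  ^-∣∣²≤1 {z} z<1 (suc n) = <⇒≤ (<1-*ˡ {z} {z ^ n} z<1 (^-∣∣²≤1 {z} z<1 n))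

  <1-^ : ∀ {z} → ∣ z ∣<1 → ∀ n → ∣ z ^ suc n ∣<1
  <1-^ {z} z<1 n = <1-*ˡ {z} {z ^ n} z<1 (^-∣∣²≤1 {z} z<1 n)

  φ ψ : ∀ z → ∣ z ∣<1 → ℂ
  φ z z<1 = f z z (<1-*ˡ {z} {z} z<1 (<⇒≤ z<1))
  ψ z z<1 = f z (z ^ 3) (<1-^ {z} z<1 3)


module Theta {c ℓ₁ ℓ₂ : Level} (ℝ : RealField c ℓ₁ ℓ₂) where
  open Analysis ℝ public
  open Order ℝ
  private
    module R = RealField ℝ
    module C = CommutativeRing ℂ-commutativeRing
    module Z = RingIdentities ℂ-commutativeRing

  module QuarterPowers
    (q q¼ : ℂ) (q≉0 : q ≉0) (q<1 : ∣ q ∣<1) (q¼^4≈q : q¼ ^ 4 ≈ q) where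
    q¼≉0 : q¼ ≉0
    q¼≉0 = *-≉0ˡ {q¼} {q¼ ^ 3} (≉0-cong (C.sym q¼^4≈q) q≉0)

    q¼<1 : ∣ q¼ ∣<1
    q¼<1 = *-cancelˡ-< 0≤w (0<y-x⇒x<y (<-resp R.refl
        (solve 1 (λ v → :1 :- v :* (v :* (v :* v))
          := ((:1 :+ v) :* (:1 :+ v :* v)) :* :1 :- ((:1 :+ v) :* (:1 :+ v :* v)) :* v) R.refl v)
        (x<y⇒0<y-x (<-resp ∣q∣²≈v⁴ R.refl q<1))))
      where
      open Solve R.commutativeRing
      v = ∣ q¼ ∣²
      0≤v : R.0# ≤ v
      0≤v = ∣∣²-nonneg q¼
      0≤w : R.0# ≤ (R.1# R.+ v) R.* (R.1# R.+ v R.* v)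
      0≤w = *-nonneg (≤-trans (<⇒≤ 0<1) (x≤x+y 0≤v)) (≤-trans (<⇒≤ 0<1) (x≤x+y (sq-nonneg v)))
      ∣q∣²≈v⁴ : ∣ q ∣² R.≈ v R.* (v R.* (v R.* v))
      ∣q∣²≈v⁴ = R.trans (∣∣²-cong (C.sym q¼^4≈q))
        (R.trans (∣∣²-* q¼ (q¼ ^ 3)) (R.*-congˡ
        (R.trans (∣∣²-* q¼ (q¼ ^ 2)) (R.*-congˡ
        (R.trans (∣∣²-* q¼ (q¼ ^ 1)) (R.*-congˡ
        (R.trans (∣∣²-* q¼ 1#) (R.trans (R.*-congˡ ∣1∣²) (R.*-identityʳ v)))))))))

    open Z.IntegerPower (inv-inverseʳ q¼ q¼≉0) using (pow; pow-homo)

    -- q^ r /4 is q^{r/4} = (q¼)^r, for every integer r.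
    q^_/4 : ℤ → ℂ
    q^ r /4 = pow r

    q^/4-≉0 : ∀ r → q^ r /4 ≉0
    q^/4-≉0 (+ n)    = ^-≉0 q¼≉0 n
    q^/4-≉0 -[1+ n ] = ^-≉0 (inv-≉0 q¼ q¼≉0) (suc n)

    q^/4<1 : ∀ {r} → ℤ.0ℤ ℤ.< r → ∣ q^ r /4 ∣<1
    q^/4<1 {+ suc n} _ = <1-^ {q¼} q¼<1 n
    q^/4<1 {+ zero} (ℤ.+<+ ())

    prod<1 : ∀ {x y} → ℤ.0ℤ ℤ.< x ℤ.+ y → ∣ q^ x /4 * q^ y /4 ∣<1
    prod<1 {x} {y} 0<x+y = <-resp (∣∣²-cong (pow-homo x y)) R.refl (q^/4<1 0<x+y)

    negprod<1 : ∀ {x y} → ℤ.0ℤ ℤ.< x ℤ.+ y → ∣ (- q^ x /4) * (- q^ y /4) ∣<1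
    negprod<1 {x} {y} 0<x+y =
      <-resp (∣∣²-cong (C.sym (Z.-x*-y (q^ x /4) (q^ y /4)))) R.refl (prod<1 {x} {y} 0<x+y)

    neg<1 : ∀ {r} → ℤ.0ℤ ℤ.< r → ∣ - q^ r /4 ∣<1
    neg<1 {r} 0<r = <-resp (R.sym (∣∣²-neg (q^ r /4))) R.refl (q^/4<1 0<r)

    -- f(q^{x/4}, q^{y/4}) and f(-q^{x/4}, -q^{y/4})
    f⁺ f⁻ : ∀ x y → ℤ.0ℤ ℤ.< x ℤ.+ y → ℂ
    f⁺ x y 0<x+y = f (q^ x /4) (q^ y /4) (prod<1 {x} {y} 0<x+y)
    f⁻ x y 0<x+y = f (- q^ x /4) (- q^ y /4) (negprod<1 {x} {y} 0<x+y)

  -- With i = m/2, the exponents are multiples of 1/4; they are written as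
  -- q^ r /4, with r built from K = 4 · (k/4) and D = 4 · (2i - 1).
  module Quotient
    (q q¼ : ℂ) (q≉0 : q ≉0) (q<1 : ∣ q ∣<1) (q¼^4≈q : q¼ ^ 4 ≈ q)
    (k m : ℕ) (0<k : 0 ℕ.< k) where
    open QuarterPowers q q¼ q≉0 q<1 q¼^4≈q public

    2i-1 K D : ℤ
    2i-1 = + m ℤ.- + 1
    K    = + k
    D    = + 4 ℤ.* 2i-1

    private
      0<c*K : ∀ c → ℤ.0ℤ ℤ.< + suc c ℤ.* K
      0<c*K c = ≡.subst (ℤ.0ℤ ℤ.<_) (ℤₚ.pos-* (suc c) k)
        (ℤ.+<+ (ℕₚ.≤-trans 0<k (ℕₚ.m≤n*m k (suc c))))

      open ℤSolver.+-*-Solver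

    0<K : ℤ.0ℤ ℤ.< K
    0<K = ℤ.+<+ 0<k

    0<2K : ℤ.0ℤ ℤ.< + 2 ℤ.* K
    0<2K = 0<c*K 1

    0<4K : ℤ.0ℤ ℤ.< + 4 ℤ.* K
    0<4K = 0<c*K 3

    0<[K-D]+[3K+D] : ℤ.0ℤ ℤ.< (K ℤ.- D) ℤ.+ (+ 3 ℤ.* K ℤ.+ D)
    0<[K-D]+[3K+D] = ≡.subst (ℤ.0ℤ ℤ.<_) (solve 2 (λ K D →
      con (+ 4) :* K := (K :- D) :+ (con (+ 3) :* K :+ D)) ≡.refl K D) 0<4K

    0<[K+D]+[3K-D] : ℤ.0ℤ ℤ.< (K ℤ.+ D) ℤ.+ (+ 3 ℤ.* K ℤ.- D)
    0<[K+D]+[3K-D] = ≡.subst (ℤ.0ℤ ℤ.<_) (solve 2 (λ K D →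
      con (+ 4) :* K := (K :+ D) :+ (con (+ 3) :* K :- D)) ≡.refl K D) 0<4K

    0<D+[2K-D] : ℤ.0ℤ ℤ.< D ℤ.+ (+ 2 ℤ.* K ℤ.- D)
    0<D+[2K-D] = ≡.subst (ℤ.0ℤ ℤ.<_) (solve 2 (λ K D →
      con (+ 2) :* K := D :+ (con (+ 2) :* K :- D)) ≡.refl K D) 0<2K

    0<[K-D]+[K+D] : ℤ.0ℤ ℤ.< (K ℤ.- D) ℤ.+ (K ℤ.+ D)
    0<[K-D]+[K+D] = ≡.subst (ℤ.0ℤ ℤ.<_) (solve 2 (λ K D →
      con (+ 2) :* K := (K :- D) :+ (K :+ D)) ≡.refl K D) 0<2K

    -- (q^{x/4}, q^{y/4} ; q^k)_∞
    ⟨q^_/4,q^_/4⨾q^k⟩∞ : ℤ → ℤ → ℂ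
    ⟨q^ x /4,q^ y /4⨾q^k⟩∞ =
        ⟨ q^ x /4 ⨾ q^ + 4 ℤ.* K /4 ⟩∞[ q^/4<1 0<4K ]
      * ⟨ q^ y /4 ⨾ q^ + 4 ℤ.* K /4 ⟩∞[ q^/4<1 0<4K ]

    T-numerator T-denominator q^[2i-1]/2 : ℂ
    T-numerator   = ⟨q^ K ℤ.- D /4,q^ + 3 ℤ.* K ℤ.+ D /4⨾q^k⟩∞
    T-denominator = ⟨q^ K ℤ.+ D /4,q^ + 3 ℤ.* K ℤ.- D /4⨾q^k⟩∞
    q^[2i-1]/2    = q^ + 2 ℤ.* 2i-1 /4

    T : T-denominator ≉0 → ℂ
    T den≉0 = q^[2i-1]/2 * (T-numerator ÷ T-denominator [ den≉0 ])

    T-≉0 : T-numerator ≉0 → (den≉0 : T-denominator ≉0) → T den≉0 ≉0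
    T-≉0 num≉0 den≉0 = *-≉0 {q^[2i-1]/2} {T-numerator ÷ T-denominator [ den≉0 ]}
      (q^/4-≉0 (+ 2 ℤ.* 2i-1)) (÷-≉0 {T-numerator} {T-denominator} num≉0 den≉0)

{-# OPTIONS --safe #-}

-- Write a = q^{k/4}, d = q^{2i-1}, p = a⁴, P = (p; p)_∞ and A, B for the theta functions in the
-- denominator and the numerator of T.  By the Jacobi triple product A and B are P times the
-- denominator and numerator products, f(-a/d, -ad) is (a²; a²)_∞ times the product of these two
-- products, and ψ(a²) (a²; a²)_∞ = P².  After multiplication by the common denominator the claims
-- become
--   A² - d B² = φ(a) f(-d, -a²/d)   and   A² + d B² = φ(-a) f(d, a²/d).
-- In the double series A² = ∑ (-1)^{m+n} a^{2m²-m+2n²-n} d^{m+n} put u = m + n and v = m - n: it is the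
-- part u ≡ v mod 2 of ∑ (-1)^u a^{u²-u} d^u a^{v²}, and -d B² is the part u ≢ v (similarly with (-1)^v for
-- the second identity).
--
-- The triple product is the limit N → ∞ of
--   (p;p)_N ∏_{j<N} (1 - x p^j)(1 - y p^j) = ∑_{|n|≤N} E(N,|n|) θ_n,  p = xy,
-- where θ_n is the n-th term of f(-x, -y) and E(N,n) = (p;p)_N [2N choose N+n]_p → 1 boundedly.
-- That (p;p)_∞ is apart from 0 follows from its tails being close to 1.
module Submission where

open import Defs
open import Level using (Level; _⊔_) renaming (suc to lsuc)
open import Data.Nat.Base as ℕ using (ℕ; zero; suc)
import Data.Nat.Properties as ℕₚ
import Data.Nat.Solver as ℕSolver
open import Data.Nat.Divisibility using (_∣_)
open import Data.Integer.Base as ℤ using (ℤ; +_; -[1+_]; ∣_∣)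
import Data.Integer.Properties as ℤₚ
import Data.Integer.Solver as ℤSolver
open import Data.Product.Base using (Σ-syntax; ∃-syntax; _×_; _,_; proj₁; proj₂)
open import Data.Sum.Base using (inj₁; inj₂)
open import Algebra.Bundles using (CommutativeRing; Semiring)
import Algebra.Definitions.RawSemiring as RawSemiringDefs
import Algebra.Properties.Ring as Ringₚ
import Algebra.Properties.Semiring.Exp as Expₚ
import Algebra.Properties.CommutativeSemiring.Exp as CExpₚ
open import Function.Base using (_∘_)
open import Function.Bundles using (Equivalence)
open import Relation.Binary.PropositionalEquality as ≡ using (_≡_)

-- z ≼ t stands for |z| ≤ t.
record NormedRing {c ℓ₁ ℓ₂ : Level} (ℝ : RealField c ℓ₁ ℓ₂) : Set (lsuc (c ⊔ ℓ₁ ⊔ ℓ₂)) where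
  private module R = RealField ℝ
  open Order ℝ using (_≤_; ½)
  infix 4 _≼_
  field
    commutativeRing : CommutativeRing c ℓ₁
  open CommutativeRing commutativeRing
  field
    _≼_        : Carrier → R.Carrier → Set ℓ₂
    ≼⇒0≤       : ∀ {z t} → z ≼ t → R.0# ≤ t
    ≼-cong     : ∀ {z w s t} → z ≈ w → s R.≈ t → z ≼ s → w ≼ t
    ≼-weaken   : ∀ {z s t} → s ≤ t → z ≼ s → z ≼ t
    ≼-*        : ∀ {z w s t} → z ≼ s → w ≼ t → z * w ≼ s R.* t
    ≼-neg      : ∀ {z t} → z ≼ t → - z ≼ t
    ≼-+        : ∀ {z w s t} → z ≼ s → w ≼ t → z + w ≼ s R.+ t
    ≼-zero     : 0# ≼ R.0#
    ≼-one      : 1# ≼ R.1#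
    ≼-bound    : ∀ z → ∃[ t ] z ≼ t
    ≼-closed   : ∀ {z t} → R.0# ≤ t → (∀ ε → R.0# R.< ε → z ≼ t R.+ ε) → z ≼ t
    ≼-zero⇒≈0  : ∀ {z} → z ≼ R.0# → z ≈ 0#
    ≼-complete : ∀ (s : ℕ → Carrier) C → (∀ n → s (suc n) - s n ≼ C R.* ½ R.^ n) →
                 ∃[ z ] (∀ ε → R.0# R.< ε → ∃[ N ] (∀ n → N ℕ.≤ n → s n - z ≼ ε))

module RealLemmas {c ℓ₁ ℓ₂ : Level} (ℝ : RealField c ℓ₁ ℓ₂) where
  open RealField ℝ
  open Order ℝ
  open Solve commutativeRing

  ½≤1 : ½ ≤ 1#
  ½≤1 = ≤-resp refl ½+½≈1 (x≤x+y (<⇒≤ 0<½))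

  ½<1 : ½ < 1#
  ½<1 = <-resp (+-identityˡ ½) ½+½≈1 (+-monoˡ-< ½ 0<½)

  ½*x+½*x : ∀ x → ½ * x + ½ * x ≈ x
  ½*x+½*x x = trans (solve 2 (λ h x → h :* x :+ h :* x := (h :+ h) :* x) refl ½ x)
    (trans (*-congʳ ½+½≈1) (*-identityˡ x))

  *-monoˡ-≤ : ∀ {x y z} → 0# ≤ z → x ≤ y → x * z ≤ y * z
  *-monoˡ-≤ {x} {y} {z} 0≤z x≤y = ≤-resp (*-comm z x) (*-comm z y) (*-monoʳ-≤ 0≤z x≤y)

  +-nonneg : ∀ {x y} → 0# ≤ x → 0# ≤ y → 0# ≤ x + y
  +-nonneg 0≤x 0≤y = ≤-trans 0≤x (x≤x+y 0≤y)

  x≤y+x : ∀ {x y} → 0# ≤ y → x ≤ y + x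
  x≤y+x 0≤y = ≤-resp refl (+-comm _ _) (x≤x+y 0≤y)

  x-y≤x : ∀ {x y} → 0# ≤ y → x - y ≤ x
  x-y≤x {x} {y} 0≤y = 0≤y-x⇒x≤y (≤-resp refl
    (solve 2 (λ x y → y := x :- (x :- y)) refl x y) 0≤y)

  small-multiple : ∀ {C ε} → 0# ≤ C → 0# < ε → ∃[ δ ] (0# < δ × δ ≤ 1# × C * δ ≤ ε)
  small-multiple {C} {ε} 0≤C 0<ε = ε * i , *-pos 0<ε 0<i ,
    ≤-resp refl eq (≤-resp refl (+-comm _ _) (x≤x+y (*-nonneg 0≤C 0≤i))) ,
    ≤-resp (solve 3 (λ c e i → e :* (c :* i) := c :* (e :* i)) refl C ε i) (*-identityʳ ε)
      (*-monoʳ-≤ (<⇒≤ 0<ε) (≤-resp refl eq (x≤x+y (*-nonneg (<⇒≤ 0<ε) 0≤i))))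
    where
    inv = inverse (<-≤-trans 0<ε (≤-resp refl (+-comm _ _) (x≤x+y {ε} 0≤C)))
    i = proj₁ inv
    0<i = proj₁ (proj₂ inv)
    0≤i = <⇒≤ 0<i
    eq : C * i + ε * i ≈ 1#
    eq = trans (sym (distribʳ i C ε)) (proj₂ (proj₂ inv))

  ^-+ : ∀ t m n → t ^ (m ℕ.+ n) ≈ t ^ m * t ^ n
  ^-+ t zero    n = sym (*-identityˡ _)
  ^-+ t (suc m) n = trans (*-congˡ (^-+ t m n)) (sym (*-assoc t _ _))

  ^-* : ∀ s t n → (s * t) ^ n ≈ s ^ n * t ^ n
  ^-* s t zero    = sym (*-identityˡ _)
  ^-* s t (suc n) = trans (*-congˡ (^-* s t n))
    (solve 4 (λ s t x y → (s :* t) :* (x :* y) := (s :* x) :* (t :* y)) refl s t _ _)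

  ^-mono-exp : ∀ {t} → 0# ≤ t → t ≤ 1# → ∀ {m n} → m ℕ.≤ n → t ^ n ≤ t ^ m
  ^-mono-exp {t} 0≤t t≤1 {m} {n} m≤n =
    ≡.subst (λ k → t ^ k ≤ t ^ m) (ℕₚ.m∸n+n≡m m≤n) (^-anti-≤ 0≤t t≤1 (n ℕ.∸ m) m)

module Limits {c ℓ₁ ℓ₂ : Level} {ℝ : RealField c ℓ₁ ℓ₂} (N : NormedRing ℝ) where
  private
    module R = RealField ℝ
    module S = Solve R.commutativeRing
  open Order ℝ
  open RealLemmas ℝ
  open NormedRing N
  open CommutativeRing commutativeRing
  open Solve commutativeRing
  open R using () renaming (Carrier to ∣ℝ∣; _<_ to _<ℝ_; 0# to 0ℝ; 1# to 1ℝ)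

  infix 4 _⟿_

  _⟿_ : (ℕ → Carrier) → Carrier → Set (c ⊔ ℓ₂)
  s ⟿ z = ∀ ε → 0ℝ <ℝ ε → ∃[ M ] (∀ n → M ℕ.≤ n → s n - z ≼ ε)

  ⟿-by-multiple : ∀ {s z} C → 0ℝ ≤ C →
    (∀ δ → 0ℝ <ℝ δ → δ ≤ 1ℝ → ∃[ M ] (∀ n → M ℕ.≤ n → s n - z ≼ C R.* δ)) → s ⟿ z
  ⟿-by-multiple C 0≤C h ε 0<ε =
    let δ , 0<δ , δ≤1 , Cδ≤ε = small-multiple 0≤C 0<ε
        M , k = h δ 0<δ δ≤1
    in M , λ n M≤n → ≼-weaken Cδ≤ε (k n M≤n)

  ⟿-cong : ∀ {s s′ z z′} → (∀ n → s n ≈ s′ n) → z ≈ z′ → s ⟿ z → s′ ⟿ z′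
  ⟿-cong s≈s′ z≈z′ h ε 0<ε =
    let M , k = h ε 0<ε in M , λ n M≤n → ≼-cong (+-cong (s≈s′ n) (-‿cong z≈z′)) R.refl (k n M≤n)

  private
    2-nonneg : 0ℝ ≤ 1ℝ R.+ 1ℝ
    2-nonneg = +-nonneg (<⇒≤ 0<1) (<⇒≤ 0<1)

    δ+δ : ∀ δ → δ R.+ δ R.≈ (1ℝ R.+ 1ℝ) R.* δ
    δ+δ = S.solve 1 (λ d → d S.:+ d S.:= (S.:1 S.:+ S.:1) S.:* d) R.refl

  ⟿-unique : ∀ {s z w} → s ⟿ z → s ⟿ w → z ≈ w
  ⟿-unique {s} {z} {w} h k = begin
    z              ≈⟨ solve 2 (λ z w → z := (z :- w) :+ w) refl z w ⟩
    (z - w) + w    ≈⟨ +-congʳ (≼-zero⇒≈0 (≼-closed ≤-refl close)) ⟩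
    0# + w         ≈⟨ +-identityˡ w ⟩
    w              ∎
    where
    open import Relation.Binary.Reasoning.Setoid setoid
    close : ∀ ε → 0ℝ <ℝ ε → z - w ≼ 0ℝ R.+ ε
    close ε 0<ε =
      let M  , h′ = h (½ R.* ε) (R.*-pos 0<½ 0<ε)
          M′ , k′ = k (½ R.* ε) (R.*-pos 0<½ 0<ε)
          n = M ℕ.+ M′
      in ≼-cong
      (solve 3 (λ s z w → (s :- w) :+ (:- (s :- z)) := z :- w) refl (s n) z w)
      (R.trans (½*x+½*x ε) (R.sym (R.+-identityˡ ε)))
      (≼-+ (k′ n (ℕₚ.m≤n+m M′ M)) (≼-neg (h′ n (ℕₚ.m≤m+n M M′))))

  ⟿-const : ∀ z → (λ _ → z) ⟿ z
  ⟿-const z ε 0<ε = 0 , λ _ _ → ≼-cong (sym (-‿inverseʳ z)) R.refl (≼-weaken (<⇒≤ 0<ε) ≼-zero)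

  ⟿-+ : ∀ {s t z w} → s ⟿ z → t ⟿ w → (λ n → s n + t n) ⟿ z + w
  ⟿-+ {s} {t} {z} {w} h k = ⟿-by-multiple (1ℝ R.+ 1ℝ) 2-nonneg near
    where
    near : ∀ δ → 0ℝ <ℝ δ → δ ≤ 1ℝ →
      ∃[ M ] (∀ n → M ℕ.≤ n → (s n + t n) - (z + w) ≼ (1ℝ R.+ 1ℝ) R.* δ)
    near δ 0<δ _ =
      let M  , h′ = h δ 0<δ
          M′ , k′ = k δ 0<δ
      in M ℕ.+ M′ , λ n M+M′≤n → ≼-cong
      (solve 4 (λ s t z w → (s :- z) :+ (t :- w) := (s :+ t) :- (z :+ w)) refl (s n) (t n) z w)
      (δ+δ δ)
      (≼-+ (h′ n (ℕₚ.≤-trans (ℕₚ.m≤m+n M M′) M+M′≤n)) (k′ n (ℕₚ.≤-trans (ℕₚ.m≤n+m M′ M) M+M′≤n)))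

  ⟿-* : ∀ {s t z w} → s ⟿ z → t ⟿ w → (λ n → s n * t n) ⟿ z * w
  ⟿-* {s} {t} {z} {w} h k =
    ⟿-by-multiple (1ℝ R.+ W R.+ Z) (+-nonneg (+-nonneg (<⇒≤ 0<1) (≼⇒0≤ w≼W)) (≼⇒0≤ z≼Z)) near
    where
    Z = proj₁ (≼-bound z)
    z≼Z = proj₂ (≼-bound z)
    W = proj₁ (≼-bound w)
    w≼W = proj₂ (≼-bound w)
    near : ∀ δ → 0ℝ <ℝ δ → δ ≤ 1ℝ →
      ∃[ M ] (∀ n → M ℕ.≤ n → s n * t n - z * w ≼ (1ℝ R.+ W R.+ Z) R.* δ)
    near δ 0<δ δ≤1 =
      let M  , h′ = h δ 0<δ
          M′ , k′ = k δ 0<δ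
      in M ℕ.+ M′ , λ n M+M′≤n →
      let hₙ = h′ n (ℕₚ.≤-trans (ℕₚ.m≤m+n M M′) M+M′≤n)
          kₙ = k′ n (ℕₚ.≤-trans (ℕₚ.m≤n+m M′ M) M+M′≤n)
      in ≼-cong
        (solve 4 (λ s t z w → (s :- z) :* (t :- w) :+ (s :- z) :* w :+ z :* (t :- w)
          := s :* t :- z :* w) refl (s n) (t n) z w)
        (S.solve 3 (λ d w z → S.:1 S.:* d S.:+ d S.:* w S.:+ z S.:* d
          S.:= (S.:1 S.:+ w S.:+ z) S.:* d) R.refl δ W Z)
        (≼-+ (≼-+ (≼-weaken (*-mono-≤ (<⇒≤ 0<δ) (<⇒≤ 0<δ) δ≤1 ≤-refl) (≼-* hₙ kₙ))
                  (≼-* hₙ w≼W))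
             (≼-* z≼Z kₙ))

  ⟿-subseq : ∀ {s z} (φ : ℕ → ℕ) → (∀ n → n ℕ.≤ φ n) → s ⟿ z → (λ n → s (φ n)) ⟿ z
  ⟿-subseq φ n≤φn h ε 0<ε =
    let M , k = h ε 0<ε in M , λ n M≤n → k (φ n) (ℕₚ.≤-trans M≤n (n≤φn n))

  ⟿-suc : ∀ {s z} → s ⟿ z → (λ n → s (suc n)) ⟿ z
  ⟿-suc = ⟿-subseq suc ℕₚ.n≤1+n

  ⟿-pred : ∀ {s z} → (λ n → s (suc n)) ⟿ z → s ⟿ z
  ⟿-pred h ε 0<ε =
    let M , k = h ε 0<ε in suc M , λ { (suc n) (ℕ.s≤s M≤n) → k n M≤n }

  ⟿-near : ∀ {s s′ z τ} C → 0ℝ ≤ C → 0ℝ ≤ τ → τ <ℝ 1ℝ →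
    (∀ n → s′ n - s n ≼ C R.* τ R.^ n) → s ⟿ z → s′ ⟿ z
  ⟿-near {s} {s′} {z} {τ} C 0≤C 0≤τ τ<1 s′-s h = ⟿-by-multiple (1ℝ R.+ 1ℝ) 2-nonneg near
    where
    near : ∀ δ → 0ℝ <ℝ δ → δ ≤ 1ℝ → ∃[ M ] (∀ n → M ℕ.≤ n → s′ n - z ≼ (1ℝ R.+ 1ℝ) R.* δ)
    near δ 0<δ _ =
      let M  , h′   = h δ 0<δ
          M′ , Cτ<δ = geometric-small 0≤τ τ<1 0≤C 0<δ
      in M ℕ.+ M′ , λ n M+M′≤n → ≼-cong
      (solve 3 (λ s′ s z → (s′ :- s) :+ (s :- z) := s′ :- z) refl (s′ n) (s n) z)
      (δ+δ δ)
      (≼-+ (≼-weaken (≤-trans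
             (*-monoʳ-≤ 0≤C (^-mono-exp 0≤τ (<⇒≤ τ<1) (ℕₚ.≤-trans (ℕₚ.m≤n+m M′ M) M+M′≤n)))
             (<⇒≤ Cτ<δ)) (s′-s n))
           (h′ n (ℕₚ.≤-trans (ℕₚ.m≤m+n M M′) M+M′≤n)))

  ⟿-≼ : ∀ {s z t} → s ⟿ z → 0ℝ ≤ t → (∀ n → s n ≼ t) → z ≼ t
  ⟿-≼ {s} {z} {t} h 0≤t s≼t = ≼-closed 0≤t close
    where
    close : ∀ ε → 0ℝ <ℝ ε → z ≼ t R.+ ε
    close ε 0<ε = let M , h′ = h ε 0<ε in ≼-cong (solve 2 (λ s z → s :+ (:- (s :- z)) := z) refl (s M) z) R.refl
      (≼-+ (s≼t M) (≼-neg (h′ M ℕₚ.≤-refl)))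

  psum pprod : (ℕ → Carrier) → ℕ → Carrier
  psum u zero    = 0#
  psum u (suc n) = psum u n + u n
  pprod u zero    = 1#
  pprod u (suc n) = pprod u n * u n

  psum-cong : ∀ {u v} → (∀ n → u n ≈ v n) → ∀ n → psum u n ≈ psum v n
  psum-cong u≈v zero    = refl
  psum-cong u≈v (suc n) = +-cong (psum-cong u≈v n) (u≈v n)

  psum-+ : ∀ u v n → psum (λ i → u i + v i) n ≈ psum u n + psum v n
  psum-+ u v zero    = sym (+-identityˡ 0#)
  psum-+ u v (suc n) = trans (+-congʳ (psum-+ u v n))
    (solve 4 (λ a b x y → (a :+ b) :+ (x :+ y) := (a :+ x) :+ (b :+ y)) refl _ _ _ _)

  psum-*ˡ : ∀ a u n → psum (λ i → a * u i) n ≈ a * psum u n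
  psum-*ˡ a u zero    = sym (zeroʳ a)
  psum-*ˡ a u (suc n) = trans (+-congʳ (psum-*ˡ a u n)) (sym (distribˡ a _ _))

  psum-suc : ∀ u n → psum u (suc n) ≈ u 0 + psum (λ i → u (suc i)) n
  psum-suc u zero    = +-comm 0# (u 0)
  psum-suc u (suc n) = trans (+-congʳ (psum-suc u n)) (+-assoc _ _ _)

  psum-≼ : ∀ u D n → 0ℝ ≤ D → (∀ i → i ℕ.< n → u i ≼ D R.* ½ R.^ suc i) → psum u n ≼ D
  psum-≼ u D n 0≤D h = ≼-weaken (x-y≤x (*-nonneg 0≤D (^-nonneg (<⇒≤ 0<½) n))) (go n h)
    where
    go : ∀ n → (∀ i → i ℕ.< n → u i ≼ D R.* ½ R.^ suc i) → psum u n ≼ D R.- D R.* ½ R.^ n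
    go zero    h = ≼-cong refl (S.solve 1 (λ d → S.:0 S.:= d S.:- d S.:* S.:1) R.refl D) ≼-zero
    go (suc n) h = ≼-cong refl
      (R.trans (S.solve 3 (λ d h p → d S.:- d S.:* p S.:+ d S.:* (h S.:* p)
          S.:= d S.:- d S.:* (h S.:* p) S.:+ d S.:* ((h S.:+ h S.:- S.:1) S.:* p)) R.refl D ½ (½ R.^ n))
        (R.trans (R.+-congˡ (R.trans (R.*-congˡ (R.*-congʳ (R.+-congʳ ½+½≈1)))
          (S.solve 2 (λ d p → d S.:* ((S.:1 S.:- S.:1) S.:* p) S.:= S.:0) R.refl D (½ R.^ n))))
          (R.+-identityʳ _)))
      (≼-+ (go n (λ i i<n → h i (ℕₚ.m<n⇒m<1+n i<n))) (h n ℕₚ.≤-refl))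

module BilateralSums {c ℓ₁ ℓ₂ : Level} {ℝ : RealField c ℓ₁ ℓ₂} (N : NormedRing ℝ) where
  private
    module R = RealField ℝ
    module S = Solve R.commutativeRing
    module ℤS = ℤSolver.+-*-Solver
  open Order ℝ
  open RealLemmas ℝ
  open NormedRing N
  open CommutativeRing commutativeRing
  open Solve commutativeRing
  open Limits N
  open R using () renaming (Carrier to ∣ℝ∣; _<_ to _<ℝ_; 0# to 0ℝ; 1# to 1ℝ)
  open import Relation.Binary.Reasoning.Setoid setoid

  psum-range : ∀ u m n → psum u (m ℕ.+ n) - psum u n ≈ psum (λ i → u (i ℕ.+ n)) m
  psum-range u zero    n = -‿inverseʳ _
  psum-range u (suc m) n = trans
    (solve 3 (λ a b x → (a :+ x) :- b := (a :- b) :+ x) refl _ _ _)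
    (+-congʳ (psum-range u m n))

  psum-double : ∀ u n →
    psum u (n ℕ.+ n) ≈ psum (λ i → u (i ℕ.+ i)) n + psum (λ i → u (suc (i ℕ.+ i))) n
  psum-double u zero    = sym (+-identityˡ 0#)
  psum-double u (suc n) = begin
    psum u (suc n ℕ.+ suc n)                       ≡⟨ ≡.cong (psum u ∘ suc) (ℕₚ.+-suc n n) ⟩
    psum u (n ℕ.+ n) + u (n ℕ.+ n) + u (suc (n ℕ.+ n)) ≈⟨ +-congʳ (+-congʳ (psum-double u n)) ⟩
    _ ≈⟨ solve 4 (λ a b x y → a :+ b :+ x :+ y := (a :+ x) :+ (b :+ y)) refl _ _ _ _ ⟩
    _ ∎

  psum-converges : ∀ u D → (∀ n → u n ≼ D R.* ½ R.^ suc n) → ∃[ z ] psum u ⟿ z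
  psum-converges u D h = ≼-complete (psum u) (D R.* ½) (λ n → ≼-cong
    (solve 2 (λ s x → x := (s :+ x) :- s) refl (psum u n) (u n))
    (R.sym (R.*-assoc D ½ _)) (h n))

  record _sumsTo_ (g : ℤ → Carrier) (s : Carrier) : Set (c ⊔ ℓ₁ ⊔ ℓ₂) where
    constructor sums
    field
      {s⁺ s⁻}    : Carrier
      converges⁺ : psum (g ∘ +_) ⟿ s⁺
      converges⁻ : psum (g ∘ -[1+_]) ⟿ s⁻
      total      : s⁺ + s⁻ ≈ s

  window : (ℤ → Carrier) → ℕ → Carrier
  window g = psum (λ n → g (+ n) + g -[1+ n ])

  window-⟿ : ∀ {g s} → g sumsTo s → window g ⟿ s
  window-⟿ {g} (sums h⁺ h⁻ e) =
    ⟿-cong (λ n → sym (psum-+ (g ∘ +_) (g ∘ -[1+_]) n)) e (⟿-+ h⁺ h⁻)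

  sumsTo-unique : ∀ {g s t} → g sumsTo s → g sumsTo t → s ≈ t
  sumsTo-unique h k = ⟿-unique (window-⟿ h) (window-⟿ k)

  sumsTo-cong : ∀ {g g′ s s′} → (∀ n → g n ≈ g′ n) → s ≈ s′ → g sumsTo s → g′ sumsTo s′
  sumsTo-cong g≈g′ s≈s′ (sums h⁺ h⁻ e) = sums
    (⟿-cong (psum-cong (g≈g′ ∘ +_)) refl h⁺) (⟿-cong (psum-cong (g≈g′ ∘ -[1+_])) refl h⁻)
    (trans e s≈s′)

  sumsTo-≡ : ∀ {g g′ : ℤ → ℤ} (u : ℤ → Carrier) {s} → (∀ n → g n ≡ g′ n) →
    (u ∘ g) sumsTo s → (u ∘ g′) sumsTo s
  sumsTo-≡ u g≡g′ = sumsTo-cong (λ n → reflexive (≡.cong u (g≡g′ n))) refl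

  sumsTo-*ˡ : ∀ a {g s} → g sumsTo s → (λ n → a * g n) sumsTo (a * s)
  sumsTo-*ˡ a {g} (sums h⁺ h⁻ e) = sums
    (⟿-cong (λ n → sym (psum-*ˡ a (g ∘ +_) n)) refl (⟿-* (⟿-const a) h⁺))
    (⟿-cong (λ n → sym (psum-*ˡ a (g ∘ -[1+_]) n)) refl (⟿-* (⟿-const a) h⁻))
    (trans (sym (distribˡ a _ _)) (*-congˡ e))

  sumsTo-*ʳ : ∀ a {g s} → g sumsTo s → (λ n → g n * a) sumsTo (s * a)
  sumsTo-*ʳ a h = sumsTo-cong (λ n → *-comm _ _) (*-comm _ _) (sumsTo-*ˡ a h)

  sumsTo-+ : ∀ {g g′ s s′} → g sumsTo s → g′ sumsTo s′ → (λ n → g n + g′ n) sumsTo (s + s′)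
  sumsTo-+ {g} {g′} (sums h⁺ h⁻ e) (sums k⁺ k⁻ e′) = sums
    (⟿-cong (λ n → sym (psum-+ (g ∘ +_) (g′ ∘ +_) n)) refl (⟿-+ h⁺ k⁺))
    (⟿-cong (λ n → sym (psum-+ (g ∘ -[1+_]) (g′ ∘ -[1+_]) n)) refl (⟿-+ h⁻ k⁻))
    (trans (solve 4 (λ a b x y → (a :+ x) :+ (b :+ y) := (a :+ b) :+ (x :+ y)) refl _ _ _ _)
      (+-cong e e′))

  private
    drop-first : ∀ {u z} → psum u ⟿ z → psum (u ∘ suc) ⟿ z - u 0
    drop-first {u} h = ⟿-cong
      (λ n → trans (+-congʳ (psum-suc u n))
        (solve 2 (λ x s → (x :+ s) :- x := s) refl (u 0) (psum (u ∘ suc) n)))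
      refl (⟿-+ (⟿-suc h) (⟿-const (- u 0)))

    add-first : ∀ {u z} → psum (u ∘ suc) ⟿ z → psum u ⟿ u 0 + z
    add-first {u} h = ⟿-pred (⟿-cong (λ n → sym (psum-suc u n)) refl (⟿-+ (⟿-const (u 0)) h))

    shift-by-1 : ∀ {g s} → g sumsTo s → (λ n → g (ℤ.1ℤ ℤ.+ n)) sumsTo s
    shift-by-1 {g} (sums h⁺ h⁻ e) = sums (drop-first h⁺) (add-first h⁻) (trans
      (solve 3 (λ a b x → (a :- x) :+ (x :+ b) := a :+ b) refl _ _ _) e)

    shift-by--1 : ∀ {g s} → g sumsTo s → (λ n → g (ℤ.-1ℤ ℤ.+ n)) sumsTo s
    shift-by--1 {g} (sums h⁺ h⁻ e) = sums (add-first h⁺) (drop-first h⁻) (trans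
      (solve 3 (λ a b x → (x :+ a) :+ (b :- x) := a :+ b) refl _ _ _) e)

  sumsTo-shift : ∀ m {g s} → g sumsTo s → (λ n → g (m ℤ.+ n)) sumsTo s
  sumsTo-shift (+ zero) {g} h = sumsTo-≡ g (λ n → ≡.sym (ℤₚ.+-identityˡ n)) h
  sumsTo-shift (+ suc j) {g} h = sumsTo-≡ g
    (λ n → ≡.trans (≡.sym (ℤₚ.+-assoc (+ j) ℤ.1ℤ n)) (≡.cong (λ i → + i ℤ.+ n) (ℕₚ.+-comm j 1)))
    (shift-by-1 (sumsTo-shift (+ j) h))
  sumsTo-shift -[1+ zero ] {g} h = shift-by--1 h
  sumsTo-shift -[1+ suc j ] {g} h = sumsTo-≡ g
    (λ n → ≡.trans (≡.sym (ℤₚ.+-assoc -[1+ j ] ℤ.-1ℤ n))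
      (≡.cong (λ i → -[1+ suc i ] ℤ.+ n) (ℕₚ.+-identityʳ j)))
    (shift-by--1 (sumsTo-shift -[1+ j ] h))

  sumsTo-split : ∀ {g s e o} → g sumsTo s → (λ n → g (n ℤ.+ n)) sumsTo e →
    (λ n → g (ℤ.1ℤ ℤ.+ (n ℤ.+ n))) sumsTo o → s ≈ e + o
  sumsTo-split {g} {s} {e} {o} (sums h⁺ h⁻ p) (sums {e⁺} {e⁻} e⁺⟿ e⁻⟿ q) (sums {o⁺} {o⁻} o⁺⟿ o⁻⟿ r) = begin
    s                           ≈⟨ p ⟨
    _ + _                       ≈⟨ +-cong (halves (g ∘ +_) h⁺ e⁺⟿ o⁺⟿) (halves (g ∘ -[1+_]) h⁻ o⁻⟿ e⁻⟿) ⟩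
    (e⁺ + o⁺) + (o⁻ + e⁻)       ≈⟨ solve 4 (λ a b x y → (a :+ b) :+ (x :+ y)
                                     := (a :+ y) :+ (b :+ x)) refl e⁺ o⁺ o⁻ e⁻ ⟩
    (e⁺ + e⁻) + (o⁺ + o⁻)       ≈⟨ +-cong q r ⟩
    e + o                       ∎
    where
    halves : ∀ u {z a b} → psum u ⟿ z → psum (λ i → u (i ℕ.+ i)) ⟿ a →
      psum (λ i → u (suc (i ℕ.+ i))) ⟿ b → z ≈ a + b
    halves u h k l = ⟿-unique
      (⟿-cong (psum-double u) refl (⟿-subseq (λ n → n ℕ.+ n) (λ n → ℕₚ.m≤m+n n n) h)) (⟿-+ k l)

  private
    thrice : ∣ℝ∣ → ∣ℝ∣
    thrice C = C R.+ C R.+ C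

    thrice-nonneg : ∀ {C} → 0ℝ ≤ C → 0ℝ ≤ thrice C
    thrice-nonneg h = +-nonneg (+-nonneg h h) h

    half-step : ∀ C n → C R.* ½ R.^ n R.≈ (C R.+ C) R.* ½ R.^ suc n
    half-step C n = R.trans
      (R.*-congˡ (R.trans (R.sym (R.*-identityˡ _)) (R.*-congʳ (R.sym ½+½≈1))))
      (S.solve 3 (λ c h p → c S.:* ((h S.:+ h) S.:* p) S.:= (c S.:+ c) S.:* (h S.:* p)) R.refl C ½ (½ R.^ n))

  Decays : (ℤ → Carrier) → ∣ℝ∣ → Set ℓ₂
  Decays g C = ∀ n → g n ≼ C R.* ½ R.^ ∣ n ∣

  module _ {g : ℤ → Carrier} {C : ∣ℝ∣} (g≼ : Decays g C) where
    private
      0≤C : 0ℝ ≤ C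
      0≤C = ≤-resp R.refl (R.*-identityʳ C) (≼⇒0≤ (g≼ (+ 0)))

      pair≼ : ∀ n → g (+ n) + g -[1+ n ] ≼ thrice C R.* ½ R.^ suc n
      pair≼ n = ≼-cong refl
        (R.sym (R.distribʳ (½ R.^ suc n) (C R.+ C) C))
        (≼-+ (≼-cong refl (half-step C n) (g≼ (+ n))) (g≼ -[1+ n ]))

    decay-converges : ∃[ s ] g sumsTo s
    decay-converges =
      let s⁺ , h⁺ = psum-converges (g ∘ +_) (C R.+ C)
            (λ n → ≼-cong refl (half-step C n) (g≼ (+ n)))
          s⁻ , h⁻ = psum-converges (g ∘ -[1+_]) C (λ n → g≼ -[1+ n ])
      in s⁺ + s⁻ , sums h⁺ h⁻ refl

    window-≼ : ∀ M → window g M ≼ thrice C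
    window-≼ M = psum-≼ _ (thrice C) M (thrice-nonneg 0≤C) (λ i _ → pair≼ i)

    sum-≼ : ∀ {s} → g sumsTo s → s ≼ thrice C
    sum-≼ h = ⟿-≼ (window-⟿ h) (thrice-nonneg 0≤C) window-≼

    tail-≼ : ∀ {s} → g sumsTo s → ∀ M → s - window g M ≼ thrice C R.* ½ R.^ M
    tail-≼ h M = ⟿-≼
      (⟿-+ (⟿-subseq (ℕ._+ M) (λ n → ℕₚ.m≤m+n n M) (window-⟿ h)) (⟿-const (- window g M)))
      0≤D
      (λ n → ≼-cong (sym (psum-range _ n M)) R.refl (psum-≼ _ _ n 0≤D (λ i _ →
        ≼-cong refl (R.trans (R.*-congˡ (R.*-congˡ (^-+ ½ i M)))
          (S.solve 4 (λ t h p q → t S.:* (h S.:* (p S.:* q)) S.:= (t S.:* q) S.:* (h S.:* p))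
            R.refl (thrice C) ½ (½ R.^ i) (½ R.^ M)))
          (pair≼ (i ℕ.+ M)))))
      where
      0≤D = *-nonneg (thrice-nonneg 0≤C) (^-nonneg (<⇒≤ 0<½) M)

  window-cong : ∀ {g g′} → (∀ n → g n ≈ g′ n) → ∀ M → window g M ≈ window g′ M
  window-cong g≈g′ = psum-cong (λ n → +-cong (g≈g′ (+ n)) (g≈g′ -[1+ n ]))

  window-+ : ∀ g g′ M → window (λ n → g n + g′ n) M ≈ window g M + window g′ M
  window-+ g g′ M = trans
    (psum-cong (λ n → solve 4 (λ a b x y → (a :+ b) :+ (x :+ y) := (a :+ x) :+ (b :+ y)) refl _ _ _ _) M)
    (psum-+ _ _ M)

  window-- : ∀ g g′ M → window (λ n → g n - g′ n) M ≈ window g M - window g′ M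
  window-- g g′ M = begin
    window (λ n → g n - g′ n) M
      ≈⟨ solve 2 (λ x y → x := (x :+ y) :- y) refl _ _ ⟩
    window (λ n → g n - g′ n) M + window g′ M - window g′ M
      ≈⟨ +-congʳ (window-+ (λ n → g n - g′ n) g′ M) ⟨
    window (λ n → g n - g′ n + g′ n) M - window g′ M
      ≈⟨ +-congʳ (window-cong (λ n → solve 2 (λ x y → x :- y :+ y := x) refl (g n) (g′ n)) M) ⟩
    window g M - window g′ M ∎

  window-0 : ∀ M → window (λ _ → 0#) M ≈ 0#
  window-0 zero    = refl
  window-0 (suc M) = trans (+-cong (window-0 M) (+-identityˡ 0#)) (+-identityˡ 0#)

  window-swap : ∀ (H : ℤ → ℤ → Carrier) L M →
    window (λ m → window (H m) M) L ≈ window (λ n → window (λ m → H m n) L) M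
  window-swap H zero    M = sym (window-0 M)
  window-swap H (suc L) M = begin
    window (λ m → window (H m) M) L + (window (H (+ L)) M + window (H -[1+ L ]) M)
      ≈⟨ +-cong (window-swap H L M) (sym (window-+ (H (+ L)) (H -[1+ L ]) M)) ⟩
    window (λ n → window (λ m → H m n) L) M + window (λ n → H (+ L) n + H -[1+ L ] n) M
      ≈⟨ window-+ (λ n → window (λ m → H m n) L) (λ n → H (+ L) n + H -[1+ L ] n) M ⟨
    window (λ n → window (λ m → H m n) (suc L)) M ∎

  fubini : ∀ (H : ℤ → ℤ → Carrier) C → (∀ m n → H m n ≼ C R.* ½ R.^ ∣ m ∣ R.* ½ R.^ ∣ n ∣) →
    ∀ {A B s t} → (∀ m → H m sumsTo A m) → (∀ n → (λ m → H m n) sumsTo B n) →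
    A sumsTo s → B sumsTo t → s ≈ t
  fubini H C H≼ rows columns A⟶s B⟶t = ⟿-unique (by-rows H H≼ rows A⟶s)
    (⟿-cong (λ M → sym (window-swap H M M)) refl (by-rows (λ n m → H m n)
      (λ n m → ≼-cong refl (S.solve 3 (λ c x y → c S.:* x S.:* y S.:= c S.:* y S.:* x)
        R.refl C (½ R.^ ∣ m ∣) (½ R.^ ∣ n ∣)) (H≼ m n))
      columns B⟶t))
    where
    0≤C : 0ℝ ≤ C
    0≤C = ≤-resp R.refl (R.trans (R.*-identityʳ _) (R.*-identityʳ C)) (≼⇒0≤ (H≼ (+ 0) (+ 0)))
    by-rows : ∀ (H : ℤ → ℤ → Carrier) → (∀ m n → H m n ≼ C R.* ½ R.^ ∣ m ∣ R.* ½ R.^ ∣ n ∣) →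
      ∀ {A s} → (∀ m → H m sumsTo A m) → A sumsTo s →
      (λ M → window (λ m → window (H m) M) M) ⟿ s
    by-rows H H≼ {A} rows A⟶s = ⟿-near (thrice (thrice C)) (thrice-nonneg (thrice-nonneg 0≤C))
      (<⇒≤ 0<½) ½<1
      (λ M → ≼-cong (trans (-‿cong (window-- A (λ m → window (H m) M) M))
            (solve 2 (λ x y → :- (x :- y) := y :- x) refl _ _))
          (S.solve 2 (λ c h → (c S.:+ c S.:+ c) S.:* h S.:+ (c S.:+ c S.:+ c) S.:* h S.:+
            (c S.:+ c S.:+ c) S.:* h
            S.:= ((c S.:+ c S.:+ c) S.:+ (c S.:+ c S.:+ c) S.:+ (c S.:+ c S.:+ c)) S.:* h) R.refl C (½ R.^ M))
          (≼-neg (window-≼ {C = thrice C R.* ½ R.^ M}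
            (λ m → ≼-cong refl
              (S.solve 3 (λ c x y → (c S.:* x S.:+ c S.:* x S.:+ c S.:* x) S.:* y
                S.:= (c S.:+ c S.:+ c) S.:* y S.:* x) R.refl C (½ R.^ ∣ m ∣) (½ R.^ M))
              (tail-≼ {C = C R.* ½ R.^ ∣ m ∣} (H≼ m) (rows m) M)) M)))
      (window-⟿ A⟶s)

  DecaysQuickly : (ℤ → Carrier) → ∣ℝ∣ → Set ℓ₂
  DecaysQuickly h C = ∀ n → h n ≼ C R.* (½ R.* ½) R.^ ∣ n ∣

  autocorrelation : ∀ {h C s} → DecaysQuickly h C → h sumsTo s →
    ∃[ B ] (∀ v → (λ n → h n * h (v ℤ.+ n)) sumsTo B v) × (B sumsTo (s * s))
  autocorrelation {h} {C} {s} h≼ h⟶s =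
    B , B⟶ , sumsTo-cong (λ _ → refl) (sym (fubini H (C R.* C) H≼ rows B⟶ A⟶ (proj₂ ΣB))) (proj₂ ΣB)
    where
    H : ℤ → ℤ → Carrier
    H n v = h n * h (v ℤ.+ n)
    0≤C : 0ℝ ≤ C
    0≤C = ≤-resp R.refl (R.*-identityʳ C) (≼⇒0≤ (h≼ (+ 0)))
    ∣v∣≤ : ∀ n v → ∣ v ∣ ℕ.≤ ∣ n ∣ ℕ.+ ∣ v ℤ.+ n ∣
    ∣v∣≤ n v = ≡.subst₂ ℕ._≤_
      (≡.cong ∣_∣ (ℤS.solve 2 (λ v n → (v ℤS.:+ n) ℤS.:- n ℤS.:= v) ≡.refl v n))
      (ℕₚ.+-comm ∣ v ℤ.+ n ∣ ∣ n ∣) (ℤₚ.∣i-j∣≤∣i∣+∣j∣ (v ℤ.+ n) n)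
    H≼ : ∀ n v → H n v ≼ C R.* C R.* ½ R.^ ∣ n ∣ R.* ½ R.^ ∣ v ∣
    H≼ n v = ≼-weaken
      (≤-resp (R.sym (R.trans
          (R.*-cong (R.*-congˡ (^-* ½ ½ i)) (R.*-congˡ (^-* ½ ½ j)))
          (R.trans (S.solve 3 (λ c x y → (c S.:* (x S.:* x)) S.:* (c S.:* (y S.:* y))
              S.:= (c S.:* c) S.:* ((x S.:* y) S.:* (x S.:* y))) R.refl C (½ R.^ i) (½ R.^ j))
            (R.*-congˡ (R.*-cong (R.sym (^-+ ½ i j)) (R.sym (^-+ ½ i j)))))))
        (R.sym (R.*-assoc _ _ _))
        (*-monoʳ-≤ (*-nonneg 0≤C 0≤C) (*-mono-≤ (^-nonneg 0≤½ (i ℕ.+ j)) (^-nonneg 0≤½ ∣ v ∣)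
          (^-mono-exp 0≤½ ½≤1 (ℕₚ.m≤m+n i j)) (^-mono-exp 0≤½ ½≤1 (∣v∣≤ n v)))))
      (≼-* (h≼ n) (h≼ (v ℤ.+ n)))
      where
      i = ∣ n ∣
      j = ∣ v ℤ.+ n ∣
      0≤½ = <⇒≤ 0<½
    rows : ∀ n → H n sumsTo (h n * s)
    rows n = sumsTo-*ˡ (h n) (sumsTo-≡ h (λ v → ℤₚ.+-comm n v) (sumsTo-shift n h⟶s))
    A⟶ : (λ n → h n * s) sumsTo (s * s)
    A⟶ = sumsTo-*ʳ s h⟶s
    column≼ : ∀ v → Decays (λ n → H n v) (C R.* C R.* ½ R.^ ∣ v ∣)
    column≼ v n = ≼-cong refl (S.solve 3 (λ c x y → c S.:* x S.:* y S.:= c S.:* y S.:* x)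
      R.refl (C R.* C) (½ R.^ ∣ n ∣) (½ R.^ ∣ v ∣)) (H≼ n v)
    B : ℤ → Carrier
    B v = proj₁ (decay-converges (column≼ v))
    B⟶ : ∀ v → (λ n → H n v) sumsTo B v
    B⟶ v = proj₂ (decay-converges (column≼ v))
    ΣB : ∃[ t ] B sumsTo t
    ΣB = decay-converges {C = thrice (C R.* C)} (λ v → ≼-cong refl
      (S.solve 2 (λ c x → c S.:* x S.:+ c S.:* x S.:+ c S.:* x S.:= (c S.:+ c S.:+ c) S.:* x)
        R.refl (C R.* C) (½ R.^ ∣ v ∣))
      (sum-≼ (column≼ v) (B⟶ v)))

  -- For fixed v, the pairs (m , n) with m - n = v give the even-indexed terms of γ (v + ·) in the
  -- first square and the odd-indexed ones in the second.
  sum-of-squares : ∀ {γ δ h k C D Γ Δ s t} (c d : Carrier) →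
    DecaysQuickly h C → DecaysQuickly k D →
    γ sumsTo Γ → δ sumsTo Δ → h sumsTo s → k sumsTo t →
    (∀ m n → c * (h m * h n) ≈ γ (m ℤ.+ n) * δ (m ℤ.- n)) →
    (∀ m n → d * (k m * k n) ≈ γ (ℤ.1ℤ ℤ.+ (m ℤ.+ n)) * δ (m ℤ.- n)) →
    c * (s * s) + d * (t * t) ≈ Γ * Δ
  sum-of-squares {γ} {δ} {h} {k} {Γ = Γ} {Δ} {s} {t} c d h≼ k≼ γ⟶ δ⟶ h⟶ k⟶ hh≈ kk≈ =
    sumsTo-unique
      (sumsTo-cong diagonal refl (sumsTo-+ (sumsTo-*ˡ c (proj₂ (proj₂ autoₕ)))
        (sumsTo-*ˡ d (proj₂ (proj₂ autoₖ)))))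
      (sumsTo-*ˡ Γ δ⟶)
    where
    autoₕ = autocorrelation h≼ h⟶
    autoₖ = autocorrelation k≼ k⟶
    difference : ∀ v n → (v ℤ.+ n) ℤ.- n ≡ v
    difference = ℤS.solve 2 (λ v n → (v ℤS.:+ n) ℤS.:- n ℤS.:= v) ≡.refl
    diagonal : ∀ v → c * proj₁ autoₕ v + d * proj₁ autoₖ v ≈ Γ * δ v
    diagonal v = sym (sumsTo-split
      (sumsTo-*ʳ (δ v) (sumsTo-shift v γ⟶))
      (sumsTo-cong (λ n → begin
          c * (h n * h (v ℤ.+ n))                  ≈⟨ *-congˡ (*-comm _ _) ⟩
          c * (h (v ℤ.+ n) * h n)                  ≈⟨ hh≈ (v ℤ.+ n) n ⟩
          γ (v ℤ.+ n ℤ.+ n) * δ (v ℤ.+ n ℤ.- n)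
            ≡⟨ ≡.cong₂ (λ i j → γ i * δ j) (ℤₚ.+-assoc v n n) (difference v n) ⟩
          γ (v ℤ.+ (n ℤ.+ n)) * δ v                ∎)
        refl (sumsTo-*ˡ c (proj₁ (proj₂ autoₕ) v)))
      (sumsTo-cong (λ n → begin
          d * (k n * k (v ℤ.+ n))                  ≈⟨ *-congˡ (*-comm _ _) ⟩
          d * (k (v ℤ.+ n) * k n)                  ≈⟨ kk≈ (v ℤ.+ n) n ⟩
          γ (ℤ.1ℤ ℤ.+ (v ℤ.+ n ℤ.+ n)) * δ (v ℤ.+ n ℤ.- n)
            ≡⟨ ≡.cong₂ (λ i j → γ i * δ j)
                 (ℤS.solve 2 (λ v n → ℤS.con ℤ.1ℤ ℤS.:+ (v ℤS.:+ n ℤS.:+ n)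
                   ℤS.:= v ℤS.:+ (ℤS.con ℤ.1ℤ ℤS.:+ (n ℤS.:+ n))) ≡.refl v n)
                 (difference v n) ⟩
          γ (v ℤ.+ (ℤ.1ℤ ℤ.+ (n ℤ.+ n))) * δ v     ∎)
        refl (sumsTo-*ˡ d (proj₁ (proj₂ autoₖ) v))))

module Products {c ℓ₁ ℓ₂ : Level} {ℝ : RealField c ℓ₁ ℓ₂} (N : NormedRing ℝ) where
  private
    module R = RealField ℝ
    module S = Solve R.commutativeRing
  open Order ℝ
  open RealLemmas ℝ
  open NormedRing N
  open CommutativeRing commutativeRing
  open Solve commutativeRing
  open Limits N
  open RawSemiringDefs (Semiring.rawSemiring semiring) using (_^_)
  open R using () renaming (Carrier to ∣ℝ∣; _<_ to _<ℝ_; 0# to 0ℝ; 1# to 1ℝ)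

  pprod-cong : ∀ {u v} → (∀ n → u n ≈ v n) → ∀ n → pprod u n ≈ pprod v n
  pprod-cong u≈v zero    = refl
  pprod-cong u≈v (suc n) = *-cong (pprod-cong u≈v n) (u≈v n)

  pprod-suc : ∀ u n → pprod u (suc n) ≈ u 0 * pprod (u ∘ suc) n
  pprod-suc u zero    = *-comm 1# (u 0)
  pprod-suc u (suc n) = trans (*-congʳ (pprod-suc u n)) (*-assoc _ _ _)

  pprod-* : ∀ u v n → pprod (λ i → u i * v i) n ≈ pprod u n * pprod v n
  pprod-* u v zero    = sym (*-identityˡ 1#)
  pprod-* u v (suc n) = trans (*-congʳ (pprod-* u v n))
    (solve 4 (λ a b x y → (a :* b) :* (x :* y) := (a :* x) :* (b :* y)) refl _ _ _ _)

  pprod-double : ∀ u n →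
    pprod u (n ℕ.+ n) ≈ pprod (λ i → u (i ℕ.+ i)) n * pprod (λ i → u (suc (i ℕ.+ i))) n
  pprod-double u zero    = sym (*-identityˡ 1#)
  pprod-double u (suc n) = trans (reflexive (≡.cong (pprod u ∘ suc) (ℕₚ.+-suc n n)))
    (trans (*-congʳ (*-congʳ (pprod-double u n)))
      (solve 4 (λ a b x y → a :* b :* x :* y := (a :* x) :* (b :* y)) refl _ _ _ _))

  ≼-^ : ∀ {z t} → z ≼ t → ∀ n → z ^ n ≼ t R.^ n
  ≼-^ h zero    = ≼-one
  ≼-^ h (suc n) = ≼-* h (≼-^ h n)

  geometric-bound : ∀ (u r : ℕ → Carrier) {ρ} → 0ℝ <ℝ ρ → (∀ n → u (suc n) ≈ u n * r n) →
    ∀ M → (∀ n → r (n ℕ.+ M) ≼ ρ) → ∃[ C ] (∀ n → u n ≼ C R.* ρ R.^ n)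
  geometric-bound u r {ρ} 0<ρ rec zero r≼ρ = T , go
    where
    T = proj₁ (≼-bound (u 0))
    go : ∀ n → u n ≼ T R.* ρ R.^ n
    go zero    = ≼-cong refl (R.sym (R.*-identityʳ T)) (proj₂ (≼-bound (u 0)))
    go (suc n) = ≼-cong (sym (rec n))
      (S.solve 3 (λ t p q → t S.:* q S.:* p S.:= t S.:* (p S.:* q)) R.refl T ρ (ρ R.^ n))
      (≼-* (go n) (≡.subst (λ i → r i ≼ ρ) (ℕₚ.+-identityʳ n) (r≼ρ n)))
  geometric-bound u r {ρ} 0<ρ rec (suc M) r≼ρ = T R.+ C R.* i , go
    where
    T = proj₁ (≼-bound (u 0))
    0≤T = ≼⇒0≤ (proj₂ (≼-bound (u 0)))
    later = geometric-bound (u ∘ suc) (r ∘ suc) 0<ρ (rec ∘ suc) M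
      (λ n → ≡.subst (λ j → r j ≼ ρ) (ℕₚ.+-suc n M) (r≼ρ n))
    C = proj₁ later
    0≤C = ≤-resp R.refl (R.*-identityʳ C) (≼⇒0≤ (proj₂ later 0))
    inv = inverse 0<ρ
    i = proj₁ inv
    0≤i = <⇒≤ (proj₁ (proj₂ inv))
    go : ∀ n → u n ≼ (T R.+ C R.* i) R.* ρ R.^ n
    go zero    = ≼-weaken (≤-resp R.refl (R.sym (R.*-identityʳ _)) (x≤x+y (*-nonneg 0≤C 0≤i)))
      (proj₂ (≼-bound (u 0)))
    go (suc n) = ≼-weaken
      (≤-resp (R.trans
          (S.solve 4 (λ c i p q → (c S.:* i) S.:* (p S.:* q) S.:= (p S.:* i) S.:* (c S.:* q))
            R.refl C i ρ (ρ R.^ n))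
          (R.trans (R.*-congʳ (proj₂ (proj₂ inv))) (R.*-identityˡ _)))
        R.refl (*-monoˡ-≤ (^-nonneg (<⇒≤ 0<ρ) (suc n)) (x≤y+x 0≤T)))
      (proj₂ later n)

  small-power : ∀ x {p t} → p ≼ t → t <ℝ 1ℝ → ∀ {ε} → 0ℝ <ℝ ε → ∃[ M ] (∀ n → x * p ^ (n ℕ.+ M) ≼ ε)
  small-power x {p} {t} p≼t t<1 {ε} 0<ε =
    let X , x≼X = ≼-bound x
        M , Xt<ε = geometric-small (≼⇒0≤ p≼t) t<1 (≼⇒0≤ x≼X) 0<ε
    in M , λ n → ≼-weaken (≤-trans (*-monoʳ-≤ (≼⇒0≤ x≼X)
        (^-anti-≤ (≼⇒0≤ p≼t) (<⇒≤ t<1) n M)) (<⇒≤ Xt<ε))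
      (≼-* x≼X (≼-^ p≼t (n ℕ.+ M)))

  -- u (n + 1) / u n = x pⁿ → 0, so u decays faster than any geometric sequence.
  theta-bound : ∀ (u : ℕ → Carrier) x {p t} → p ≼ t → t <ℝ 1ℝ → (∀ n → u (suc n) ≈ u n * (x * p ^ n)) →
    ∀ {ρ} → 0ℝ <ℝ ρ → ∃[ C ] (∀ n → u n ≼ C R.* ρ R.^ n)
  theta-bound u x {p} p≼t t<1 rec 0<ρ =
    let M , small = small-power x p≼t t<1 0<ρ
    in geometric-bound u (λ n → x * p ^ n) 0<ρ rec M small

  module EulerProduct {p : Carrier} {t : ∣ℝ∣} (p≼t : p ≼ t) (t<1 : t <ℝ 1ℝ) where

    1-p^ : ℕ → Carrier
    1-p^ j = 1# - p ^ j

    -- (1 - pᵐ⁺¹) ⋯ (1 - pᵐ⁺ˡ)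
    Q : ℕ → ℕ → Carrier
    Q m = pprod (λ i → 1-p^ (suc (i ℕ.+ m)))

    Q-head : ∀ m l → Q m (suc l) ≈ 1-p^ (suc m) * Q (suc m) l
    Q-head m l = trans (pprod-suc _ l) (*-congˡ (pprod-cong
      (λ i → reflexive (≡.cong (1-p^ ∘ suc) (≡.sym (ℕₚ.+-suc i m)))) l))

    private
      0≤t : 0ℝ ≤ t
      0≤t = ≼⇒0≤ p≼t
      t≤1 : t ≤ 1ℝ
      t≤1 = <⇒≤ t<1
      inv = inverse (x<y⇒0<y-x t<1)
      κ : ∣ℝ∣
      κ = proj₁ inv
      0≤κ : 0ℝ ≤ κ
      0≤κ = <⇒≤ (proj₁ (proj₂ inv))
      T : ℕ → ℕ → ∣ℝ∣
      T m l = t R.^ (l ℕ.+ m)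
      0≤T : ∀ m l → 0ℝ ≤ T m l
      0≤T m l = ^-nonneg 0≤t (l ℕ.+ m)
      power≼T : ∀ m l → p ^ suc (l ℕ.+ m) ≼ T m l
      power≼T m l = ≼-weaken (^-suc-≤ 0≤t t≤1 (l ℕ.+ m)) (≼-^ p≼t (suc (l ℕ.+ m)))
      κ-step : ∀ e → e R.≈ κ R.* (e R.- t R.* e)
      κ-step e = R.trans (R.sym (R.*-identityˡ e)) (R.trans (R.*-congʳ (R.sym (proj₂ (proj₂ inv))))
        (S.solve 3 (λ t k e → ((S.:1 S.:- t) S.:* k) S.:* e S.:= k S.:* (e S.:- t S.:* e)) R.refl t κ e))

      Q≼ : ∀ m → (κ R.+ κ) R.* t R.^ m ≤ 1ℝ → ∀ l → Q m l ≼ 1ℝ R.+ (κ R.+ κ) R.* (t R.^ m R.- T m l)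
      Q≼ m h zero    = ≼-cong refl
        (S.solve 2 (λ k e → S.:1 S.:= S.:1 S.:+ k S.:* (e S.:- e)) R.refl (κ R.+ κ) (t R.^ m)) ≼-one
      Q≼ m h (suc l) = ≼-weaken
        (≤-resp (S.solve 2 (λ x e → (S.:1 S.:+ x S.:+ e) S.:+ x S.:* e
          S.:= (S.:1 S.:+ x) S.:* (S.:1 S.:+ e)) R.refl X e)
          (R.trans (R.+-congˡ (R.trans (R.*-identityˡ e) (κ-step e)))
            (R.trans (R.+-congʳ (R.+-congˡ (κ-step e)))
            (S.solve 4 (λ k e a t → (S.:1 S.:+ (k S.:+ k) S.:* (a S.:- e) S.:+ k S.:* (e S.:- t S.:* e))
              S.:+ k S.:* (e S.:- t S.:* e)
              S.:= S.:1 S.:+ (k S.:+ k) S.:* (a S.:- t S.:* e)) R.refl κ e (t R.^ m) t)))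
          (+-mono-≤ ≤-refl (*-monoˡ-≤ (0≤T m l) X≤1)))
        (≼-* (Q≼ m h l) (≼-+ ≼-one (≼-neg (power≼T m l))))
        where
        e = T m l
        X = (κ R.+ κ) R.* (t R.^ m R.- e)
        X≤1 : X ≤ 1ℝ
        X≤1 = ≤-trans (*-monoʳ-≤ (+-nonneg 0≤κ 0≤κ) (x-y≤x (0≤T m l))) h

      2ℝ : ∣ℝ∣
      2ℝ = 1ℝ R.+ 1ℝ

      1≤2 : 1ℝ ≤ 2ℝ
      1≤2 = x≤x+y (<⇒≤ 0<1)

      Q≼2 : ∀ m → (κ R.+ κ) R.* t R.^ m ≤ 1ℝ → ∀ l → Q m l ≼ 2ℝ
      Q≼2 m h l = ≼-weaken (+-mono-≤ ≤-refl
        (≤-trans (*-monoʳ-≤ (+-nonneg 0≤κ 0≤κ) (x-y≤x (0≤T m l))) h)) (Q≼ m h l)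

    Q-bounded : ∃[ B ] (∀ m l → Q m l ≼ B)
    Q-bounded = 2ℝ R.^ suc M , λ m l → go M m (ℕₚ.m≤m+n M m) l
      where
      start = geometric-small 0≤t t<1 (+-nonneg 0≤κ 0≤κ) 0<1
      M = proj₁ start
      0≤2 = ≤-trans (<⇒≤ 0<1) 1≤2
      1≤2^ : ∀ k → 1ℝ ≤ 2ℝ R.^ k
      1≤2^ zero    = ≤-refl
      1≤2^ (suc k) = ≤-resp (R.*-identityˡ 1ℝ) R.refl (*-mono-≤ (<⇒≤ 0<1) (^-nonneg 0≤2 k) 1≤2 (1≤2^ k))
      go : ∀ k m → M ℕ.≤ k ℕ.+ m → ∀ l → Q m l ≼ 2ℝ R.^ suc k
      go zero    m M≤ l = ≼-cong refl (R.sym (R.*-identityʳ 2ℝ)) (Q≼2 m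
        (≤-trans (*-monoʳ-≤ (+-nonneg 0≤κ 0≤κ) (^-mono-exp 0≤t t≤1 M≤)) (<⇒≤ (proj₂ start))) l)
      go (suc k) m M≤ zero    = ≼-weaken (1≤2^ (suc (suc k))) ≼-one
      go (suc k) m M≤ (suc l) = ≼-cong (sym (Q-head m l)) R.refl
        (≼-* (≼-+ ≼-one (≼-neg (≼-weaken (^-≤1 0≤t t≤1 (suc m)) (≼-^ p≼t (suc m)))))
          (go k (suc m) (≡.subst (M ℕ.≤_) (≡.sym (ℕₚ.+-suc k m)) M≤) l))

    B : ∣ℝ∣
    B = proj₁ Q-bounded

    0≤B : 0ℝ ≤ B
    0≤B = ≼⇒0≤ (proj₂ Q-bounded 0 0)

    private
      Q-1≼′ : ∀ m l → Q m l - 1# ≼ B R.* κ R.* (t R.^ m R.- T m l)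
      Q-1≼′ m zero = ≼-cong (sym (-‿inverseʳ 1#))
        (S.solve 2 (λ k e → S.:0 S.:= k S.:* (e S.:- e)) R.refl (B R.* κ) (t R.^ m)) ≼-zero
      Q-1≼′ m (suc l) = ≼-cong
        (solve 2 (λ q x → (q :- :1) :+ (:- (q :* x)) := q :* (:1 :- x) :- :1) refl (Q m l)
          (p ^ suc (l ℕ.+ m)))
        (R.trans (R.+-congˡ (R.*-congˡ (κ-step e)))
          (S.solve 5 (λ b k e a t → b S.:* k S.:* (a S.:- e) S.:+ b S.:* (k S.:* (e S.:- t S.:* e))
            S.:= b S.:* k S.:* (a S.:- t S.:* e)) R.refl B κ e (t R.^ m) t))
        (≼-+ (Q-1≼′ m l) (≼-neg (≼-* (proj₂ Q-bounded m l) (power≼T m l))))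
        where e = T m l

    K : ∣ℝ∣
    K = B R.* κ

    0≤K : 0ℝ ≤ K
    0≤K = *-nonneg 0≤B 0≤κ

    Q-1≼ : ∀ m l → Q m l - 1# ≼ K R.* t R.^ m
    Q-1≼ m l = ≼-weaken (*-monoʳ-≤ 0≤K (x-y≤x (0≤T m l))) (Q-1≼′ m l)

    Q-near-1 : ∃[ m ] (∀ l → Q m l - 1# ≼ ½)
    Q-near-1 =
      let m , Kt<½ = geometric-small 0≤t t<1 0≤K 0<½
      in m , λ l → ≼-weaken (<⇒≤ Kt<½) (Q-1≼ m l)

module JacobiTripleProduct {c ℓ₁ ℓ₂ : Level} {ℝ : RealField c ℓ₁ ℓ₂} (N : NormedRing ℝ) where
  private
    module R = RealField ℝ
    module S = Solve R.commutativeRing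
    module ℕS = ℕSolver.+-*-Solver
  open Order ℝ
  open RealLemmas ℝ
  open NormedRing N
  open CommutativeRing commutativeRing
  open Solve commutativeRing
  open Limits N
  open Products N
  open RawSemiringDefs (Semiring.rawSemiring semiring) using (_^_)
  open Expₚ semiring using (^-homo-*)
  open R using () renaming (Carrier to ∣ℝ∣; _<_ to _<ℝ_; 0# to 0ℝ; 1# to 1ℝ)
  open import Relation.Binary.Reasoning.Setoid setoid

  module Coefficients {p : Carrier} {t : ∣ℝ∣} (p≼t : p ≼ t) (t<1 : t <ℝ 1ℝ) where
    open EulerProduct p≼t t<1 public

    private
      E′ : ℕ → ℕ → ℕ → Carrier
      E′ M       zero    b = Q (M ℕ.+ b) M
      E′ zero    (suc n) b = 0#
      E′ (suc M) (suc n) b = 1-p^ (suc M) * E′ M n b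

      E′-closed : ∀ n m b → E′ (n ℕ.+ m) n b ≈ Q m n * Q (m ℕ.+ b) m
      E′-closed zero    m b = sym (*-identityˡ _)
      E′-closed (suc n) m b = trans (*-congˡ (E′-closed n m b))
        (solve 3 (λ x y z → x :* (y :* z) := (y :* x) :* z) refl _ _ _)

      E′-vanish : ∀ M b → E′ M (suc M) b ≈ 0#
      E′-vanish zero    b = refl
      E′-vanish (suc M) b = trans (*-congˡ (E′-vanish M b)) (zeroʳ _)

    -- (p;p)_M times the Gaussian binomial coefficient [2M choose M + n].
    E : ℕ → ℕ → Carrier
    E M n = E′ M n (n ℕ.+ n)

    E-closed : ∀ n m → E (n ℕ.+ m) n ≈ Q m n * Q (m ℕ.+ (n ℕ.+ n)) m
    E-closed n m = E′-closed n m (n ℕ.+ n)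

    E-closed′ : ∀ {M} n m → M ≡ n ℕ.+ m → E M n ≈ Q m n * Q (m ℕ.+ (n ℕ.+ n)) m
    E-closed′ n m ≡.refl = E-closed n m

    E-vanish : ∀ M → E M (suc M) ≈ 0#
    E-vanish M = E′-vanish M (suc M ℕ.+ suc M)

    E-top : ∀ M → E (suc M) (suc M) ≈ 1-p^ (suc M) * E M M
    E-top M = *-congˡ (trans (top (suc M ℕ.+ suc M)) (sym (top (M ℕ.+ M))))
      where
      top : ∀ b → E′ M M b ≈ Q 0 M
      top b = trans (reflexive (≡.cong (λ i → E′ i M b) (≡.sym (ℕₚ.+-identityʳ M))))
        (trans (E′-closed M 0 b) (*-identityʳ _))

    private
      1-p^≈ : ∀ {i x} j → i ≡ j → p ^ j ≈ x → 1-p^ i ≈ 1# - x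
      1-p^≈ j ≡.refl h = +-congˡ (-‿cong h)

      Q≡ : ∀ {m m′} l → m ≡ m′ → Q m l ≈ Q m′ l
      Q≡ l ≡.refl = refl

      ^-double : ∀ n → p ^ (n ℕ.+ n) ≈ p ^ n * p ^ n
      ^-double n = ^-homo-* p n n

      ^-add-double : ∀ m n → p ^ (m ℕ.+ (n ℕ.+ n)) ≈ p ^ m * (p ^ n * p ^ n)
      ^-add-double m n = trans (^-homo-* p m (n ℕ.+ n)) (*-congˡ (^-double n))

      ^-double-add : ∀ n m → p ^ ((n ℕ.+ m) ℕ.+ (n ℕ.+ m)) ≈ (p ^ m * p ^ n) * (p ^ m * p ^ n)
      ^-double-add n m = trans (^-double (n ℕ.+ m)) (*-cong e e)
        where e = trans (^-homo-* p n m) (*-comm _ _)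

    E-recurrence₀ : ∀ M → E (suc M) 0 ≈
      1-p^ (suc M) * ((1# + p ^ suc (M ℕ.+ M)) * E M 0 + (p ^ suc M + p ^ suc M) * E M 1)
    E-recurrence₀ zero = solve 1 (λ p →
      :1 :* (:1 :- p :* (p :* :1))
      := (:1 :- p :* :1) :* ((:1 :+ p :* :1) :* :1 :+ (p :* :1 :+ p :* :1) :* :0)) refl p
    E-recurrence₀ (suc j) = begin
      E (suc m) 0
        ≈⟨ trans (Q≡ (suc m) (ℕₚ.+-identityʳ (suc m))) (*-cong (*-congˡ
             (1-p^≈ (suc (m ℕ.+ m)) (≡.cong suc (ℕₚ.+-suc j m)) (*-congˡ (^-double m))))
             (1-p^≈ (suc (suc (m ℕ.+ m))) (≡.cong (λ i → suc (suc i)) (ℕₚ.+-suc j m))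
               (*-congˡ (*-congˡ (^-double m))))) ⟩
      g * (1# - p * (x * x)) * (1# - p * (p * (x * x)))
        ≈⟨ solve 3 (λ p x g →
             g :* (:1 :- p :* (x :* x)) :* (:1 :- p :* (p :* (x :* x)))
             := (:1 :- p :* x) :* ((:1 :+ p :* (x :* x)) :* ((:1 :- p :* x) :* g)
                  :+ (p :* x :+ p :* x) :* ((:1 :- x) :* g))) refl p x g ⟩
      1-p^ (suc m) * ((1# + p * (x * x)) * ((1# - p * x) * g) + (p * x + p * x) * ((1# - x) * g))
        ≈⟨ *-congˡ (+-cong
             (*-cong (+-congˡ (*-congˡ (^-double m))) (trans (Q≡ m (ℕₚ.+-identityʳ m)) (Q-head m j)))
             (*-congˡ (trans (E-closed 1 j)
               (*-cong (*-identityˡ _) (Q≡ j (ℕₚ.+-comm j 2)))))) ⟨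
      1-p^ (suc m) * ((1# + p ^ suc (m ℕ.+ m)) * E m 0 + (p ^ suc m + p ^ suc m) * E m 1) ∎
      where
      m = suc j
      x = p ^ m
      g = Q (suc m) j

    E-recurrence : ∀ k m → let M = suc k ℕ.+ m in E (suc M) (suc k) ≈
      1-p^ (suc M) * ((1# + p ^ suc (M ℕ.+ M)) * E M (suc k) + p ^ suc m * E M k
        + p ^ suc (M ℕ.+ suc k) * E M (suc (suc k)))
    E-recurrence k zero = begin
      E (suc M) n
        ≈⟨ trans (E-closed′ n 1 (≡.cong suc (≡.sym (ℕₚ.+-suc k 0)))) (*-cong
             (*-congˡ (1-p^≈ (suc n) (≡.cong suc (ℕₚ.+-comm k 1)) refl))
             (*-congˡ (1-p^≈ (suc (suc (n ℕ.+ n))) ≡.refl (*-congˡ (*-congˡ (^-double n)))))) ⟩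
      g * (1# - p * y) * (1# * (1# - p * (p * (y * y))))
        ≈⟨ solve 3 (λ p y g →
             g :* (:1 :- p :* y) :* (:1 :* (:1 :- p :* (p :* (y :* y))))
             := (:1 :- p :* y) :* ((:1 :+ p :* (y :* y)) :* ((:1 :- p :* :1) :* g)
                :+ (p :* :1) :* (g :* (:1 :* (:1 :- y :* y))))) refl p y g ⟩
      (1# - p * y) * ((1# + p * (y * y)) * ((1# - p * 1#) * g) + (p * 1#) * (g * (1# * (1# - y * y))))
        ≈⟨ *-cong (1-p^≈ (suc n) (≡.cong suc M≡n) refl) (trans
             (+-cong (+-cong
               (*-cong (+-congˡ (*-congˡ (trans (reflexive (≡.cong (λ i → p ^ (i ℕ.+ i)) M≡n)) (^-double n))))
                 (trans (E-closed n 0) (trans (*-identityʳ _) (Q-head 0 k))))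
               (*-congˡ (trans (E-closed′ k 1 (≡.sym (ℕₚ.+-suc k 0)))
                 (*-congˡ (*-congˡ (1-p^≈ (n ℕ.+ n) (≡.cong suc (≡.sym (ℕₚ.+-suc k k))) (^-double n)))))))
               (trans (*-congˡ (trans (reflexive (≡.cong (λ i → E i (suc n)) M≡n)) (E-vanish n))) (zeroʳ _)))
             (+-identityʳ _)) ⟨
      1-p^ (suc M) * ((1# + p ^ suc (M ℕ.+ M)) * E M n + p ^ 1 * E M k
        + p ^ suc (M ℕ.+ n) * E M (suc n)) ∎
      where
      n = suc k
      M = n ℕ.+ 0
      M≡n : M ≡ n
      M≡n = ℕₚ.+-identityʳ n
      y = p ^ n
      g = Q 1 k
    E-recurrence k (suc j) = begin
      E (suc M) n
        ≈⟨ trans (E-closed′ n (suc m) (≡.cong suc (≡.sym (ℕₚ.+-suc k m)))) (*-cong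
             (*-congˡ (1-p^≈ (suc M) (≡.cong suc (ℕₚ.+-suc k m)) (*-congˡ pM)))
             (*-cong (*-congˡ
               (1-p^≈ (suc (M ℕ.+ M)) (ℕS.solve 2 (λ j k → :s (j :⊕ :s ((:s j) :⊕ ((:s k) :⊕ (:s k)))) ℕS.:= :s (((:s k) :⊕ (:s j)) :⊕ ((:s k) :⊕ (:s j)))) ≡.refl j k) (*-congˡ pMM)))
               (1-p^≈ (suc (suc (M ℕ.+ M))) (ℕS.solve 2 (λ j k → :s (:s (j :⊕ :s ((:s j) :⊕ ((:s k) :⊕ (:s k))))) ℕS.:= :s (:s (((:s k) :⊕ (:s j)) :⊕ ((:s k) :⊕ (:s j))))) ≡.refl j k) (*-congˡ (*-congˡ pMM))))) ⟩
      g * (1# - p * (x * y)) * (h * (1# - p * ((x * y) * (x * y))) * (1# - p * (p * ((x * y) * (x * y)))))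
        ≈⟨ solve 5 (λ p x y g h →
             g :* (:1 :- p :* (x :* y)) :* (h :* (:1 :- p :* ((x :* y) :* (x :* y)))
               :* (:1 :- p :* (p :* ((x :* y) :* (x :* y)))))
             := (:1 :- p :* (x :* y)) :* ((:1 :+ p :* ((x :* y) :* (x :* y)))
                    :* (((:1 :- p :* x) :* g) :* ((:1 :- p :* (x :* (y :* y))) :* h))
                  :+ (p :* x) :* (g :* ((:1 :- x :* (y :* y)) :* ((:1 :- p :* (x :* (y :* y))) :* h)))
                  :+ (p :* (x :* (y :* y))) :* (((:1 :- x) :* ((:1 :- p :* x) :* g)) :* h))) refl p x y g h ⟩
      (1# - p * (x * y)) * ((1# + p * ((x * y) * (x * y)))
             * (((1# - p * x) * g) * ((1# - p * (x * (y * y))) * h))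
           + (p * x) * (g * ((1# - x * (y * y)) * ((1# - p * (x * (y * y))) * h)))
           + (p * (x * (y * y))) * (((1# - x) * ((1# - p * x) * g)) * h))
        ≈⟨ *-cong (1-p^≈ (suc M) ≡.refl (*-congˡ pM)) (+-cong (+-cong
             (*-cong (+-congˡ (*-congˡ pMM))
               (trans (E-closed n m) (*-cong (Q-head m k) (trans (Q-head b j)
                 (*-congʳ (1-p^≈ (suc b) ≡.refl (*-congˡ pb)))))))
             (*-congˡ (trans (E-closed′ k (suc m) (≡.sym (ℕₚ.+-suc k m))) (*-congˡ
               (trans (Q-head b′ m) (*-cong (1-p^≈ b b′≡b pb) (trans (Q≡ m b′≡b) (trans (Q-head b j)
                 (*-congʳ (1-p^≈ (suc b) ≡.refl (*-congˡ pb)))))))))))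
             (*-cong (*-congˡ (trans (reflexive (≡.cong (p ^_)
                 (ℕS.solve 2 (λ m k → ((:s k) :⊕ m) :⊕ (:s k) ℕS.:= m :⊕ ((:s k) :⊕ (:s k))) ≡.refl m k))) pb))
               (trans (E-closed′ (suc n) j (ℕₚ.+-suc n j)) (*-cong
                 (trans (Q-head j n) (*-congˡ (Q-head m k)))
                 (Q≡ j (ℕS.solve 2 (λ j k → j :⊕ (:s (:s k) :⊕ :s (:s k)) ℕS.:= :s (:s j :⊕ (:s k :⊕ :s k))) ≡.refl j k)))))) ⟨
      1-p^ (suc M) * ((1# + p ^ suc (M ℕ.+ M)) * E M n + p ^ suc m * E M k
        + p ^ suc (M ℕ.+ n) * E M (suc n)) ∎
      where
      n = suc k
      m = suc j
      M = n ℕ.+ m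
      b = m ℕ.+ (n ℕ.+ n)
      b′ = suc m ℕ.+ (k ℕ.+ k)
      x = p ^ m
      y = p ^ n
      g = Q (suc m) k
      h = Q (suc b) j
      infixl 6 _:⊕_
      _:⊕_ : ∀ {i} → ℕS.Polynomial i → ℕS.Polynomial i → ℕS.Polynomial i
      _:⊕_ = ℕS._:+_
      :s : ∀ {i} → ℕS.Polynomial i → ℕS.Polynomial i
      :s = ℕS.con 1 ℕS.:+_
      b′≡b : suc b′ ≡ b
      b′≡b = ℕS.solve 2 (λ m k → :s (:s m :⊕ (k :⊕ k)) ℕS.:= m :⊕ (:s k :⊕ :s k)) ≡.refl m k
      pM : p ^ M ≈ x * y
      pM = trans (^-homo-* p n m) (*-comm _ _)
      pMM : p ^ (M ℕ.+ M) ≈ (x * y) * (x * y)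
      pMM = ^-double-add n m
      pb : p ^ b ≈ x * (y * y)
      pb = ^-add-double m n

  poch : Carrier → Carrier → ℕ → Carrier
  poch a p = pprod (λ n → 1# - a * p ^ n)

  module _ (x y : Carrier) {t : ∣ℝ∣} (xy≼t : x * y ≼ t) (t<1 : t <ℝ 1ℝ)
    (u v : ℕ → Carrier) (u₀≈1 : u 0 ≈ 1#) (v₀≈1 : v 0 ≈ 1#)
    (u-rec : ∀ n → u (suc n) ≈ u n * (- (x * (x * y) ^ n)))
    (v-rec : ∀ n → v (suc n) ≈ v n * (- (y * (x * y) ^ n))) where

    open Coefficients xy≼t t<1

    private
      p = x * y

      w : ℕ → Carrier
      w n = u n + v n

      partial : ℕ → ℕ → Carrier
      partial M n = E M 0 + psum (λ i → E M (suc i) * w (suc i)) n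

      factors : ℕ → Carrier
      factors M = (1# - x * p ^ M) * (1# - y * p ^ M)

      factors-w₀ : ∀ M → factors M ≈ 1# + p ^ suc (M ℕ.+ M) + p ^ M * w 1
      factors-w₀ M = begin
        factors M
          ≈⟨ solve 3 (λ x y q → (:1 :- x :* q) :* (:1 :- y :* q)
               := :1 :+ (x :* y) :* (q :* q)
                  :+ q :* (:1 :* (:- (x :* :1)) :+ :1 :* (:- (y :* :1)))) refl x y (p ^ M) ⟩
        1# + p * (p ^ M * p ^ M) + p ^ M * (1# * (- (x * 1#)) + 1# * (- (y * 1#)))
          ≈⟨ +-cong (+-congˡ (*-congˡ (^-homo-* p M M))) (*-congˡ (+-cong
               (trans (u-rec 0) (*-congʳ u₀≈1)) (trans (v-rec 0) (*-congʳ v₀≈1)))) ⟨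
        1# + p ^ suc (M ℕ.+ M) + p ^ M * w 1 ∎

      factors-w : ∀ n m → let M = suc n ℕ.+ m in
        factors M * w (suc n) ≈ (1# + p ^ suc (M ℕ.+ M)) * w (suc n)
          + p ^ m * w (suc (suc n)) + p ^ suc (M ℕ.+ n) * w n
      factors-w n m = begin
        factors M * w (suc n)
          ≈⟨ *-cong (*-cong (+-congˡ (-‿cong (*-congˡ pM))) (+-congˡ (-‿cong (*-congˡ pM))))
               (+-cong (u-rec n) (v-rec n)) ⟩
        (1# - x * X) * (1# - y * X) * (u n * (- (x * a)) + v n * (- (y * a)))
          ≈⟨ solve 6 (λ x y a b u v → let p = x :* y ; X = p :* (a :* b) in
               (:1 :- x :* X) :* (:1 :- y :* X) :* (u :* (:- (x :* a)) :+ v :* (:- (y :* a)))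
               := (:1 :+ p :* (X :* X)) :* (u :* (:- (x :* a)) :+ v :* (:- (y :* a)))
                  :+ b :* (u :* (:- (x :* a)) :* (:- (x :* (p :* a))) :+ v :* (:- (y :* a)) :*
                    (:- (y :* (p :* a))))
                  :+ p :* (X :* a) :* (u :+ v)) refl x y a b (u n) (v n) ⟩
        (1# + p * (X * X)) * (u n * (- (x * a)) + v n * (- (y * a)))
          + b * (u n * (- (x * a)) * (- (x * (p * a))) + v n * (- (y * a)) * (- (y * (p * a))))
          + p * (X * a) * (u n + v n)
          ≈⟨ +-cong (+-cong
               (*-cong (+-congˡ (*-congˡ (trans (^-homo-* p M M) (*-cong pM pM))))
                 (+-cong (u-rec n) (v-rec n)))
               (*-congˡ (+-cong (trans (u-rec (suc n)) (*-congʳ (u-rec n)))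
                 (trans (v-rec (suc n)) (*-congʳ (v-rec n))))))
               (*-congʳ (*-congˡ (trans (^-homo-* p M n) (*-congʳ pM)))) ⟨
        (1# + p ^ suc (M ℕ.+ M)) * w (suc n) + p ^ m * w (suc (suc n)) + p ^ suc (M ℕ.+ n) * w n ∎
        where
        M = suc n ℕ.+ m
        a = p ^ n
        b = p ^ m
        X = p * (a * b)
        pM : p ^ M ≈ X
        pM = *-congˡ (^-homo-* p n m)

      -- The last summand is the boundary term of a summation by parts.
      partial-step : ∀ n m M → M ≡ n ℕ.+ m →
        1-p^ (suc M) * factors M * partial M n ≈ partial (suc M) n
          + 1-p^ (suc M) * (E M n * (p ^ m * w (suc n)) - E M (suc n) * (p ^ suc (M ℕ.+ n) * w n))
      partial-step zero m .m ≡.refl = begin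
        c₁ * factors m * (e₀ + 0#)
          ≈⟨ *-congʳ (*-congˡ (factors-w₀ m)) ⟩
        c₁ * (1# + P + p ^ m * w 1) * (e₀ + 0#)
          ≈⟨ solve 7 (λ c P q w₁ e₀ e₁ r → c :* (:1 :+ P :+ q :* w₁) :* (e₀ :+ :0)
               := c :* ((:1 :+ P) :* e₀ :+ (r :+ r) :* e₁) :+ :0
                  :+ c :* (e₀ :* (q :* w₁) :- e₁ :* (r :* (:1 :+ :1)))) refl c₁ P (p ^ m) (w 1) e₀ e₁
                    (p ^ suc m) ⟩
        c₁ * ((1# + P) * e₀ + (p ^ suc m + p ^ suc m) * e₁) + 0#
          + c₁ * (e₀ * (p ^ m * w 1) - e₁ * (p ^ suc m * (1# + 1#)))
          ≈⟨ +-cong (+-congʳ (E-recurrence₀ m)) (*-congˡ (+-congˡ (-‿cong (*-congˡ (*-cong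
               (reflexive (≡.cong (λ i → p ^ suc i) (ℕₚ.+-identityʳ m))) (+-cong u₀≈1 v₀≈1)))))) ⟨
        E (suc m) 0 + 0# + c₁ * (e₀ * (p ^ m * w 1) - e₁ * (p ^ suc (m ℕ.+ 0) * w 0)) ∎
        where
        c₁ = 1-p^ (suc m)
        e₀ = E m 0
        e₁ = E m 1
        P = p ^ suc (m ℕ.+ m)
      partial-step (suc n) m .(suc n ℕ.+ m) ≡.refl = begin
        c₁ * factors M * partial M (suc n)
          ≈⟨ solve 5 (λ c f e s x → c :* f :* (e :+ (s :+ x)) := c :* f :* (e :+ s) :+ c :* f :* x) refl
               c₁ (factors M) (E M 0) _ (e₁ * w₁) ⟩
        c₁ * factors M * partial M n + c₁ * factors M * (e₁ * w₁)
          ≈⟨ +-cong (partial-step n (suc m) M (≡.sym (ℕₚ.+-suc n m)))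
               (trans (solve 4 (λ c f e w → c :* f :* (e :* w) := c :* e :* (f :* w)) refl c₁
                 (factors M) e₁ w₁)
                 (*-congˡ (factors-w n m))) ⟩
        partial (suc M) n + c₁ * (e₀ * (p ^ suc m * w₁) - e₁ * (r * w n))
          + c₁ * e₁ * ((1# + P) * w₁ + p ^ m * w₂ + r * w n)
          ≈⟨ solve 14 (λ s₀ s c e₀ e₁ e₂ w₀ w₁ w₂ r r₂ r′ P q →
               s₀ :+ s :+ c :* (e₀ :* (q :* w₁) :- e₁ :* (r :* w₀)) :+ c :* e₁ :*
                 ((:1 :+ P) :* w₁ :+ r′ :* w₂ :+ r :* w₀)
               := s₀ :+ (s :+ c :* ((:1 :+ P) :* e₁ :+ q :* e₀ :+ r₂ :* e₂) :* w₁)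
                  :+ c :* (e₁ :* (r′ :* w₂) :- e₂ :* (r₂ :* w₁))) refl
               (E (suc M) 0) (psum (λ i → E (suc M) (suc i) * w (suc i)) n)
               c₁ e₀ e₁ e₂ (w n) w₁ w₂ r r₂ (p ^ m) P (p ^ suc m) ⟩
        E (suc M) 0 + (psum (λ i → E (suc M) (suc i) * w (suc i)) n
            + c₁ * ((1# + P) * e₁ + p ^ suc m * e₀ + r₂ * e₂) * w₁)
          + c₁ * (e₁ * (p ^ m * w₂) - e₂ * (r₂ * w₁))
          ≈⟨ +-congʳ (+-congˡ (+-congˡ (*-congʳ (E-recurrence n m)))) ⟨
        partial (suc M) (suc n) + c₁ * (e₁ * (p ^ m * w₂) - e₂ * (r₂ * w₁)) ∎
        where
        M = suc n ℕ.+ m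
        c₁ = 1-p^ (suc M)
        e₀ = E M n
        e₁ = E M (suc n)
        e₂ = E M (suc (suc n))
        w₁ = w (suc n)
        w₂ = w (suc (suc n))
        P = p ^ suc (M ℕ.+ M)
        r = p ^ suc (M ℕ.+ n)
        r₂ = p ^ suc (M ℕ.+ suc n)

      finite-product : ∀ M → Q 0 M * (poch x p M * poch y p M) ≈ partial M M
      finite-product zero = solve 0 (:1 :* (:1 :* :1) := :1 :+ :0) refl
      finite-product (suc M) = begin
        Q 0 M * 1-p^ (suc (M ℕ.+ 0)) * (poch x p M * (1# - x * p ^ M) * (poch y p M * (1# - y * p ^ M)))
          ≈⟨ solve 6 (λ c f g q a b → q :* c :* (a :* f :* (b :* g)) := c :* (f :* g) :* (q :* (a :* b))) refl
               _ (1# - x * p ^ M) (1# - y * p ^ M) (Q 0 M) (poch x p M) (poch y p M) ⟩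
        1-p^ (suc (M ℕ.+ 0)) * factors M * (Q 0 M * (poch x p M * poch y p M))
          ≈⟨ *-cong (*-congʳ (reflexive (≡.cong (1-p^ ∘ suc) (ℕₚ.+-identityʳ M)))) (finite-product M) ⟩
        1-p^ (suc M) * factors M * partial M M
          ≈⟨ partial-step M 0 M (≡.sym (ℕₚ.+-identityʳ M)) ⟩
        partial (suc M) M + 1-p^ (suc M) * (E M M * (1# * w (suc M)) - E M (suc M) *
          (p ^ suc (M ℕ.+ M) * w M))
          ≈⟨ +-congˡ (*-congˡ (+-congˡ (-‿cong (*-congʳ (E-vanish M))))) ⟩
        partial (suc M) M + 1-p^ (suc M) * (E M M * (1# * w (suc M)) - 0# * (p ^ suc (M ℕ.+ M) * w M))
          ≈⟨ solve 6 (λ s₀ s c e w z → s₀ :+ s :+ c :* (e :* (:1 :* w) :- :0 :* z)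
            := s₀ :+ (s :+ (c :* e) :* w)) refl
               (E (suc M) 0) (psum (λ i → E (suc M) (suc i) * w (suc i)) M) (1-p^ (suc M)) (E M M)
                 (w (suc M)) _ ⟩
        E (suc M) 0 + (psum (λ i → E (suc M) (suc i) * w (suc i)) M + 1-p^ (suc M) * E M M * w (suc M))
          ≈⟨ +-congˡ (+-congˡ (*-congʳ (E-top M))) ⟨
        partial (suc M) (suc M) ∎

      E-1≼ : ∀ n m → E (n ℕ.+ m) n - 1# ≼ (K R.* B R.+ K) R.* t R.^ m
      E-1≼ n m = ≼-cong
        (trans (solve 2 (λ a b → (a :- :1) :* b :+ (b :- :1) := a :* b :- :1) refl _ _)
          (+-congʳ (sym (E-closed n m))))
        (S.solve 3 (λ k b t → k S.:* t S.:* b S.:+ k S.:* t S.:= (k S.:* b S.:+ k) S.:* t) R.refl K B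
          (t R.^ m))
        (≼-+ (≼-* (Q-1≼ m n) (proj₂ Q-bounded (m ℕ.+ (n ℕ.+ n)) m))
          (≼-weaken (*-monoʳ-≤ 0≤K (^-mono-exp (≼⇒0≤ xy≼t) (<⇒≤ t<1) (ℕₚ.m≤m+n m (n ℕ.+ n))))
            (Q-1≼ (m ℕ.+ (n ℕ.+ n)) m)))

    -- The coefficients E M n tend to 1 as M → ∞, dominated by the decay of u and v.
    jacobi-triple-product : ∀ {a b e s⁺ s⁻} → 0ℝ <ℝ t →
      poch x p ⟿ a → poch y p ⟿ b → Q 0 ⟿ e → psum u ⟿ s⁺ → psum (v ∘ suc) ⟿ s⁻ →
      e * (a * b) ≈ s⁺ + s⁻
    jacobi-triple-product {a} {b} {e} {s⁺} {s⁻} 0<t a⟿ b⟿ e⟿ s⁺⟿ s⁻⟿ = ⟿-unique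
      (⟿-* e⟿ (⟿-* a⟿ b⟿))
      (⟿-cong (λ M → sym (finite-product M)) refl
        (⟿-near (L R.+ L R.* D) 0≤C 0≤t t<1 difference
          (⟿-cong limit-form refl (⟿-+ (⟿-suc s⁺⟿) s⁻⟿))))
      where
      0≤t = <⇒≤ 0<t
      L = K R.* B R.+ K
      0≤L = +-nonneg (*-nonneg 0≤K 0≤B) 0≤K
      ρ = t R.* ½
      0<ρ = R.*-pos 0<t 0<½
      u-bound = theta-bound u (- x) xy≼t t<1
        (λ n → trans (u-rec n) (*-congˡ (solve 2 (λ x q → :- (x :* q) := (:- x) :* q) refl x _))) 0<ρ
      v-bound = theta-bound v (- y) xy≼t t<1
        (λ n → trans (v-rec n) (*-congˡ (solve 2 (λ x q → :- (x :* q) := (:- x) :* q) refl y _))) 0<ρ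
      D₁ = proj₁ u-bound
      D₂ = proj₁ v-bound
      D = D₁ R.+ D₂
      0≤D = +-nonneg (≤-resp R.refl (R.*-identityʳ D₁) (≼⇒0≤ (proj₂ u-bound 0)))
                     (≤-resp R.refl (R.*-identityʳ D₂) (≼⇒0≤ (proj₂ v-bound 0)))
      0≤C = +-nonneg 0≤L (*-nonneg 0≤L 0≤D)
      w-bound : ∀ n → w n ≼ D R.* ρ R.^ n
      w-bound n = ≼-cong refl (R.sym (R.distribʳ _ D₁ D₂)) (≼-+ (proj₂ u-bound n) (proj₂ v-bound n))
      limit-form : ∀ M → psum u (suc M) + psum (v ∘ suc) M ≈ 1# + psum (w ∘ suc) M
      limit-form M = trans (+-congʳ (trans (psum-suc u M) (+-congʳ u₀≈1)))
        (trans (+-assoc _ _ _) (+-congˡ (sym (psum-+ (u ∘ suc) (v ∘ suc) M))))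
      difference : ∀ M → partial M M - (1# + psum (w ∘ suc) M) ≼ (L R.+ L R.* D) R.* t R.^ M
      difference M = ≼-cong
        (begin
          (E M 0 - 1#) + psum (λ i → (E M (suc i) - 1#) * w (suc i)) M
            ≈⟨ solve 3 (λ e s s′ → (e :- :1) :+ s := (e :+ (s :+ s′)) :- (:1 :+ s′)) refl (E M 0) _ _ ⟩
          (E M 0 + (psum (λ i → (E M (suc i) - 1#) * w (suc i)) M + psum (w ∘ suc) M)) -
            (1# + psum (w ∘ suc) M)
            ≈⟨ +-congʳ (+-congˡ (trans (sym (psum-+ _ _ M))
                 (psum-cong (λ i → solve 2 (λ e w → (e :- :1) :* w :+ w := e :* w) refl (E M (suc i))
                   (w (suc i))) M))) ⟩
          partial M M - (1# + psum (w ∘ suc) M) ∎)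
        (R.sym (R.distribʳ (t R.^ M) L (L R.* D)))
        (≼-+ (E-1≼ 0 M)
          (psum-≼ _ _ M (*-nonneg (*-nonneg 0≤L 0≤D) (^-nonneg 0≤t M)) term≼))
        where
        term≼ : ∀ i → i ℕ.< M → (E M (suc i) - 1#) * w (suc i) ≼ (L R.* D) R.* t R.^ M R.* ½ R.^ suc i
        term≼ i i<M = ≡.subst
          (λ j → (E j (suc i) - 1#) * w (suc i) ≼ (L R.* D) R.* t R.^ j R.* ½ R.^ suc i) (ℕₚ.m+[n∸m]≡n i<M)
          (≼-cong refl
            (R.trans (R.*-congˡ (R.*-congˡ (^-* t ½ (suc i))))
              (R.trans (S.solve 5 (λ l d a b h → l S.:* a S.:* (d S.:* (b S.:* h))
                S.:= l S.:* d S.:* (b S.:* a) S.:* h)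
                  R.refl L D (t R.^ m) (t R.^ suc i) (½ R.^ suc i))
                (R.*-congʳ (R.*-congˡ (R.sym (^-+ t (suc i) m))))))
            (≼-* (E-1≼ (suc i) m) (w-bound (suc i))))
          where m = M ℕ.∸ suc i

module ThetaSeries {c ℓ₁ ℓ₂ : Level} {ℝ : RealField c ℓ₁ ℓ₂} (N : NormedRing ℝ) where
  private
    module R = RealField ℝ
    module S = Solve R.commutativeRing
    module ℤS = ℤSolver.+-*-Solver
  open Order ℝ
  open RealLemmas ℝ
  open NormedRing N
  open CommutativeRing commutativeRing
  open Solve commutativeRing
  open RingIdentities commutativeRing
  open Ringₚ ring using (-‿involutive)
  open Limits N
  open BilateralSums N
  open Products N
  open JacobiTripleProduct N
  open Analysis ℝ using (tri; tri′; tri-step; tri′-step; tri-neg-step; tri′-neg-step)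
  open RawSemiringDefs (Semiring.rawSemiring semiring) using (_^_)
  open Expₚ semiring using (^-homo-*; ^-congˡ)
  open CExpₚ commutativeSemiring using (^-distrib-*)
  open R using () renaming (Carrier to ∣ℝ∣; _<_ to _<ℝ_; 0# to 0ℝ; 1# to 1ℝ)
  open import Relation.Binary.Reasoning.Setoid setoid

  poch-cong : ∀ {a a′ p p′} → a ≈ a′ → p ≈ p′ → ∀ n → poch a p n ≈ poch a′ p′ n
  poch-cong a≈ p≈ = pprod-cong (λ n → +-congˡ (-‿cong (*-cong a≈ (^-congˡ n p≈))))

  poch-split : ∀ {a b p P u v w} → b ≈ a * p → P ≈ p * p →
    poch a p ⟿ u → poch a P ⟿ v → poch b P ⟿ w → u ≈ v * w
  poch-split {a} {b} {p} {P} b≈ap P≈p² u⟿ v⟿ w⟿ = ⟿-unique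
    (⟿-subseq (λ n → n ℕ.+ n) (λ n → ℕₚ.m≤m+n n n) u⟿)
    (⟿-cong (λ n → sym (trans (pprod-double _ n) (*-cong
      (pprod-cong (λ i → +-congˡ (-‿cong (*-congˡ (p^2i i)))) n)
      (pprod-cong (λ i → +-congˡ (-‿cong (trans (*-congˡ (*-congˡ (p^2i i)))
        (trans (sym (*-assoc a p _)) (*-congʳ (sym b≈ap)))))) n))))
      refl (⟿-* v⟿ w⟿))
    where
    p^2i : ∀ i → p ^ (i ℕ.+ i) ≈ P ^ i
    p^2i i = trans (^-homo-* p i i) (trans (sym (^-distrib-* p p i)) (^-congˡ i (sym P≈p²)))

  poch-conjugate : ∀ {a b p A P u v w} → b ≈ - a → A ≈ a * a → P ≈ p * p →
    poch a p ⟿ u → poch b p ⟿ v → poch A P ⟿ w → u * v ≈ w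
  poch-conjugate {a} {b} {p} {A} {P} b≈-a A≈a² P≈p² u⟿ v⟿ w⟿ = ⟿-unique
    (⟿-cong (λ n → trans (sym (pprod-* _ _ n)) (pprod-cong factor n)) refl (⟿-* u⟿ v⟿)) w⟿
    where
    factor : ∀ i → (1# - a * p ^ i) * (1# - b * p ^ i) ≈ 1# - A * P ^ i
    factor i = trans (*-congˡ (+-congˡ (-‿cong (*-congʳ b≈-a))))
      (trans (solve 2 (λ a q → (:1 :- a :* q) :* (:1 :- (:- a) :* q) := :1 :- (a :* a) :* (q :* q)) refl a
        (p ^ i))
        (+-congˡ (-‿cong (*-cong (sym A≈a²) (trans (sym (^-distrib-* p p i)) (^-congˡ i (sym P≈p²)))))))

  euler-tail-near-1 : ∀ {p t} → p ≼ t → t <ℝ 1ℝ →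
    ∃[ m ] (∀ {z} → (λ l → pprod (λ i → 1# - p ^ suc (i ℕ.+ m)) l) ⟿ z → z - 1# ≼ ½)
  euler-tail-near-1 p≼t t<1 =
    let m , near = EulerProduct.Q-near-1 p≼t t<1
    in m , λ z⟿ → ⟿-≼ (⟿-+ z⟿ (⟿-const (- 1#))) (<⇒≤ 0<½) near

  euler-factors : ∀ p m n → poch (p ^ suc m) p n ≈ pprod (λ i → 1# - p ^ suc (i ℕ.+ m)) n
  euler-factors p m = pprod-cong (λ i → +-congˡ (-‿cong (trans (sym (^-homo-* p (suc m) i))
    (reflexive (≡.cong (λ j → p ^ suc j) (ℕₚ.+-comm m i))))))

  θ : Carrier → Carrier → ℤ → Carrier
  θ a b n = a ^ tri n * b ^ tri′ n

  private
    θ⁺-rec : ∀ a b n → θ a b (+ suc n) ≈ θ a b (+ n) * (a * (a * b) ^ n)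
    θ⁺-rec a b n = theta-step⁺ a b n {tri (+ n)} {tri′ (+ n)} (tri-step n) (tri′-step n)

    θ⁻-rec : ∀ a b n → θ a b -[1+ suc n ] ≈ θ a b -[1+ n ] * ((b * (a * b)) * (a * b) ^ n)
    θ⁻-rec a b n = theta-step⁻ a b n {tri -[1+ n ]} {tri′ -[1+ n ]} (tri-neg-step n) (tri′-neg-step n)

  θ-decays : ∀ {a b t} → a * b ≼ t → t <ℝ 1ℝ → ∃[ C ] DecaysQuickly (θ a b) C
  θ-decays {a} {b} ab≼t t<1 = C⁺ R.+ C⁻ R.* i , bound
    where
    0<¼ = R.*-pos 0<½ 0<½
    inv = inverse 0<¼
    i = proj₁ inv
    0≤i = <⇒≤ (proj₁ (proj₂ inv))
    bound⁺ = theta-bound (θ a b ∘ +_) a ab≼t t<1 (θ⁺-rec a b) 0<¼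
    bound⁻ = theta-bound (θ a b ∘ -[1+_]) (b * (a * b)) ab≼t t<1 (θ⁻-rec a b) 0<¼
    C⁺ = proj₁ bound⁺
    C⁻ = proj₁ bound⁻
    0≤C⁺ = ≤-resp R.refl (R.*-identityʳ C⁺) (≼⇒0≤ (proj₂ bound⁺ 0))
    0≤C⁻ = ≤-resp R.refl (R.*-identityʳ C⁻) (≼⇒0≤ (proj₂ bound⁻ 0))
    bound : DecaysQuickly (θ a b) (C⁺ R.+ C⁻ R.* i)
    bound (+ n)    = ≼-weaken
      (*-monoˡ-≤ (^-nonneg (<⇒≤ 0<¼) n) (x≤x+y (*-nonneg 0≤C⁻ 0≤i))) (proj₂ bound⁺ n)
    bound -[1+ n ] = ≼-weaken
      (≤-resp (R.trans
          (S.solve 4 (λ c i p q → (c S.:* i) S.:* (p S.:* q) S.:= (p S.:* i) S.:* (c S.:* q))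
            R.refl C⁻ i (½ R.* ½) ((½ R.* ½) R.^ n))
          (R.trans (R.*-congʳ (proj₂ (proj₂ inv))) (R.*-identityˡ _)))
        R.refl (*-monoˡ-≤ (^-nonneg (<⇒≤ 0<¼) (suc n)) (x≤y+x 0≤C⁺)))
      (proj₂ bound⁻ n)

  jacobi : ∀ {a b x y p t u v e s} → a ≈ - x → b ≈ - y → p ≈ x * y → p ≼ t → 0ℝ <ℝ t → t <ℝ 1ℝ →
    poch x p ⟿ u → poch y p ⟿ v → poch p p ⟿ e → θ a b sumsTo s → e * (u * v) ≈ s
  jacobi {a} {b} {x} {y} {p} a≈-x b≈-y p≈xy p≼t 0<t t<1 u⟿ v⟿ e⟿ (sums s⁺⟿ s⁻⟿ total) = trans
    (jacobi-triple-product x y (≼-cong p≈xy R.refl p≼t) t<1 (θ a b ∘ +_) negative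
      (*-identityˡ 1#) refl positive-rec negative-rec 0<t
      (⟿-cong (poch-cong refl p≈xy) refl u⟿) (⟿-cong (poch-cong refl p≈xy) refl v⟿)
      (⟿-cong (λ n → trans (poch-cong p≈xy p≈xy n) (pprod-cong (λ i → reflexive
        (≡.cong (λ j → 1# - (x * y) ^ suc j) (≡.sym (ℕₚ.+-identityʳ i)))) n)) refl e⟿)
      s⁺⟿ s⁻⟿)
    total
    where
    negative : ℕ → Carrier
    negative zero    = 1#
    negative (suc n) = θ a b -[1+ n ]
    ab≈xy : a * b ≈ x * y
    ab≈xy = trans (*-cong a≈-x b≈-y) (-x*-y x y)
    positive-rec : ∀ n → θ a b (+ suc n) ≈ θ a b (+ n) * (- (x * (x * y) ^ n))
    positive-rec n = trans (θ⁺-rec a b n) (*-congˡ (trans (*-cong a≈-x (^-congˡ n ab≈xy))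
      (solve 2 (λ x q → (:- x) :* q := :- (x :* q)) refl x _)))
    negative-rec : ∀ n → negative (suc n) ≈ negative n * (- (y * (x * y) ^ n))
    negative-rec zero = *-congˡ (trans (*-congʳ b≈-y) (solve 1 (λ y → (:- y) :* :1 := :- (y :* :1)) refl y))
    negative-rec (suc n) = trans (θ⁻-rec a b n) (*-congˡ (trans
      (*-cong (*-cong b≈-y ab≈xy) (^-congˡ n ab≈xy))
      (solve 3 (λ y p q → ((:- y) :* p) :* q := :- (y :* (p :* q))) refl y (x * y) _)))

  poch-head : ∀ {a b p u v} → b ≈ a * p → poch a p ⟿ u → poch b p ⟿ v → u ≈ (1# - a) * v
  poch-head {a} {b} {p} b≈ap u⟿ v⟿ = ⟿-unique (⟿-suc u⟿)
    (⟿-cong (λ n → sym (trans (pprod-suc _ n) (*-cong (+-congˡ (-‿cong (*-identityʳ a)))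
        (pprod-cong (λ i → +-congˡ (-‿cong (trans (sym (*-assoc a p _)) (*-congʳ (sym b≈ap))))) n))))
      refl (⟿-* (⟿-const (1# - a)) v⟿))

  -- f(-x, -y) with both factors of modulus xy split into factors of modulus (xy)².
  jacobi-split : ∀ {x y x′ y′ p P t a b u v u′ v′ up vp e s} → a ≈ - x → b ≈ - y →
    p ≈ x * y → P ≈ p * p → x′ ≈ x * p → y′ ≈ y * p →
    p ≼ t → 0ℝ <ℝ t → t <ℝ 1ℝ → poch x p ⟿ up → poch y p ⟿ vp → poch p p ⟿ e →
    poch x P ⟿ u → poch x′ P ⟿ u′ → poch y P ⟿ v → poch y′ P ⟿ v′ →
    θ a b sumsTo s → s ≈ e * ((u * v′) * (v * u′))
  jacobi-split a≈ b≈ p≈xy P≈p² x′≈ y′≈ p≼t 0<t t<1 up⟿ vp⟿ e⟿ u⟿ u′⟿ v⟿ v′⟿ s⟿ = trans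
    (sym (jacobi a≈ b≈ p≈xy p≼t 0<t t<1 up⟿ vp⟿ e⟿ s⟿))
    (*-congˡ (trans (*-cong (poch-split x′≈ P≈p² up⟿ u⟿ u′⟿) (poch-split y′≈ P≈p² vp⟿ v⟿ v′⟿))
      (solve 4 (λ u u′ v v′ → (u :* u′) :* (v :* v′) := (u :* v′) :* (v :* u′)) refl _ _ _ _)))

  -- ψ(b) (b; b)_∞ = (b²; b²)²_∞
  gauss-ψ : ∀ {b p c t e₁ e₂ e₄ w w′ x y y′ s} → p ≈ b * b → c ≈ p * p →
    c ≼ t → 0ℝ <ℝ t → t <ℝ 1ℝ →
    poch b b ⟿ e₁ → poch p p ⟿ e₂ → poch c c ⟿ e₄ →
    poch b p ⟿ w → poch (- b) p ⟿ w′ → poch p c ⟿ x → poch (- b) c ⟿ y → poch (- (b ^ 3)) c ⟿ y′ →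
    θ b (b ^ 3) sumsTo s → s * e₁ ≈ e₂ * e₂
  gauss-ψ {b} {p} {c} {e₁ = e₁} {e₂} {e₄} {w} {w′} {x} {y} {y′} {s}
    p≈b² c≈p² c≼t 0<t t<1 e₁⟿ e₂⟿ e₄⟿ w⟿ w′⟿ x⟿ y⟿ y′⟿ s⟿ = begin
    s * e₁               ≈⟨ *-cong s≈ (poch-split p≈b² p≈b² e₁⟿ w⟿ e₂⟿) ⟩
    e₄ * w′ * (w * e₂)   ≈⟨ solve 4 (λ e w w′ e′ → e :* w′ :* (w :* e′) := (w :* w′) :* e :* e′) refl e₄ w
      w′ e₂ ⟩
    (w * w′) * e₄ * e₂   ≈⟨ *-congʳ (*-congʳ (poch-conjugate refl p≈b² c≈p² w⟿ w′⟿ x⟿)) ⟩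
    x * e₄ * e₂          ≈⟨ *-congʳ (poch-split c≈p² c≈p² e₂⟿ x⟿ e₄⟿) ⟨
    e₂ * e₂              ∎
    where
    s≈ : s ≈ e₄ * w′
    s≈ = trans
      (sym (jacobi (sym (-‿involutive b)) (sym (-‿involutive (b ^ 3)))
        (trans c≈p² (trans (*-cong p≈b² p≈b²)
          (solve 1 (λ b → (b :* b) :* (b :* b) := (:- b) :* (:- (b :* (b :* (b :* :1))))) refl b)))
        c≼t 0<t t<1 y⟿ y′⟿ e₄⟿ s⟿))
      (*-congˡ (sym (poch-split
        (trans (solve 1 (λ b → :- (b :* (b :* (b :* :1))) := (:- b) :* (b :* b)) refl b) (*-congˡ (sym p≈b²)))
        c≈p² w′⟿ y⟿ y′⟿)))

  private
    tri≡ : ∀ n → + tri n ≡ + tri′ n ℤ.+ n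
    tri≡ (+ zero) = ≡.refl
    tri≡ (+ suc n) = ≡.trans (≡.cong +_ (tri-step n)) (≡.trans (≡.cong (ℤ._+_ (+ suc n)) (tri≡ (+ n)))
      (≡.trans (ℤS.solve 2 (λ n t → (ℤS.con ℤ.1ℤ ℤS.:+ n) ℤS.:+ (t ℤS.:+ n)
        ℤS.:= (n ℤS.:+ t) ℤS.:+ (ℤS.con ℤ.1ℤ ℤS.:+ n))
          ≡.refl (+ n) (+ tri′ (+ n)))
        (≡.cong (λ j → + j ℤ.+ + suc n) (≡.sym (tri′-step n)))))
    tri≡ -[1+ zero ] = ≡.refl
    tri≡ -[1+ suc n ] = ≡.trans (≡.cong +_ (tri-neg-step n))
      (≡.trans (≡.cong (ℤ._+_ (+ suc n)) (tri≡ -[1+ n ]))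
      (≡.trans (ℤS.solve 2 (λ n t → (ℤS.con ℤ.1ℤ ℤS.:+ n) ℤS.:+ (t ℤS.:+ (ℤS.:- (ℤS.con ℤ.1ℤ ℤS.:+ n)))
            ℤS.:= (ℤS.con (+ 2) ℤS.:+ n ℤS.:+ t) ℤS.:+ (ℤS.:- (ℤS.con (+ 2) ℤS.:+ n)))
          ≡.refl (+ n) (+ tri′ -[1+ n ]))
        (≡.cong (λ j → + j ℤ.+ -[1+ suc n ]) (≡.sym (tri′-neg-step n)))))

    2tri′≡ : ∀ n → + tri′ n ℤ.+ + tri′ n ≡ n ℤ.* (n ℤ.- ℤ.1ℤ)
    2tri′≡ (+ zero) = ≡.refl
    2tri′≡ (+ suc n) = ≡.trans (≡.cong (λ j → + j ℤ.+ + j) (tri′-step n))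
      (≡.trans (ℤS.solve 2 (λ n t → (n ℤS.:+ t) ℤS.:+ (n ℤS.:+ t) ℤS.:= (n ℤS.:+ n) ℤS.:+ (t ℤS.:+ t))
        ≡.refl (+ n) (+ tri′ (+ n)))
      (≡.trans (≡.cong (λ j → + n ℤ.+ + n ℤ.+ j) (2tri′≡ (+ n)))
        (ℤS.solve 1 (λ n → (n ℤS.:+ n) ℤS.:+ n ℤS.:* (n ℤS.:- ℤS.con ℤ.1ℤ)
          ℤS.:= (ℤS.con ℤ.1ℤ ℤS.:+ n) ℤS.:* ((ℤS.con ℤ.1ℤ ℤS.:+ n) ℤS.:- ℤS.con ℤ.1ℤ)) ≡.refl (+ n))))
    2tri′≡ -[1+ zero ] = ≡.refl
    2tri′≡ -[1+ suc n ] = ≡.trans (≡.cong (λ j → + j ℤ.+ + j) (tri′-neg-step n))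
      (≡.trans (ℤS.solve 2 (λ n t → (n ℤS.:+ t) ℤS.:+ (n ℤS.:+ t) ℤS.:= (n ℤS.:+ n) ℤS.:+ (t ℤS.:+ t))
        ≡.refl (+ (2 ℕ.+ n)) (+ tri′ -[1+ n ]))
      (≡.trans (≡.cong (λ j → + (2 ℕ.+ n) ℤ.+ + (2 ℕ.+ n) ℤ.+ j) (2tri′≡ -[1+ n ]))
        (ℤS.solve 1 (λ n → let k = ℤS.con (+ 2) ℤS.:+ n ; m = ℤS.:- (ℤS.con ℤ.1ℤ ℤS.:+ n) in
          (k ℤS.:+ k) ℤS.:+ m ℤS.:* (m ℤS.:- ℤS.con ℤ.1ℤ)
          ℤS.:= (ℤS.:- k) ℤS.:* ((ℤS.:- k) ℤS.:- ℤS.con ℤ.1ℤ)) ≡.refl (+ n))))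

  module Monomials (pow : ℤ → Carrier)
    (pow-homo : ∀ i j → pow (i ℤ.+ j) ≈ pow i * pow j) (pow-0 : pow ℤ.0ℤ ≈ 1#) where

    private
      module Sign = IntegerPower {r = - 1#} {s = - 1#}
        (solve 0 ((:- :1) :* (:- :1) := :1) refl)

    abstract
      sign : ℤ → Carrier
      sign = Sign.pow

      sign-homo : ∀ i j → sign (i ℤ.+ j) ≈ sign i * sign j
      sign-homo = Sign.pow-homo

      sign-0 : sign ℤ.0ℤ ≈ 1#
      sign-0 = refl

      sign-1 : sign ℤ.1ℤ ≈ - 1#
      sign-1 = *-identityʳ _

      sign-ℕ : ∀ n → (- 1#) ^ n ≈ sign (+ n)
      sign-ℕ n = refl

      sign-square : ∀ k → sign k * sign k ≈ 1#
      sign-square (+ n)    = power n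
        where
        power : ∀ n → (- 1#) ^ n * (- 1#) ^ n ≈ 1#
        power zero    = *-identityˡ 1#
        power (suc n) = trans (solve 1 (λ z → (:- :1 :* z) :* (:- :1 :* z) := z :* z) refl ((- 1#) ^ n))
          (power n)
      sign-square -[1+ n ] = sign-square (+ suc n)

    sign-+2 : ∀ i k → sign (i ℤ.+ (k ℤ.+ k)) ≈ sign i
    sign-+2 i k = trans (sign-homo i (k ℤ.+ k)) (trans (*-congˡ (trans (sign-homo k k) (sign-square k)))
      (*-identityʳ _))

    abstract
      mono : ℤ → ℤ → Carrier
      mono i j = sign i * pow j

      mono-def : ∀ i j → mono i j ≈ sign i * pow j
      mono-def i j = refl

      mono-* : ∀ i j i′ j′ → mono i j * mono i′ j′ ≈ mono (i ℤ.+ i′) (j ℤ.+ j′)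
      mono-* i j i′ j′ = trans (solve 4 (λ a b x y → (a :* b) :* (x :* y) := (a :* x) :* (b :* y)) refl _
        _ _ _)
        (*-cong (sym (sign-homo i i′)) (sym (pow-homo j j′)))

      mono-cong : ∀ {i i′ j j′} k → i ≡ i′ ℤ.+ (k ℤ.+ k) → j ≡ j′ → mono i j ≈ mono i′ j′
      mono-cong {i′ = i′} k ≡.refl ≡.refl = *-congʳ (sign-+2 i′ k)

    mono-0 : ∀ j → mono ℤ.0ℤ j ≈ pow j
    mono-0 j = trans (mono-def _ j) (trans (*-congʳ sign-0) (*-identityˡ _))

    mono-1 : ∀ j → mono ℤ.1ℤ j ≈ - pow j
    mono-1 j = trans (mono-def _ j) (trans (*-congʳ sign-1)
      (solve 1 (λ x → (:- :1) :* x := :- x) refl (pow j)))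

    private
      pow-^ : ∀ x n → pow x ^ n ≈ pow (x ℤ.* + n)
      pow-^ x zero    = sym (trans (reflexive (≡.cong pow (ℤₚ.*-zeroʳ x))) pow-0)
      pow-^ x (suc n) = trans (*-congˡ (pow-^ x n)) (trans (sym (pow-homo x (x ℤ.* + n)))
        (reflexive (≡.cong pow (≡.sym (ℤₚ.*-suc x (+ n))))))

      exponent : ∀ x y d n → x ℤ.+ y ≡ d ℤ.+ d →
        x ℤ.* + tri n ℤ.+ y ℤ.* + tri′ n ≡ d ℤ.* (n ℤ.* (n ℤ.- ℤ.1ℤ)) ℤ.+ x ℤ.* n
      exponent x y d n x+y≡2d = ≡.trans (≡.cong (λ j → x ℤ.* j ℤ.+ y ℤ.* + tri′ n) (tri≡ n))
        (≡.trans (ℤS.solve 4 (λ x y t n → x ℤS.:* (t ℤS.:+ n) ℤS.:+ y ℤS.:* t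
          ℤS.:= (x ℤS.:+ y) ℤS.:* t ℤS.:+ x ℤS.:* n)
            ≡.refl x y (+ tri′ n) n)
        (≡.cong (ℤ._+ x ℤ.* n) (≡.trans (≡.cong (ℤ._* (+ tri′ n)) x+y≡2d)
          (≡.trans (ℤS.solve 2 (λ d t → (d ℤS.:+ d) ℤS.:* t ℤS.:= d ℤS.:* (t ℤS.:+ t)) ≡.refl d (+ tri′ n))
            (≡.cong (d ℤ.*_) (2tri′≡ n))))))

      neg-^ : ∀ x n → (- x) ^ n ≈ (- 1#) ^ n * x ^ n
      neg-^ x n = trans (^-congˡ n (solve 1 (λ x → :- x := (:- :1) :* x) refl x)) (^-distrib-* (- 1#) x n)

      positive-exponents : ∀ x y d → x ℤ.+ y ≡ d ℤ.+ d → ∀ n →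
        pow x ^ tri n * pow y ^ tri′ n ≈ pow (d ℤ.* (n ℤ.* (n ℤ.- ℤ.1ℤ)) ℤ.+ x ℤ.* n)
      positive-exponents x y d e n = trans (*-cong (pow-^ x (tri n)) (pow-^ y (tri′ n)))
        (trans (sym (pow-homo (x ℤ.* + tri n) (y ℤ.* + tri′ n)))
          (reflexive (≡.cong pow (exponent x y d n e))))

    θ-mono⁺ : ∀ x y d → x ℤ.+ y ≡ d ℤ.+ d → ∀ n →
      θ (pow x) (pow y) n ≈ mono ℤ.0ℤ (d ℤ.* (n ℤ.* (n ℤ.- ℤ.1ℤ)) ℤ.+ x ℤ.* n)
    θ-mono⁺ x y d e n = trans (positive-exponents x y d e n) (sym (mono-0 _))

    θ-mono⁻ : ∀ x y d → x ℤ.+ y ≡ d ℤ.+ d → ∀ n →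
      θ (- pow x) (- pow y) n ≈ mono n (d ℤ.* (n ℤ.* (n ℤ.- ℤ.1ℤ)) ℤ.+ x ℤ.* n)
    θ-mono⁻ x y d e n = trans (*-cong (neg-^ (pow x) (tri n)) (neg-^ (pow y) (tri′ n)))
      (trans (solve 4 (λ a b x y → (a :* b) :* (x :* y) := (a :* x) :* (b :* y)) refl _ _ _ _)
        (trans (*-cong signs (positive-exponents x y d e n)) (sym (mono-def n _))))
      where
      signs : (- 1#) ^ tri n * (- 1#) ^ tri′ n ≈ sign n
      signs = trans (trans (*-cong (sign-ℕ (tri n)) (sign-ℕ (tri′ n))) (sym (sign-homo (+ tri n) (+ tri′ n))))
        (trans (reflexive (≡.cong sign (≡.trans (≡.cong (ℤ._+ (+ tri′ n)) (tri≡ n))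
            (ℤS.solve 2 (λ t n → (t ℤS.:+ n) ℤS.:+ t ℤS.:= n ℤS.:+ (t ℤS.:+ t)) ≡.refl (+ tri′ n) n))))
          (sign-+2 n (+ tri′ n)))

    module _ (K D : ℤ) {t : ∣ℝ∣} (q≼t : pow (+ 4 ℤ.* K) ≼ t) (t<1 : t <ℝ 1ℝ) where
      private
        2K = + 2 ℤ.* K

        α β : ℤ → Carrier
        α n = mono n (2K ℤ.* (n ℤ.* (n ℤ.- ℤ.1ℤ)) ℤ.+ (K ℤ.+ D) ℤ.* n)
        β n = mono n (2K ℤ.* (n ℤ.* (n ℤ.- ℤ.1ℤ)) ℤ.+ (+ 3 ℤ.* K ℤ.+ D) ℤ.* n)

        e-α : (K ℤ.+ D) ℤ.+ (+ 3 ℤ.* K ℤ.- D) ≡ 2K ℤ.+ 2K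
        e-α = ℤS.solve 2 (λ K D → (K ℤS.:+ D) ℤS.:+ (ℤS.con (+ 3) ℤS.:* K ℤS.:- D)
          ℤS.:= ℤS.con (+ 2) ℤS.:* K ℤS.:+ ℤS.con (+ 2) ℤS.:* K) ≡.refl K D
        e-β : (+ 3 ℤ.* K ℤ.+ D) ℤ.+ (K ℤ.- D) ≡ 2K ℤ.+ 2K
        e-β = ℤS.solve 2 (λ K D → (ℤS.con (+ 3) ℤS.:* K ℤS.:+ D) ℤS.:+ (K ℤS.:- D)
          ℤS.:= ℤS.con (+ 2) ℤS.:* K ℤS.:+ ℤS.con (+ 2) ℤS.:* K) ≡.refl K D
        e-γ : D ℤ.+ (+ 2 ℤ.* K ℤ.- D) ≡ K ℤ.+ K
        e-γ = ℤS.solve 2 (λ K D → D ℤS.:+ (ℤS.con (+ 2) ℤS.:* K ℤS.:- D) ℤS.:= K ℤS.:+ K) ≡.refl K D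

        decays : ∀ x y {g : ℤ → Carrier} → x ℤ.+ y ≡ 2K ℤ.+ 2K → (∀ n → θ (- pow x) (- pow y) n ≈ g n) →
          ∃[ C ] DecaysQuickly g C
        decays x y e θ≈g =
          let C , θ≼ = θ-decays {a = - pow x} {b = - pow y} (≼-cong
                (trans (reflexive (≡.cong pow (≡.sym
                  (≡.trans e (ℤS.solve 1 (λ K → ℤS.con (+ 2) ℤS.:* K ℤS.:+ ℤS.con (+ 2) ℤS.:* K
                    ℤS.:= ℤS.con (+ 4) ℤS.:* K) ≡.refl K)))))
                  (trans (pow-homo x y) (sym (-x*-y _ _)))) R.refl q≼t) t<1
          in C , λ n → ≼-cong (θ≈g n) R.refl (θ≼ n)

        α-decays = decays (K ℤ.+ D) (+ 3 ℤ.* K ℤ.- D) e-α (θ-mono⁻ (K ℤ.+ D) (+ 3 ℤ.* K ℤ.- D) 2K e-α)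
        β-decays = decays (+ 3 ℤ.* K ℤ.+ D) (K ℤ.- D) e-β (θ-mono⁻ (+ 3 ℤ.* K ℤ.+ D) (K ℤ.- D) 2K e-β)

        αα : ∀ {i} (iγ iδ : ℤ → ℤ) k m n → i ≡ ℤ.0ℤ → m ℤ.+ n ≡ iγ (m ℤ.+ n) ℤ.+ iδ (m ℤ.- n) ℤ.+ (k ℤ.+ k) →
          mono i ℤ.0ℤ * (α m * α n)
          ≈ mono (iγ (m ℤ.+ n)) (K ℤ.* ((m ℤ.+ n) ℤ.* ((m ℤ.+ n) ℤ.- ℤ.1ℤ)) ℤ.+ D ℤ.* (m ℤ.+ n))
            * mono (iδ (m ℤ.- n)) (K ℤ.* ((m ℤ.- n) ℤ.* ((m ℤ.- n) ℤ.- ℤ.1ℤ)) ℤ.+ K ℤ.* (m ℤ.- n))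
        αα {i} iγ iδ k m n ≡.refl e = trans (trans (*-congˡ (mono-* _ _ _ _)) (mono-* _ _ _ _))
          (trans (mono-cong k (≡.trans (ℤₚ.+-identityˡ (m ℤ.+ n)) e)
            (ℤS.solve 4 (λ K D m n → let 1ℤ = ℤS.con ℤ.1ℤ ; 2K = ℤS.con (+ 2) ℤS.:* K in
              ℤS.con ℤ.0ℤ ℤS.:+ ((2K ℤS.:* (m ℤS.:* (m ℤS.:- 1ℤ)) ℤS.:+ (K ℤS.:+ D) ℤS.:* m)
                ℤS.:+ (2K ℤS.:* (n ℤS.:* (n ℤS.:- 1ℤ)) ℤS.:+ (K ℤS.:+ D) ℤS.:* n))
              ℤS.:= (K ℤS.:* ((m ℤS.:+ n) ℤS.:* ((m ℤS.:+ n) ℤS.:- 1ℤ)) ℤS.:+ D ℤS.:* (m ℤS.:+ n))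
                ℤS.:+ (K ℤS.:* ((m ℤS.:- n) ℤS.:* ((m ℤS.:- n) ℤS.:- 1ℤ)) ℤS.:+ K ℤS.:* (m ℤS.:- n)))
              ≡.refl K D m n))
            (sym (mono-* _ _ _ _)))

        ββ : ∀ i (iγ iδ : ℤ → ℤ) k m n → i ℤ.+ (m ℤ.+ n) ≡ iγ (ℤ.1ℤ ℤ.+ (m ℤ.+ n)) ℤ.+ iδ (m ℤ.- n) ℤ.+
          (k ℤ.+ k) →
          let u = ℤ.1ℤ ℤ.+ (m ℤ.+ n) in
          mono i D * (β m * β n)
          ≈ mono (iγ u) (K ℤ.* (u ℤ.* (u ℤ.- ℤ.1ℤ)) ℤ.+ D ℤ.* u)
            * mono (iδ (m ℤ.- n)) (K ℤ.* ((m ℤ.- n) ℤ.* ((m ℤ.- n) ℤ.- ℤ.1ℤ)) ℤ.+ K ℤ.* (m ℤ.- n))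
        ββ i iγ iδ k m n e = trans (trans (*-congˡ (mono-* _ _ _ _)) (mono-* _ _ _ _))
          (trans (mono-cong k e
            (ℤS.solve 4 (λ K D m n → let 1ℤ = ℤS.con ℤ.1ℤ ; 2K = ℤS.con (+ 2) ℤS.:* K ; u = 1ℤ ℤS.:+ (m ℤS.:+ n)
                                         3K+D = ℤS.con (+ 3) ℤS.:* K ℤS.:+ D in
              D ℤS.:+ ((2K ℤS.:* (m ℤS.:* (m ℤS.:- 1ℤ)) ℤS.:+ 3K+D ℤS.:* m)
                ℤS.:+ (2K ℤS.:* (n ℤS.:* (n ℤS.:- 1ℤ)) ℤS.:+ 3K+D ℤS.:* n))
              ℤS.:= (K ℤS.:* (u ℤS.:* (u ℤS.:- 1ℤ)) ℤS.:+ D ℤS.:* u)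
                ℤS.:+ (K ℤS.:* ((m ℤS.:- n) ℤS.:* ((m ℤS.:- n) ℤS.:- 1ℤ)) ℤS.:+ K ℤS.:* (m ℤS.:- n)))
              ≡.refl K D m n))
            (sym (mono-* _ _ _ _)))

        mono-00 : mono ℤ.0ℤ ℤ.0ℤ ≈ 1#
        mono-00 = trans (mono-0 ℤ.0ℤ) pow-0

      module ThetaSquares {A B : Carrier}
        (A⟶ : θ (- pow (K ℤ.+ D)) (- pow (+ 3 ℤ.* K ℤ.- D)) sumsTo A)
        (B⟶ : θ (- pow (+ 3 ℤ.* K ℤ.+ D)) (- pow (K ℤ.- D)) sumsTo B) where

        private
          α⟶ = sumsTo-cong (θ-mono⁻ (K ℤ.+ D) (+ 3 ℤ.* K ℤ.- D) 2K e-α) refl A⟶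
          β⟶ = sumsTo-cong (θ-mono⁻ (+ 3 ℤ.* K ℤ.+ D) (K ℤ.- D) 2K e-β) refl B⟶

        difference-of-squares : ∀ {Φ F} → θ (pow K) (pow K) sumsTo Φ →
          θ (- pow D) (- pow (+ 2 ℤ.* K ℤ.- D)) sumsTo F → A * A - pow D * (B * B) ≈ Φ * F
        difference-of-squares {Φ} {F} Φ⟶ F⟶ = begin
          A * A - pow D * (B * B)
            ≈⟨ solve 3 (λ a b p → a :- p :* b := :1 :* a :+ (:- p) :* b) refl (A * A) (B * B) (pow D) ⟩
          1# * (A * A) + (- pow D) * (B * B)
            ≈⟨ +-cong (*-congʳ mono-00) (*-congʳ (mono-1 D)) ⟨
          mono ℤ.0ℤ ℤ.0ℤ * (A * A) + mono ℤ.1ℤ D * (B * B)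
            ≈⟨ sum-of-squares _ _ (proj₂ α-decays) (proj₂ β-decays)
                 (sumsTo-cong (θ-mono⁻ D (2K ℤ.- D) K e-γ) refl F⟶)
                   (sumsTo-cong (θ-mono⁺ K K K ≡.refl) refl Φ⟶) α⟶ β⟶
                 (λ m n → αα (λ j → j) (λ _ → ℤ.0ℤ) ℤ.0ℤ m n ≡.refl
                   (ℤS.solve 1 (λ u → u ℤS.:= u ℤS.:+ ℤS.con ℤ.0ℤ ℤS.:+ ℤS.con ℤ.0ℤ) ≡.refl (m ℤ.+ n)))
                 (λ m n → ββ ℤ.1ℤ (λ j → j) (λ _ → ℤ.0ℤ) ℤ.0ℤ m n
                   (ℤS.solve 1 (λ u → u ℤS.:= u ℤS.:+ ℤS.con ℤ.0ℤ ℤS.:+ ℤS.con ℤ.0ℤ) ≡.refl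
                     (ℤ.1ℤ ℤ.+ (m ℤ.+ n)))) ⟩
          F * Φ ≈⟨ *-comm F Φ ⟩
          Φ * F ∎

        sum-of-theta-squares : ∀ {Φ F} → θ (- pow K) (- pow K) sumsTo Φ →
          θ (pow D) (pow (+ 2 ℤ.* K ℤ.- D)) sumsTo F → A * A + pow D * (B * B) ≈ Φ * F
        sum-of-theta-squares {Φ} {F} Φ⟶ F⟶ = begin
          A * A + pow D * (B * B)
            ≈⟨ +-cong (trans (*-congʳ mono-00) (*-identityˡ _)) (*-congʳ (mono-0 D)) ⟨
          mono ℤ.0ℤ ℤ.0ℤ * (A * A) + mono ℤ.0ℤ D * (B * B)
            ≈⟨ sum-of-squares _ _ (proj₂ α-decays) (proj₂ β-decays)
                 (sumsTo-cong (θ-mono⁺ D (2K ℤ.- D) K e-γ) refl F⟶)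
                   (sumsTo-cong (θ-mono⁻ K K K ≡.refl) refl Φ⟶) α⟶ β⟶
                 (λ m n → αα (λ _ → ℤ.0ℤ) (λ j → j) n m n ≡.refl (parity m n))
                 (λ m n → ββ ℤ.0ℤ (λ _ → ℤ.0ℤ) (λ j → j) n m n
                   (≡.trans (ℤₚ.+-identityˡ (m ℤ.+ n)) (parity m n))) ⟩
          F * Φ ≈⟨ *-comm F Φ ⟩
          Φ * F ∎
          where
          parity : ∀ m n → m ℤ.+ n ≡ ℤ.0ℤ ℤ.+ (m ℤ.- n) ℤ.+ (n ℤ.+ n)
          parity = ℤS.solve 2 (λ m n → m ℤS.:+ n ℤS.:= ℤS.con ℤ.0ℤ ℤS.:+ (m ℤS.:- n) ℤS.:+ (n ℤS.:+ n)) ≡.refl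

module ComplexNumbers {c ℓ₁ ℓ₂ : Level} (ℝ : RealField c ℓ₁ ℓ₂) where
  open Analysis ℝ
  open Order ℝ
  open RealLemmas ℝ
  private
    module R = RealField ℝ
    module S = Solve R.commutativeRing
    module Z = CommutativeRing ℂ-commutativeRing
  open R using () renaming (_<_ to _<ℝ_; 0# to 0ℝ; 1# to 1ℝ)

  private
    ≤∧≥⇒≈0 : ∀ {x} → x ≤ 0ℝ → 0ℝ ≤ x → x R.≈ 0ℝ
    ≤∧≥⇒≈0 {x} x≤0 0≤x = proj₁ (R.tight x 0ℝ) λ x#0 → case (Equivalence.to R.#⇔<⊎> x#0)
      where
      case : _ → _
      case (inj₁ x<0) = 0≤x x<0
      case (inj₂ 0<x) = x≤0 0<x

    -x≤0⇒0≤x : ∀ {x} → R.- x ≤ 0ℝ → 0ℝ ≤ x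
    -x≤0⇒0≤x {x} h x<0 = h (x<0⇒0<-x x<0)

    ≼0⇒≈0 : ∀ {z} → z ≼ 0ℝ → z ≈ 0#
    ≼0⇒≈0 h = ≤∧≥⇒≈0 (≼⇒re≤ h) (-x≤0⇒0≤x (≼⇒re≤ (≼-neg h)))
            , ≤∧≥⇒≈0 (≼⇒im≤ h) (-x≤0⇒0≤x (≼⇒im≤ (≼-neg h)))

    closed : ∀ {z t} → 0ℝ ≤ t → (∀ ε → 0ℝ <ℝ ε → z ≼ t R.+ ε) → z ≼ t
    closed {z} {t} 0≤t z≼ = 0≤t , λ t²<w →
      let w = ∣ z ∣²
          0<δ = x<y⇒0<y-x t²<w
          δ = w R.- t R.* t
          η , 0<η , η≤1 , Cη≤½δ = small-multiple {C = t R.+ t R.+ 1ℝ}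
            (+-nonneg (+-nonneg 0≤t 0≤t) (<⇒≤ 0<1)) (R.*-pos 0<½ 0<δ)
          w≤ : w ≤ t R.* t R.+ ½ R.* δ
          w≤ = ≤-trans (_≼_.≤t*t (z≼ η 0<η)) (≤-resp
            (S.solve 2 (λ t e → (t S.:* t S.:+ (t S.:+ t) S.:* e) S.:+ e S.:* e
              S.:= (t S.:+ e) S.:* (t S.:+ e)) R.refl t η)
            R.refl
            (≤-trans (+-mono-≤ ≤-refl (≤-resp R.refl (R.*-identityˡ η) (*-monoˡ-≤ (<⇒≤ 0<η) η≤1)))
              (≤-resp (S.solve 2 (λ t e → t S.:* t S.:+ (t S.:+ t S.:+ S.:1) S.:* e
                  S.:= (t S.:* t S.:+ (t S.:+ t) S.:* e) S.:+ e) R.refl t η) R.refl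
                (+-mono-≤ ≤-refl Cη≤½δ))))
      in w≤ (<-resp (R.+-comm _ _)
           (S.solve 2 (λ t w → (w S.:- t) S.:+ t S.:= w) R.refl (t R.* t) w)
           (R.+-monoˡ-< (t R.* t) (<-resp (R.*-comm _ _) (R.*-identityʳ δ)
             (0<y-x⇒x<y (<-resp R.refl (S.solve 2
               (λ d h → d S.:* (S.:1 S.:- h) S.:= d S.:* S.:1 S.:- d S.:* h) R.refl δ ½)
               (R.*-pos 0<δ (x<y⇒0<y-x ½<1)))))))

    square-≤ : ∀ {u ε} → u <ℝ ε → R.- u <ℝ ε → u R.* u ≤ ε R.* ε
    square-≤ {u} {ε} u<ε -u<ε = 0≤y-x⇒x≤y (<⇒≤ (<-resp R.refl
      (S.solve 2 (λ u e → (e S.:- u) S.:* (e S.:- (S.:- u)) S.:= e S.:* e S.:- u S.:* u) R.refl u ε)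
      (R.*-pos (x<y⇒0<y-x u<ε) (x<y⇒0<y-x -u<ε))))

    components≼ : ∀ {u v ε} → 0ℝ <ℝ ε → u <ℝ ε → R.- u <ℝ ε → v <ℝ ε → R.- v <ℝ ε → (u +i v) ≼ ε R.+ ε
    components≼ {u} {v} {ε} 0<ε u<ε -u<ε v<ε -v<ε = +-nonneg (<⇒≤ 0<ε) (<⇒≤ 0<ε) ,
      ≤-trans (+-mono-≤ (square-≤ u<ε -u<ε) (square-≤ v<ε -v<ε))
        (≤-resp R.refl (S.solve 1 (λ e → (e S.:* e S.:+ e S.:* e) S.:+ (e S.:* e S.:+ e S.:* e)
            S.:= (e S.:+ e) S.:* (e S.:+ e)) R.refl ε)
          (x≤x+y (+-nonneg (sq-nonneg ε) (sq-nonneg ε))))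

  lim-converges : ∀ s (h : Cauchyℂ s) ε → 0ℝ <ℝ ε → ∃[ M ] (∀ n → M ℕ.≤ n → s n - lim s h ≼ ε)
  lim-converges s (cre , cim) ε 0<ε =
    let δ = ½ R.* ε
        0<δ = R.*-pos 0<½ 0<ε
        M  , hre = proj₂ (R.complete (re ∘ s) cre) δ 0<δ
        M′ , him = proj₂ (R.complete (im ∘ s) cim) δ 0<δ
        flip : ∀ x y → y R.- x R.≈ R.- (x R.- y)
        flip x y = S.solve 2 (λ x y → y S.:- x S.:= S.:- (x S.:- y)) R.refl x y
    in M ℕ.+ M′ , λ n M+M′≤n →
      let u< , -u< = hre n (ℕₚ.≤-trans (ℕₚ.m≤m+n M M′) M+M′≤n)
          v< , -v< = him n (ℕₚ.≤-trans (ℕₚ.m≤n+m M′ M) M+M′≤n)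
      in ≼-cong Z.refl (½*x+½*x ε)
        (components≼ 0<δ u< (<-resp (flip _ _) R.refl -u<) v< (<-resp (flip _ _) R.refl -v<))

  private
    complete : ∀ (s : ℕ → ℂ) C → (∀ n → s (suc n) - s n ≼ C R.* ½ R.^ n) →
      ∃[ z ] (∀ ε → 0ℝ <ℝ ε → ∃[ M ] (∀ n → M ℕ.≤ n → s n - z ≼ ε))
    complete s C step = lim s cauchy , lim-converges s cauchy
      where
      0≤C : 0ℝ ≤ C
      0≤C = ≤-resp R.refl (R.*-identityʳ C) (_≼_.0≤t (step 0))
      cauchy : Cauchyℂ s
      cauchy = telescope-Cauchy s (λ n → (C R.+ C) R.* ½ R.^ n)
        (λ n → ≼-cong Z.refl
          (R.trans (S.solve 2 (λ c p → c S.:* p S.:= (c S.:+ c) S.:* p S.:- c S.:* (S.:1 S.:* p)) R.refl C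
            (½ R.^ n))
            (R.+-congˡ (R.-‿cong (R.trans (R.*-congˡ (R.*-congʳ (R.sym ½+½≈1)))
              (S.solve 3 (λ c h p → c S.:* ((h S.:+ h) S.:* p) S.:= (c S.:+ c) S.:* (h S.:* p)) R.refl C ½
                (½ R.^ n))))))
          (step n))
        (λ n → *-nonneg (+-nonneg 0≤C 0≤C) (^-nonneg (<⇒≤ 0<½) n))
        (λ ε 0<ε → geometric-small (<⇒≤ 0<½) ½<1 (+-nonneg 0≤C 0≤C) 0<ε)

  ℂ-normedRing : NormedRing ℝ
  ℂ-normedRing = record
    { commutativeRing = ℂ-commutativeRing ; _≼_ = _≼_ ; ≼⇒0≤ = _≼_.0≤t ; ≼-cong = ≼-cong
    ; ≼-weaken = ≼-weaken ; ≼-* = ≼-* ; ≼-neg = ≼-neg ; ≼-+ = ≼-+ ; ≼-zero = ≼-zero ; ≼-one = ≼-one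
    ; ≼-bound = λ z → bound z , ≼-bound z ; ≼-closed = closed ; ≼-zero⇒≈0 = ≼0⇒≈0 ; ≼-complete = complete }

  0<re⇒≉0 : ∀ {z} → 0ℝ <ℝ re z → z ≉0
  0<re⇒≉0 {z} 0<x = <-≤-trans (R.*-pos 0<x 0<x) (x≤x+y (sq-nonneg (im z)))

  1-z-≉0 : ∀ {z} → ∣ z ∣<1 → (1# - z) ≉0
  1-z-≉0 {z} z<1 = 0<re⇒≉0 {1# - z} (x<y⇒0<y-x (≤-<-trans (≼⇒re≤ (≼-σ z)) (σ<1 z<1)))

  near-1-≉0 : ∀ {z} → z - 1# ≼ ½ → z ≉0
  near-1-≉0 {z} h = 0<re⇒≉0 {z} (<-resp R.refl
    (S.solve 1 (λ x → S.:1 S.:- (S.:- (x S.:- S.:1)) S.:= x) R.refl (re z))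
    (x<y⇒0<y-x (≤-<-trans (≼⇒re≤ (≼-neg h)) ½<1)))

  0<σ : ∀ z → 0ℝ <ℝ σ z
  0<σ z = R.*-pos 0<½ (<-≤-trans 0<1 (x≤x+y (∣∣²-nonneg z)))

  open Limits ℂ-normedRing

  partialSum≡psum : ∀ u n → partialSum u n ≡ psum u n
  partialSum≡psum u zero    = ≡.refl
  partialSum≡psum u (suc n) = ≡.cong (_+ u n) (partialSum≡psum u n)

  partialProduct≡pprod : ∀ u n → partialProduct u n ≡ pprod u n
  partialProduct≡pprod u zero    = ≡.refl
  partialProduct≡pprod u (suc n) = ≡.cong (_* u n) (partialProduct≡pprod u n)

module QuotientIdentities {c ℓ : Level} (R : CommutativeRing c ℓ) where
  open CommutativeRing R
  open Solve R
  open import Relation.Binary.Reasoning.Setoid setoid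

  quotient-scale : ∀ {n d d⁻¹ n′ d′ d′⁻¹ p} → d * d⁻¹ ≈ 1# → d′ * d′⁻¹ ≈ 1# → n′ ≈ p * n → d′ ≈ p * d →
    n * d⁻¹ ≈ n′ * d′⁻¹
  quotient-scale {n} {d} {d⁻¹} {n′} {d′} {d′⁻¹} {p} dd⁻¹≈1 d′d′⁻¹≈1 n′≈pn d′≈pd = begin
    n * d⁻¹                          ≈⟨ *-identityʳ _ ⟨
    n * d⁻¹ * 1#                     ≈⟨ *-congˡ (trans (*-congʳ (sym d′≈pd)) d′d′⁻¹≈1) ⟨
    n * d⁻¹ * (p * d * d′⁻¹)         ≈⟨ solve 5 (λ n i p d j → n :* i :* (p :* d :* j)
                                          := (p :* n) :* j :* (d :* i)) refl n d⁻¹ p d d′⁻¹ ⟩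
    p * n * d′⁻¹ * (d * d⁻¹)         ≈⟨ *-congˡ dd⁻¹≈1 ⟩
    p * n * d′⁻¹ * 1#                ≈⟨ *-identityʳ _ ⟩
    p * n * d′⁻¹                     ≈⟨ *-congʳ n′≈pn ⟨
    n′ * d′⁻¹                        ∎

  divide : ∀ {x y z z⁻¹} → z * z⁻¹ ≈ 1# → x * z ≈ y → x ≈ y * z⁻¹
  divide {x} {y} {z} {z⁻¹} zz⁻¹≈1 xz≈y = begin
    x                ≈⟨ *-identityʳ x ⟨
    x * 1#           ≈⟨ *-congˡ zz⁻¹≈1 ⟨
    x * (z * z⁻¹)    ≈⟨ *-assoc x z z⁻¹ ⟨
    x * z * z⁻¹      ≈⟨ *-congʳ xz≈y ⟩
    y * z⁻¹          ∎

  module Quotients {s r n d d⁻¹ T⁻¹ ψ F e p A B : Carrier} (s²≈r : s * s ≈ r) (dd⁻¹≈1 : d * d⁻¹ ≈ 1#)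
    (TT⁻¹≈1 : s * (n * d⁻¹) * T⁻¹ ≈ 1#) (ψe≈p² : ψ * e ≈ p * p) (F≈ : F ≈ e * (n * d))
    (A≈ : A ≈ p * d) (B≈ : B ≈ p * n) where
    private
      T = s * (n * d⁻¹)
      Δ = s * ψ * F

      Δ≈ : Δ ≈ s * (p * p) * (n * d)
      Δ≈ = begin
        s * ψ * F                 ≈⟨ *-congˡ F≈ ⟩
        s * ψ * (e * (n * d))     ≈⟨ solve 4 (λ s ψ e m → s :* ψ :* (e :* m) := s :* (ψ :* e) :* m) refl s
          ψ e (n * d) ⟩
        s * (ψ * e) * (n * d)     ≈⟨ *-congʳ (*-congˡ ψe≈p²) ⟩
        s * (p * p) * (n * d)     ∎

    reciprocal-part : 1# * T⁻¹ * Δ ≈ A * A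
    reciprocal-part = begin
      1# * T⁻¹ * Δ                                 ≈⟨ *-congˡ Δ≈ ⟩
      1# * T⁻¹ * (s * (p * p) * (n * d))           ≈⟨ *-identityʳ _ ⟨
      1# * T⁻¹ * (s * (p * p) * (n * d)) * 1#      ≈⟨ *-congˡ dd⁻¹≈1 ⟨
      1# * T⁻¹ * (s * (p * p) * (n * d)) * (d * d⁻¹)
        ≈⟨ solve 6 (λ s p n d i j → :1 :* j :* (s :* (p :* p) :* (n :* d)) :* (d :* i)
             := (s :* (n :* i) :* j) :* ((p :* d) :* (p :* d))) refl s p n d d⁻¹ T⁻¹ ⟩
      T * T⁻¹ * ((p * d) * (p * d))                ≈⟨ *-cong TT⁻¹≈1 (*-cong (sym A≈) (sym A≈)) ⟩
      1# * (A * A)                                 ≈⟨ *-identityˡ _ ⟩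
      A * A                                        ∎

    direct-part : T * Δ ≈ r * (B * B)
    direct-part = begin
      T * Δ                                        ≈⟨ *-congˡ Δ≈ ⟩
      T * (s * (p * p) * (n * d))
        ≈⟨ solve 5 (λ s p n d i → s :* (n :* i) :* (s :* (p :* p) :* (n :* d))
             := (d :* i) :* ((s :* s) :* ((p :* n) :* (p :* n)))) refl s p n d d⁻¹ ⟩
      (d * d⁻¹) * ((s * s) * ((p * n) * (p * n)))  ≈⟨ *-cong dd⁻¹≈1 (*-cong s²≈r (*-cong (sym B≈) (sym B≈))) ⟩
      1# * (r * (B * B))                           ≈⟨ *-identityˡ _ ⟩
      r * (B * B)                                  ∎

    difference-quotient : ∀ {X Δ⁻¹} → Δ * Δ⁻¹ ≈ 1# → A * A - r * (B * B) ≈ X → 1# * T⁻¹ - T ≈ X * Δ⁻¹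
    difference-quotient ΔΔ⁻¹≈1 ≈X = divide ΔΔ⁻¹≈1 (trans
      (solve 3 (λ x y z → (x :- y) :* z := x :* z :- y :* z) refl _ _ _)
      (trans (+-cong reciprocal-part (-‿cong direct-part)) ≈X))

    sum-quotient : ∀ {X Δ⁻¹} → Δ * Δ⁻¹ ≈ 1# → A * A + r * (B * B) ≈ X → 1# * T⁻¹ + T ≈ X * Δ⁻¹
    sum-quotient ΔΔ⁻¹≈1 ≈X = divide ΔΔ⁻¹≈1 (trans (distribʳ _ _ _)
      (trans (+-cong reciprocal-part direct-part) ≈X))

module ComplexTheta {c ℓ₁ ℓ₂ : Level} (ℝ : RealField c ℓ₁ ℓ₂) where
  open Analysis ℝ
  open ComplexNumbers ℝ
  open Limits ℂ-normedRing
  open BilateralSums ℂ-normedRing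
  open JacobiTripleProduct ℂ-normedRing
  open ThetaSeries ℂ-normedRing
  private module Z = CommutativeRing ℂ-commutativeRing

  pochhammer-converges : ∀ a q (q<1 : ∣ q ∣<1) → poch a q ⟿ ⟨ a ⨾ q ⟩∞[ q<1 ]
  pochhammer-converges a q q<1 = ⟿-cong (λ n → Z.reflexive
    (partialProduct≡pprod (pochhammer-factor a q) n)) Z.refl
    (lim-converges (partialProduct (pochhammer-factor a q)) (pochhammer-Cauchy a q q<1))

  f-sum : ∀ a b (ab<1 : ∣ a * b ∣<1) → θ a b sumsTo f a b ab<1
  f-sum a b ab<1 = sums
    (⟿-cong (λ n → Z.reflexive (partialSum≡psum (λ n → θ a b (+ n)) n)) Z.refl
      (lim-converges (partialSum (λ n → θ-term a b (+ n))) (θ⁺-Cauchy a b ab<1)))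
    (⟿-cong (λ n → Z.reflexive (partialSum≡psum (λ n → θ a b -[1+ n ]) n)) Z.refl
      (lim-converges (partialSum (λ n → θ-term a b -[1+ n ])) (θ⁻-Cauchy a b ab<1)))
    Z.refl

  euler-≉0 : ∀ p (p<1 : ∣ p ∣<1) → ⟨ p ⨾ p ⟩∞[ p<1 ] ≉0
  euler-≉0 p p<1 = ≉0-cong {⟨ p ^ 1 ⨾ p ⟩∞[ p<1 ]} {⟨ p ⨾ p ⟩∞[ p<1 ]}
    (⟿-unique (pochhammer-converges (p ^ 1) p p<1)
      (⟿-cong (poch-cong (Z.sym (Z.*-identityʳ p)) Z.refl) Z.refl (pochhammer-converges p p p<1)))
    (go (proj₁ tail) (near-1-≉0 {tailₘ (proj₁ tail)} (proj₂ tail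
      (⟿-cong (factor (proj₁ tail)) Z.refl (pochhammer-converges (p ^ suc (proj₁ tail)) p p<1)))))
    where
    tail = euler-tail-near-1 (≼-σ p) (σ<1 p<1)
    tailₘ : ℕ → ℂ
    tailₘ m = ⟨ p ^ suc m ⨾ p ⟩∞[ p<1 ]
    factor : ∀ m n → poch (p ^ suc m) p n ≈ pprod (λ i → 1# - p ^ suc (i ℕ.+ m)) n
    factor m = euler-factors p m
    go : ∀ m → tailₘ m ≉0 → tailₘ 0 ≉0
    go zero    h = h
    go (suc m) h = go m (≉0-cong {(1# - p ^ suc m) * tailₘ (suc m)} {tailₘ m}
      (Z.sym (poch-head (Z.*-comm p (p ^ suc m)) (pochhammer-converges (p ^ suc m) p p<1)
        (pochhammer-converges (p ^ suc (suc m)) p p<1)))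
      (*-≉0 {1# - p ^ suc m} {tailₘ (suc m)} (1-z-≉0 {p ^ suc m} (<1-^ {p} p<1 m)) h))

module ThetaQuotient {c ℓ₁ ℓ₂ : Level} (ℝ : RealField c ℓ₁ ℓ₂) where
  open Theta ℝ
  open ComplexNumbers ℝ
  open ComplexTheta ℝ
  open ThetaSeries ℂ-normedRing
  private
    module Z = CommutativeRing ℂ-commutativeRing
    module ℤS = ℤSolver.+-*-Solver

  4*≡2*+2* : ∀ j → + 4 ℤ.* j ≡ + 2 ℤ.* j ℤ.+ + 2 ℤ.* j
  4*≡2*+2* = ℤS.solve 1 (λ j → ℤS.con (+ 4) ℤS.:* j ℤS.:= ℤS.con (+ 2) ℤS.:* j ℤS.:+ ℤS.con (+ 2) ℤS.:* j)
    ≡.refl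

  -- The exponents are multiplied by 4: K = k, D = 4 (2i - 1), and i here is 2 (2i - 1).
  -- As f depends on the proof of convergence, all such proofs are parameters; unification finds
  -- those of the theorem, whereas comparing them by normalisation is not feasible.
  module Identities
    (pow : ℤ → ℂ) (pow-homo : ∀ i j → pow (i ℤ.+ j) ≈ pow i * pow j) (pow-0 : pow ℤ.0ℤ ≈ 1#)
    (pow-≉0 : ∀ i → pow i ≉0) (K i D : ℤ) (D≡2i : D ≡ i ℤ.+ i)
    (q₂<1 : ∣ pow (+ 2 ℤ.* K) ∣<1) (q₄<1 : ∣ pow (+ 4 ℤ.* K) ∣<1)
    (num<1 : ∣ (- pow (K ℤ.- D)) * (- pow (+ 3 ℤ.* K ℤ.+ D)) ∣<1)
    (den<1 : ∣ (- pow (K ℤ.+ D)) * (- pow (+ 3 ℤ.* K ℤ.- D)) ∣<1)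
    (F<1 : ∣ (- pow (K ℤ.- D)) * (- pow (K ℤ.+ D)) ∣<1)
    (ψ<1 : ∣ pow (+ 2 ℤ.* K) * pow (+ 2 ℤ.* K) ^ 3 ∣<1)
    where
    private
      2K 4K : ℤ
      2K = + 2 ℤ.* K
      4K = + 4 ℤ.* K

      q₂ q₄ q₈ : ℂ
      q₂ = pow 2K
      q₄ = pow 4K
      q₈ = q₄ * q₄

      q₈<1 : ∣ q₈ ∣<1
      q₈<1 = <1-*ˡ {q₄} {q₄} q₄<1 (Order.<⇒≤ ℝ q₄<1)

      pow-+ : ∀ i j {n} → n ≡ i ℤ.+ j → pow n ≈ pow i * pow j
      pow-+ i j ≡.refl = pow-homo i j

      P e₁ : ℂ
      P = ⟨ q₄ ⨾ q₄ ⟩∞[ q₄<1 ]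
      e₁ = ⟨ q₂ ⨾ q₂ ⟩∞[ q₂<1 ]

      P≉0 : P ≉0
      P≉0 = euler-≉0 q₄ q₄<1

    T-num T-den θnum θden F ψ₀ denom : ℂ
    T-num = ⟨ pow (K ℤ.- D) ⨾ pow (+ 4 ℤ.* K) ⟩∞[ q₄<1 ] * ⟨ pow (+ 3 ℤ.* K ℤ.+ D) ⨾ pow
      (+ 4 ℤ.* K) ⟩∞[ q₄<1 ]
    T-den = ⟨ pow (K ℤ.+ D) ⨾ pow (+ 4 ℤ.* K) ⟩∞[ q₄<1 ] * ⟨ pow (+ 3 ℤ.* K ℤ.- D) ⨾ pow
      (+ 4 ℤ.* K) ⟩∞[ q₄<1 ]
    θnum = f (- pow (K ℤ.- D)) (- pow (+ 3 ℤ.* K ℤ.+ D)) num<1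
    θden = f (- pow (K ℤ.+ D)) (- pow (+ 3 ℤ.* K ℤ.- D)) den<1
    F = f (- pow (K ℤ.- D)) (- pow (K ℤ.+ D)) F<1
    ψ₀ = f (pow (+ 2 ℤ.* K)) (pow (+ 2 ℤ.* K) ^ 3) ψ<1
    denom = pow i * ψ₀ * F

    private
      num′<1 : ∣ (- pow (+ 3 ℤ.* K ℤ.+ D)) * (- pow (K ℤ.- D)) ∣<1
      num′<1 = Order.<-respˡ-≈ ℝ (∣∣²-cong (Z.*-comm (- pow (K ℤ.- D)) (- pow (+ 3 ℤ.* K ℤ.+ D)))) num<1

      θnum′ : ℂ
      θnum′ = f (- pow (+ 3 ℤ.* K ℤ.+ D)) (- pow (K ℤ.- D)) num′<1

      f⁻-product : ∀ x y (xy<1 : ∣ (- pow x) * (- pow y) ∣<1) → 4K ≡ x ℤ.+ y →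
        P * (⟨ pow x ⨾ q₄ ⟩∞[ q₄<1 ] * ⟨ pow y ⨾ q₄ ⟩∞[ q₄<1 ]) ≈ f (- pow x) (- pow y) xy<1
      f⁻-product x y xy<1 e = jacobi {a = - pow x} {b = - pow y} Z.refl Z.refl (pow-+ x y e)
        (≼-σ q₄) (0<σ q₄) (σ<1 {q₄} q₄<1)
        (pochhammer-converges (pow x) q₄ q₄<1) (pochhammer-converges (pow y) q₄ q₄<1)
        (pochhammer-converges q₄ q₄ q₄<1) (f-sum (- pow x) (- pow y) xy<1)

      θden≈ : θden ≈ P * T-den
      θden≈ = Z.sym (f⁻-product (K ℤ.+ D) (+ 3 ℤ.* K ℤ.- D) den<1
        (ℤS.solve 2 (λ K D → ℤS.con (+ 4) ℤS.:* K ℤS.:= (K ℤS.:+ D) ℤS.:+ (ℤS.con (+ 3) ℤS.:* K ℤS.:- D))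
          ≡.refl K D))

      θnum≈ : θnum ≈ P * T-num
      θnum≈ = Z.sym (f⁻-product (K ℤ.- D) (+ 3 ℤ.* K ℤ.+ D) num<1
        (ℤS.solve 2 (λ K D → ℤS.con (+ 4) ℤS.:* K ℤS.:= (K ℤS.:- D) ℤS.:+ (ℤS.con (+ 3) ℤS.:* K ℤS.:+ D))
          ≡.refl K D))

      θnum′≈ : θnum′ ≈ P * T-num
      θnum′≈ = Z.trans (Z.sym (f⁻-product (+ 3 ℤ.* K ℤ.+ D) (K ℤ.- D) num′<1
        (ℤS.solve 2 (λ K D → ℤS.con (+ 4) ℤS.:* K ℤS.:= (ℤS.con (+ 3) ℤS.:* K ℤS.:+ D) ℤS.:+ (K ℤS.:- D))
          ≡.refl K D)))
        (Z.*-congˡ {P} (Z.*-comm ⟨ pow (+ 3 ℤ.* K ℤ.+ D) ⨾ q₄ ⟩∞[ q₄<1 ] ⟨ pow (K ℤ.- D) ⨾ q₄ ⟩∞[ q₄<1 ]))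

      q₄≈q₂² : q₄ ≈ q₂ * q₂
      q₄≈q₂² = pow-+ 2K 2K (4*≡2*+2* K)

      F≈ : F ≈ e₁ * (T-num * T-den)
      F≈ = jacobi-split {x = pow (K ℤ.- D)} {y = pow (K ℤ.+ D)}
        {x′ = pow (+ 3 ℤ.* K ℤ.- D)} {y′ = pow (+ 3 ℤ.* K ℤ.+ D)} {p = q₂} {P = q₄}
        Z.refl Z.refl
        (pow-+ (K ℤ.- D) (K ℤ.+ D) (ℤS.solve 2
          (λ K D → ℤS.con (+ 2) ℤS.:* K ℤS.:= (K ℤS.:- D) ℤS.:+ (K ℤS.:+ D)) ≡.refl K D))
        q₄≈q₂²
        (pow-+ (K ℤ.- D) 2K (ℤS.solve 2 (λ K D → ℤS.con (+ 3) ℤS.:* K ℤS.:- D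
          ℤS.:= (K ℤS.:- D) ℤS.:+ ℤS.con (+ 2) ℤS.:* K) ≡.refl K D))
        (pow-+ (K ℤ.+ D) 2K (ℤS.solve 2 (λ K D → ℤS.con (+ 3) ℤS.:* K ℤS.:+ D
          ℤS.:= (K ℤS.:+ D) ℤS.:+ ℤS.con (+ 2) ℤS.:* K) ≡.refl K D))
        (≼-σ q₂) (0<σ q₂) (σ<1 {q₂} q₂<1)
        (pochhammer-converges (pow (K ℤ.- D)) q₂ q₂<1) (pochhammer-converges (pow (K ℤ.+ D)) q₂ q₂<1)
        (pochhammer-converges q₂ q₂ q₂<1)
        (pochhammer-converges (pow (K ℤ.- D)) q₄ q₄<1) (pochhammer-converges (pow (+ 3 ℤ.* K ℤ.- D)) q₄ q₄<1)
        (pochhammer-converges (pow (K ℤ.+ D)) q₄ q₄<1) (pochhammer-converges (pow (+ 3 ℤ.* K ℤ.+ D)) q₄ q₄<1)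
        (f-sum (- pow (K ℤ.- D)) (- pow (K ℤ.+ D)) F<1)

      ψe₁≈ : ψ₀ * e₁ ≈ P * P
      ψe₁≈ = gauss-ψ {b = q₂} {p = q₄} {c = q₈} q₄≈q₂² Z.refl
        (≼-σ q₈) (0<σ q₈) (σ<1 {q₈} q₈<1)
        (pochhammer-converges q₂ q₂ q₂<1) (pochhammer-converges q₄ q₄ q₄<1) (pochhammer-converges q₈ q₈ q₈<1)
        (pochhammer-converges q₂ q₄ q₄<1) (pochhammer-converges (- q₂) q₄ q₄<1)
          (pochhammer-converges q₄ q₈ q₈<1)
        (pochhammer-converges (- q₂) q₈ q₈<1) (pochhammer-converges (- (q₂ ^ 3)) q₈ q₈<1)
        (f-sum q₂ (q₂ ^ 3) ψ<1)

      ψ₀e₁≉0 : (ψ₀ * e₁) ≉0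
      ψ₀e₁≉0 = ≉0-cong {P * P} {ψ₀ * e₁} (Z.sym ψe₁≈) (*-≉0 {P} {P} P≉0 P≉0)

      ψ₀≉0 : ψ₀ ≉0
      ψ₀≉0 = *-≉0ˡ {ψ₀} {e₁} ψ₀e₁≉0

      e₁≉0 : e₁ ≉0
      e₁≉0 = *-≉0ˡ {e₁} {ψ₀} (≉0-cong {ψ₀ * e₁} {e₁ * ψ₀} (Z.*-comm ψ₀ e₁) ψ₀e₁≉0)

      module Squares = Monomials.ThetaSquares pow pow-homo pow-0 K D (≼-σ q₄)
        (σ<1 {q₄} q₄<1) {A = θden} {B = θnum′}
        (f-sum (- pow (K ℤ.+ D)) (- pow (+ 3 ℤ.* K ℤ.- D)) den<1)
        (f-sum (- pow (+ 3 ℤ.* K ℤ.+ D)) (- pow (K ℤ.- D)) num′<1)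

    module _ (num≉0 : T-num ≉0) (den≉0 : T-den ≉0) where

      θden≉0 : θden ≉0
      θden≉0 = ≉0-cong {P * T-den} {θden} (Z.sym θden≈) (*-≉0 {P} {T-den} P≉0 den≉0)

      denom≉0 : denom ≉0
      denom≉0 = *-≉0 {pow i * ψ₀} {F} (*-≉0 {pow i} {ψ₀} (pow-≉0 i) ψ₀≉0)
        (≉0-cong {e₁ * (T-num * T-den)} {F} (Z.sym F≈)
          (*-≉0 {e₁} {T-num * T-den} e₁≉0 (*-≉0 {T-num} {T-den} num≉0 den≉0)))

      Tₙ : ℂ
      Tₙ = pow i * (T-num ÷ T-den [ den≉0 ])

      T-theta : Tₙ ≈ pow i * (θnum ÷ θden [ θden≉0 ])
      T-theta = Z.*-congˡ {pow i} (QuotientIdentities.quotient-scale ℂ-commutativeRing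
        (inv-inverseʳ T-den den≉0) (inv-inverseʳ θden θden≉0) θnum≈ θden≈)

      module _ (T≉0 : Tₙ ≉0) where
        private
          module I = QuotientIdentities.Quotients ℂ-commutativeRing {s = pow i} {r = pow D}
            {n = T-num} {d = T-den} {d⁻¹ = inv T-den den≉0} {T⁻¹ = inv Tₙ T≉0}
            {ψ = ψ₀} {F = F} {e = e₁} {p = P} {A = θden} {B = θnum′}
            (Z.sym (pow-+ i i D≡2i)) (inv-inverseʳ T-den den≉0) (inv-inverseʳ Tₙ T≉0) ψe₁≈ F≈ θden≈ θnum′≈

        module _ (a<1 : ∣ pow K * pow K ∣<1) (b<1 : ∣ (- pow D) * (- pow (+ 2 ℤ.* K ℤ.- D)) ∣<1) where
          private
            Φ G : ℂ
            Φ = f (pow K) (pow K) a<1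
            G = f (- pow D) (- pow (+ 2 ℤ.* K ℤ.- D)) b<1

          difference : 1# ÷ Tₙ [ T≉0 ] - Tₙ ≈ Φ * G ÷ denom [ denom≉0 ]
          difference = I.difference-quotient {X = Φ * G} {Δ⁻¹ = inv denom denom≉0}
            (inv-inverseʳ denom denom≉0)
            (Squares.difference-of-squares {Φ = Φ} {F = G}
              (f-sum (pow K) (pow K) a<1) (f-sum (- pow D) (- pow (+ 2 ℤ.* K ℤ.- D)) b<1))

        module _ (a<1 : ∣ (- pow K) * (- pow K) ∣<1) (b<1 : ∣ pow D * pow (+ 2 ℤ.* K ℤ.- D) ∣<1) where
          private
            Φ G : ℂ
            Φ = f (- pow K) (- pow K) a<1
            G = f (pow D) (pow (+ 2 ℤ.* K ℤ.- D)) b<1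

          sum : 1# ÷ Tₙ [ T≉0 ] + Tₙ ≈ Φ * G ÷ denom [ denom≉0 ]
          sum = I.sum-quotient {X = Φ * G} {Δ⁻¹ = inv denom denom≉0}
            (inv-inverseʳ denom denom≉0)
            (Squares.sum-of-theta-squares {Φ = Φ} {F = G}
              (f-sum (- pow K) (- pow K) a<1) (f-sum (pow D) (pow (+ 2 ℤ.* K ℤ.- D)) b<1))

        identities : ∀ a<1 b<1 a′<1 b′<1 →
          (Σ[ θden≉0 ∈ θden ≉0 ] (Tₙ ≈ pow i * (θnum ÷ θden [ θden≉0 ])))
          × (Σ[ denom≉0 ∈ denom ≉0 ]
              ((1# ÷ Tₙ [ T≉0 ] - Tₙ
                  ≈ f (pow K) (pow K) a<1 * f (- pow D) (- pow (+ 2 ℤ.* K ℤ.- D)) b<1 ÷ denom [ denom≉0 ])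
              × (1# ÷ Tₙ [ T≉0 ] + Tₙ
                  ≈ f (- pow K) (- pow K) a′<1 * f (pow D) (pow (+ 2 ℤ.* K ℤ.- D)) b′<1 ÷ denom [ denom≉0 ])))
        identities a<1 b<1 a′<1 b′<1 = (θden≉0 , T-theta) , (denom≉0 , difference a<1 b<1 , sum a′<1 b′<1)

theorem1p2 : ∀ {c ℓ₁ ℓ₂ : Level} (ℝ : RealField c ℓ₁ ℓ₂) →
    let open Theta ℝ in
    (k m : ℕ) (0<k : 0 ℕ.< k) → 2 ∣ k → 1 ℕ.≤ m →
    (q q¼ : ℂ) (q≉0 : q ≉0) (q<1 : ∣ q ∣<1) (q¼^4≈q : q¼ ^ 4 ≈ q) →
    let open Quotient q q¼ q≉0 q<1 q¼^4≈q k m 0<k in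
    (num≉0 : T-numerator ≉0) (den≉0 : T-denominator ≉0) →
    let
    Tₙ    = T den≉0
    1/Tₙ  = 1# ÷ Tₙ [ T-≉0 num≉0 den≉0 ]
    θnum  = f⁻ (K ℤ.- D) (+ 3 ℤ.* K ℤ.+ D) 0<[K-D]+[3K+D]
    θden  = f⁻ (K ℤ.+ D) (+ 3 ℤ.* K ℤ.- D) 0<[K+D]+[3K-D]
    denom = q^[2i-1]/2 * ψ (q^ + 2 ℤ.* K /4) (q^/4<1 0<2K) * f⁻ (K ℤ.- D) (K ℤ.+ D) 0<[K-D]+[K+D]
    in
    (Σ[ θden≉0 ∈ θden ≉0 ] (Tₙ ≈ q^[2i-1]/2 * (θnum ÷ θden [ θden≉0 ])))
    × (Σ[ denom≉0 ∈ denom ≉0 ]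
    ((1/Tₙ - Tₙ ≈ φ (q^ K /4) (q^/4<1 0<K) * f⁻ D (+ 2 ℤ.* K ℤ.- D) 0<D+[2K-D] ÷ denom [ denom≉0 ])
    × (1/Tₙ + Tₙ ≈ φ (- q^ K /4) (neg<1 0<K) * f⁺ D (+ 2 ℤ.* K ℤ.- D) 0<D+[2K-D] ÷ denom [ denom≉0 ])))
theorem1p2 ℝ k m 0<k _ _ q q¼ q≉0 q<1 q¼^4≈q num≉0 den≉0 =
  I.identities _ _ _ _ num≉0 den≉0 _ _ _ _ _
  where
  open Theta ℝ
  open Quotient q q¼ q≉0 q<1 q¼^4≈q k m 0<k
  open ThetaQuotient ℝ using (4*≡2*+2*)
  module Z = CommutativeRing ℂ-commutativeRing
  module Pow = RingIdentities.IntegerPower ℂ-commutativeRing (inv-inverseʳ q¼ q¼≉0)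
  module I num<1 den<1 F<1 ψ<1 = ThetaQuotient.Identities ℝ q^_/4 Pow.pow-homo Z.refl q^/4-≉0
    K (+ 2 ℤ.* 2i-1) D (4*≡2*+2* 2i-1) (q^/4<1 0<2K) (q^/4<1 0<4K) num<1 den<1 F<1 ψ<1
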